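{- There is an absolute constant $K>0$ such that for all integers $r,\Delta\ge 2$ and every sequence of graphs $\mathcal{F}=\{F_1,F_2,\ldots\}$ with $\Delta(F_i)\le\Delta$ for all $i$, we have \[\tau_r(\mathcal{F})\le \exp^2\!\left(r^{K r\Delta^3}\right).\] In particular, $\tau_r(\mathcal{F})$ is finite whenever $\sup_{F\in\mathcal{F}}\Delta(F)$ is finite.
   Context: A sequence of graphs is a family $\mathcal{F}=\{F_1,F_2,\ldots\}$ where $F_i$ is a graph on exactly $i$ vertices for each $i\in\mathbb{N}$. $\Delta(F)$ denotes the maximum degree of $F$. For a graph $G$, an $\mathcal{F}$-tiling of $G$ is a collection of vertex-disjoint subgraphs of $G$, each a copy of some graph in $\mathcal{F}$, whose vertex sets together cover $V(G)$; if $G$ is edge-coloured, the tiling is monochromatic if each of its members is monochromatic. $\tau_r(\mathcal{F},n)$ is the minimum $t\in\mathbb{N}$ such that every $r$-edge-colouring of $K_n$ admits a monochromatic $\mathcal{F}$-tiling with at most $t$ members, and $\tau_r(\mathcal{F})=\sup_{n\in\mathbb{N}}\tau_r(\mathcal{F},n)$. $\exp^k$ denotes the $k$-fold composition of the exponential function. -}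

module Defs where

open import Data.Nat using (ℕ; suc; _≤_)
open import Data.Fin using (Fin)
open import Data.Bool using (Bool; true; false)
open import Data.List using (List; length; filterᵇ; allFin)
open import Data.Product using (Σ; ∃; _×_)
open import Relation.Binary.PropositionalEquality using (_≡_)
open import Function.Definitions using (Injective)

record Graph (n : ℕ) : Set where
  field
    adj     : Fin n → Fin n → Bool
    adj-sym : ∀ u v → adj u v ≡ adj v u
    irrefl  : ∀ v → adj v v ≡ false

open Graph public

degree : ∀ {n} → Graph n → Fin n → ℕ
degree G v = length (filterᵇ (adj G v) (allFin _))

MaxDegree≤ : ∀ {n} → Graph n → ℕ → Set
MaxDegree≤ G Δ = ∀ v → degree G v ≤ Δ

-- A sequence of graphs F = {F_1, F_2, ...}: F i is the graph F_{i+1},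
-- which has exactly i+1 vertices.
GraphSeq : Set
GraphSeq = (i : ℕ) → Graph (suc i)

-- An r-edge-colouring of the complete graph K_n: a symmetric colour
-- assignment to pairs of vertices (the diagonal values are irrelevant).
record Colouring (r n : ℕ) : Set where
  field
    col     : Fin n → Fin n → Fin r
    col-sym : ∀ u v → col u v ≡ col v u

open Colouring public

record Member (r n : ℕ) (F : GraphSeq) (c : Colouring r n) : Set where
  field
    index  : ℕ
    embed  : Fin (suc index) → Fin n
    embed-inj : Injective _≡_ _≡_ embed
    colour : Fin r
    mono   : ∀ u v → adj (F index) u v ≡ true → col c (embed u) (embed v) ≡ colour

open Member public

record MonoTiling (r n : ℕ) (F : GraphSeq) (c : Colouring r n) (t : ℕ) : Set where
  field
    member   : Fin t → Member r n F c
    covers   : ∀ (w : Fin n) → ∃ λ k → ∃ λ u → embed (member k) u ≡ w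
    disjoint : ∀ (k k' : Fin t) u u' →
               embed (member k) u ≡ embed (member k') u' → k ≡ k'

TauBoundedBy : ℕ → GraphSeq → ℕ → Set
TauBoundedBy r F B =
  ∀ (n : ℕ) (c : Colouring r n) → ∃ λ t → t ≤ B × MonoTiling r n F c t

{-# OPTIONS --safe #-}
module Submission where

-- All but a tiny fraction of the vertices can be tiled greedily, since a monochromatic copy of F_m with m linear in the
-- number of vertices always exists.  The rest is absorbed.  An absorber is a set Z with a flexible part Y ⊆ Z such that
-- Z minus any t-element subset of Y is spanned by a single tile: embed F_M except for a large independent set I, and use
-- a density increment to find slots in I and vertices Y whose bipartite candidate graph has no sparse square; it then
-- has a perfect matching whichever t vertices of Y are removed.
--
-- The flexible sets of successive absorbers form a chain of layers, each new one chosen among the leftover vertices that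
-- have the same majority colours to all older layers, and made dense towards them (in these colours) at the cost of only
-- a constant factor in the size of the older layers.  A leftover vertex w that sees Δ + 1 layers in some colour γ, where
-- γ is also the colour of all pairs of these layers, can be put into a γ-coloured tile together with vertices of these
-- layers.  Only the other leftover vertices are passed on to build the next layer, so the chain never contains Δ + 2
-- layers with all pairs of one colour, and by Ramsey's theorem it stops after boundedly many steps.  Finally the used
-- part of each Y is padded by one more copy to exactly t vertices and the absorber closes.

open import Defs
open import Data.Nat
open import Data.Nat.Properties
open import Data.Nat.DivMod using (_/_; m/n*n≤m; m%n<n; m≡m%n+[m/n]*n)
open import Data.Nat.Tactic.RingSolver using (solve-∀)
open import Data.Bool using (Bool; true; false; _∧_; _∨_; not; if_then_else_)
import Data.Bool as Bool
open import Data.Bool.Properties using (∧-comm)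
open import Data.Fin using (Fin; zero; suc; toℕ; fromℕ; inject₁; _↑ˡ_; _↑ʳ_; splitAt; funToFin; finToFun)
import Data.Fin as Fin
import Data.Fin.Properties as Fin
open import Data.List using (length; filterᵇ; tabulate)
open import Data.Product using (Σ; ∃; _×_; _,_; proj₁; proj₂)
open import Data.Sum using (_⊎_; inj₁; inj₂; [_,_]′)
open import Data.Empty using (⊥; ⊥-elim)
open import Data.Unit using (⊤; tt)
open import Function using (_∘_; id)
open import Relation.Nullary using (¬_; Dec; yes; no)
open import Relation.Nullary.Decidable using (⌊_⌋; _×-dec_)
open import Relation.Binary.PropositionalEquality

-- Finite sets as Boolean predicates

-- The obstacle is the cost of making pairs of sets dense. Purifying a new layer against the older
-- ones may shrink it by the factor `loss`, which is exponential in the density parameter. If the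
-- older layers shrank as much, each step would add another exponential and `N` steps would give a
-- tower. Hence density is one-sided: it concerns the degrees of most vertices of the newer layer
-- into large subsets of the older one. Then older layers lose only the factor `κ` per step, the
-- density to be prepared is `κ ^ N * E`, and the double exponential `loss` is paid only once by
-- each layer. The price is that embeddings must fill newer layers before older ones. The number `N`
-- is a Ramsey bound for `r` colours and cliques of `Δ + 2` layers. It serves twice: as the depth of
-- the main induction, and as the length of the chains in which single copies are found. It can be
-- taken as a power of `r` with exponent linear in `r * Δ`, and every other quantity is at most two
-- exponentials of a power of `N`.

Sub : ℕ → Set
Sub n = Fin n → Bool

infix 4 _∈_ _∉_ _⊆_
infixl 7 _∩_
infixl 6 _∪_ _∖_

_∈_ _∉_ : ∀ {n} → Fin n → Sub n → Set
v ∈ P = P v ≡ true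
v ∉ P = P v ≡ false

_⊆_ : ∀ {n} → Sub n → Sub n → Set
P ⊆ Q = ∀ v → v ∈ P → v ∈ Q

_∩_ _∪_ _∖_ : ∀ {n} → Sub n → Sub n → Sub n
(P ∩ Q) v = P v ∧ Q v
(P ∪ Q) v = P v ∨ Q v
(P ∖ Q) v = P v ∧ not (Q v)

∅ full : ∀ {n} → Sub n
∅ _ = false
full _ = true

∧⁺ : ∀ {a b} → a ≡ true → b ≡ true → a ∧ b ≡ true
∧⁺ refl refl = refl

∧ˡ : ∀ {a b} → a ∧ b ≡ true → a ≡ true
∧ˡ {true} _ = refl

∧ʳ : ∀ {a b} → a ∧ b ≡ true → b ≡ true
∧ʳ {true} e = e

∨⁺ˡ : ∀ {a b} → a ≡ true → a ∨ b ≡ true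
∨⁺ˡ refl = refl

∨⁺ʳ : ∀ {a b} → b ≡ true → a ∨ b ≡ true
∨⁺ʳ {true} refl = refl
∨⁺ʳ {false} refl = refl

∨⁻ : ∀ {a b} → a ∨ b ≡ true → a ≡ true ⊎ b ≡ true
∨⁻ {true} _ = inj₁ refl
∨⁻ {false} e = inj₂ e

not⁺ : ∀ {a} → a ≡ false → not a ≡ true
not⁺ refl = refl

not⁻ : ∀ {a} → not a ≡ true → a ≡ false
not⁻ {false} _ = refl

true≢false : ∀ {a} → a ≡ true → a ≡ false → ⊥
true≢false refl ()

¬true⇒false : ∀ {a} → ¬ (a ≡ true) → a ≡ false
¬true⇒false {true} h = ⊥-elim (h refl)
¬true⇒false {false} h = refl

bool : ∀ b → b ≡ true ⊎ b ≡ false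
bool true = inj₁ refl
bool false = inj₂ refl

dec⁺ : ∀ {ℓ} {P : Set ℓ} (d : Dec P) → P → ⌊ d ⌋ ≡ true
dec⁺ (yes _) _ = refl
dec⁺ (no ¬p) p = ⊥-elim (¬p p)

dec⁻ : ∀ {ℓ} {P : Set ℓ} (d : Dec P) → ⌊ d ⌋ ≡ true → P
dec⁻ (yes p) _ = p

dec⁺ᶠ : ∀ {ℓ} {P : Set ℓ} (d : Dec P) → ¬ P → ⌊ d ⌋ ≡ false
dec⁺ᶠ (yes p) ¬p = ⊥-elim (¬p p)
dec⁺ᶠ (no _) _ = refl

dec⁻ᶠ : ∀ {ℓ} {P : Set ℓ} (d : Dec P) → ⌊ d ⌋ ≡ false → ¬ P
dec⁻ᶠ (no ¬p) _ = ¬p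

∖ˡ : ∀ {n} (P Q : Sub n) {v} → v ∈ P ∖ Q → v ∈ P
∖ˡ P Q = ∧ˡ

∖ʳ : ∀ {n} (P Q : Sub n) {v} → v ∈ P ∖ Q → v ∉ Q
∖ʳ P Q {v} e = not⁻ (∧ʳ {P v} e)

∖⁺ : ∀ {n} (P Q : Sub n) {v} → v ∈ P → v ∉ Q → v ∈ P ∖ Q
∖⁺ P Q p q = ∧⁺ p (not⁺ q)

∉-⊆ : ∀ {n} {P Q : Sub n} → P ⊆ Q → ∀ {v} → v ∉ Q → v ∉ P
∉-⊆ s {v} q = ¬true⇒false (λ p → true≢false (s v p) q)

some : ∀ {n} → Sub n → Bool
some P = ⌊ Fin.any? (λ v → P v Bool.≟ true) ⌋

some⁺ : ∀ {n} (P : Sub n) v → v ∈ P → some P ≡ true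
some⁺ P v e = dec⁺ (Fin.any? (λ v → P v Bool.≟ true)) (v , e)

some⁻ : ∀ {n} (P : Sub n) → some P ≡ true → ∃ λ v → v ∈ P
some⁻ P e = dec⁻ (Fin.any? (λ v → P v Bool.≟ true)) e

some⁻ᶠ : ∀ {n} (P : Sub n) → some P ≡ false → ∀ v → v ∉ P
some⁻ᶠ P e v = ¬true⇒false λ p → dec⁻ᶠ (Fin.any? (λ v → P v Bool.≟ true)) e (v , p)

[_≐_] : ∀ {n} → Fin n → Fin n → Bool
[ x ≐ y ] = ⌊ x Fin.≟ y ⌋

≐-refl : ∀ {n} (x : Fin n) → [ x ≐ x ] ≡ true
≐-refl x = dec⁺ (x Fin.≟ x) refl

≐⁻ : ∀ {n} {x y : Fin n} → [ x ≐ y ] ≡ true → x ≡ y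
≐⁻ {x = x} {y} e = dec⁻ (x Fin.≟ y) e

≐⁺ᶠ : ∀ {n} {x y : Fin n} → ¬ (x ≡ y) → [ x ≐ y ] ≡ false
≐⁺ᶠ {x = x} {y} ne = dec⁺ᶠ (x Fin.≟ y) ne

≐⁻ᶠ : ∀ {n} {x y : Fin n} → [ x ≐ y ] ≡ false → ¬ (x ≡ y)
≐⁻ᶠ {x = x} {y} e = dec⁻ᶠ (x Fin.≟ y) e

-- Sums and cardinalities

opaque
  ∑ : ∀ {n} → (Fin n → ℕ) → ℕ
  ∑ {zero} f = 0
  ∑ {suc n} f = f zero + ∑ (f ∘ suc)

  ∑-mono : ∀ {n} {f g : Fin n → ℕ} → (∀ i → f i ≤ g i) → ∑ f ≤ ∑ g
  ∑-mono {zero} h = z≤n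
  ∑-mono {suc n} h = +-mono-≤ (h zero) (∑-mono (h ∘ suc))

  ∑-cong : ∀ {n} {f g : Fin n → ℕ} → (∀ i → f i ≡ g i) → ∑ f ≡ ∑ g
  ∑-cong {zero} h = refl
  ∑-cong {suc n} h = cong₂ _+_ (h zero) (∑-cong (h ∘ suc))

  ∑-+ : ∀ {n} (f g : Fin n → ℕ) → ∑ (λ i → f i + g i) ≡ ∑ f + ∑ g
  ∑-+ {zero} f g = refl
  ∑-+ {suc n} f g rewrite ∑-+ (f ∘ suc) (g ∘ suc) = lem (f zero) (g zero) _ _
    where
    lem : ∀ a b c d → a + b + (c + d) ≡ a + c + (b + d)
    lem = solve-∀

  ∑-* : ∀ {n} a (f : Fin n → ℕ) → ∑ (λ i → a * f i) ≡ a * ∑ f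
  ∑-* {zero} a f = sym (*-zeroʳ a)
  ∑-* {suc n} a f rewrite ∑-* a (f ∘ suc) = sym (*-distribˡ-+ a (f zero) _)

  ∑-const : ∀ n a → ∑ {n} (λ _ → a) ≡ n * a
  ∑-const zero a = refl
  ∑-const (suc n) a = cong (a +_) (∑-const n a)

  ∑-zero : ∀ n → ∑ {n} (λ _ → 0) ≡ 0
  ∑-zero n = trans (∑-const n 0) (*-zeroʳ n)

  ∑-swap : ∀ {m n} (f : Fin m → Fin n → ℕ) → ∑ (λ i → ∑ (f i)) ≡ ∑ (λ j → ∑ (λ i → f i j))
  ∑-swap {zero} {n} f = sym (∑-zero n)
  ∑-swap {suc m} f rewrite ∑-swap (f ∘ suc) = sym (∑-+ (f zero) _)

  term≤∑ : ∀ {n} (f : Fin n → ℕ) i → f i ≤ ∑ f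
  term≤∑ f zero = m≤m+n _ _
  term≤∑ f (suc i) = ≤-trans (term≤∑ (f ∘ suc) i) (m≤n+m _ _)

⟦_⟧ : Bool → ℕ
⟦ true ⟧ = 1
⟦ false ⟧ = 0

⟦⟧-∧ : ∀ a b → ⟦ a ∧ b ⟧ ≡ ⟦ a ⟧ * ⟦ b ⟧
⟦⟧-∧ true b = sym (+-identityʳ _)
⟦⟧-∧ false b = refl

⟦⟧-mono : ∀ {a b} → (a ≡ true → b ≡ true) → ⟦ a ⟧ ≤ ⟦ b ⟧
⟦⟧-mono {false} h = z≤n
⟦⟧-mono {true} h rewrite h refl = ≤-refl

opaque
  # : ∀ {n} → Sub n → ℕ
  # P = ∑ (λ v → ⟦ P v ⟧)

only : ∀ {n} → Fin n → Sub n
only x v = [ x ≐ v ]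

opaque
  unfolding ∑ #

  #-mono : ∀ {n} {P Q : Sub n} → P ⊆ Q → # P ≤ # Q
  #-mono h = ∑-mono (λ v → ⟦⟧-mono (h v))

  #-cong : ∀ {n} {P Q : Sub n} → (∀ v → P v ≡ Q v) → # P ≡ # Q
  #-cong h = ∑-cong (λ v → cong ⟦_⟧ (h v))

  #-split : ∀ {n} (P Q : Sub n) → # P ≡ # (P ∩ Q) + # (P ∖ Q)
  #-split P Q = trans (∑-cong (λ v → lem (P v) (Q v))) (∑-+ (λ v → ⟦ P v ∧ Q v ⟧) (λ v → ⟦ P v ∧ not (Q v) ⟧))
    where
    lem : ∀ a b → ⟦ a ⟧ ≡ ⟦ a ∧ b ⟧ + ⟦ a ∧ not b ⟧
    lem true true = refl
    lem true false = refl
    lem false b = refl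

  #-∪ : ∀ {n} (P Q : Sub n) → # (P ∪ Q) ≤ # P + # Q
  #-∪ P Q = ≤-trans (∑-mono (λ v → lem (P v) (Q v))) (≤-reflexive (∑-+ (λ v → ⟦ P v ⟧) (λ v → ⟦ Q v ⟧)))
    where
    lem : ∀ a b → ⟦ a ∨ b ⟧ ≤ ⟦ a ⟧ + ⟦ b ⟧
    lem true b = s≤s z≤n
    lem false b = ≤-refl

  #-∪-disjoint : ∀ {n} (P Q : Sub n) → (∀ v → v ∈ P → v ∉ Q) → # (P ∪ Q) ≡ # P + # Q
  #-∪-disjoint P Q h = trans (∑-cong (λ v → lem (P v) (Q v) (h v))) (∑-+ (λ v → ⟦ P v ⟧) (λ v → ⟦ Q v ⟧))
    where
    lem : ∀ a b → (a ≡ true → b ≡ false) → ⟦ a ∨ b ⟧ ≡ ⟦ a ⟧ + ⟦ b ⟧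
    lem true b h rewrite h refl = refl
    lem false b h = refl

  #-∖ : ∀ {n} (P Q : Sub n) → # P ≤ # (P ∖ Q) + # Q
  #-∖ P Q = begin
    # P                       ≡⟨ #-split P Q ⟩
    # (P ∩ Q) + # (P ∖ Q)     ≤⟨ +-monoˡ-≤ (# (P ∖ Q)) (#-mono {P = P ∩ Q} {Q = Q} (λ v → ∧ʳ {P v})) ⟩
    # Q + # (P ∖ Q)           ≡⟨ +-comm (# Q) _ ⟩
    # (P ∖ Q) + # Q           ∎
    where open ≤-Reasoning

  #-∖-⊆ : ∀ {n} (P Q : Sub n) → Q ⊆ P → # (P ∖ Q) + # Q ≡ # P
  #-∖-⊆ P Q h = begin
    # (P ∖ Q) + # Q         ≡⟨ +-comm (# (P ∖ Q)) _ ⟩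
    # Q + # (P ∖ Q)         ≡⟨ cong (_+ # (P ∖ Q)) (#-cong (λ v → lem (P v) (Q v) (h v))) ⟩
    # (P ∩ Q) + # (P ∖ Q)   ≡⟨ sym (#-split P Q) ⟩
    # P                     ∎
    where
    open ≡-Reasoning
    lem : ∀ a b → (b ≡ true → a ≡ true) → b ≡ a ∧ b
    lem a true h rewrite h refl = refl
    lem true false h = refl
    lem false false h = refl

  #-full : ∀ n → # (full {n}) ≡ n
  #-full n = trans (∑-const n 1) (*-identityʳ n)

  #-empty : ∀ {n} (P : Sub n) → (∀ v → v ∉ P) → # P ≡ 0
  #-empty {n} P h = trans (∑-cong (λ v → cong ⟦_⟧ (h v))) (∑-zero n)

  ∈⇒0<# : ∀ {n} (P : Sub n) {v} → v ∈ P → 0 < # P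
  ∈⇒0<# P {v} e = ≤-trans (≤-reflexive (cong ⟦_⟧ (sym e))) (term≤∑ (λ v → ⟦ P v ⟧) v)

  find : ∀ {n} (P : Sub n) → (∃ λ v → v ∈ P) ⊎ (∀ v → v ∉ P)
  find P with some P in eq
  ... | true = inj₁ (some⁻ P eq)
  ... | false = inj₂ (some⁻ᶠ P eq)

  0<#⇒∈ : ∀ {n} (P : Sub n) → 0 < # P → ∃ λ v → v ∈ P
  0<#⇒∈ P h with find P
  ... | inj₁ x = x
  ... | inj₂ e = ⊥-elim (<-irrefl (sym (#-empty P e)) h)

  #≡0⇒∉ : ∀ {n} (P : Sub n) → # P ≡ 0 → ∀ v → v ∉ P
  #≡0⇒∉ P e v = ¬true⇒false λ p → <-irrefl (sym e) (∈⇒0<# P p)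

  pick : ∀ {n} (P Q : Sub n) → # Q < # P → ∃ λ v → v ∈ P × v ∉ Q
  pick P Q h with 0<#⇒∈ (P ∖ Q) (+-cancelʳ-< (# Q) 0 _ (<-≤-trans h (#-∖ P Q)))
  ... | v , e = v , ∖ˡ P Q e , ∖ʳ P Q e

  #-only : ∀ {n} (x : Fin n) → # (only x) ≡ 1
  #-only {suc n} zero = cong suc (#-empty {n} (λ v → [ zero ≐ suc v ]) (λ v → refl))
  #-only {suc n} (suc x) = trans (#-cong (λ v → lem v)) (#-only x)
    where
    lem : ∀ v → [ suc x ≐ suc v ] ≡ [ x ≐ v ]
    lem v with x Fin.≟ v
    ... | yes _ = refl
    ... | no _ = refl

  #≤1 : ∀ {n} (P : Sub n) → (∀ x y → x ∈ P → y ∈ P → x ≡ y) → # P ≤ 1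
  #≤1 P h with find P
  ... | inj₂ e = ≤-trans (≤-reflexive (#-empty P e)) z≤n
  ... | inj₁ (x , p) = ≤-trans (#-mono {P = P} {only x} (λ v q → dec⁺ (x Fin.≟ v) (h x v p q))) (≤-reflexive (#-only x))

opaque
  unfolding #

  -- Double counting of the pairs `(y , v)` with `v` bad for `y`. Ratios are multiplied out here and
  -- in all that follows: `E * k ≤ h` says that `k` is at most a 1/`E` fraction of `h`.
  union-bound : ∀ {m n} (A : Sub m) (Bad : Fin m → Sub n) E h → (∀ y → y ∈ A → E * # (Bad y) ≤ h) →
                E * # (λ v → some (λ y → A y ∧ Bad y v)) ≤ # A * h
  union-bound A Bad E h bd = begin
    E * # (λ v → some (λ y → A y ∧ Bad y v))              ≤⟨ *-monoʳ-≤ E (∑-mono pt) ⟩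
    E * ∑ (λ v → ∑ (λ y → ⟦ A y ⟧ * ⟦ Bad y v ⟧))          ≡⟨ cong (E *_) (∑-swap (λ v y → ⟦ A y ⟧ * ⟦ Bad y v ⟧)) ⟩
    E * ∑ (λ y → ∑ (λ v → ⟦ A y ⟧ * ⟦ Bad y v ⟧))          ≡⟨ sym (∑-* E (λ y → ∑ (λ v → ⟦ A y ⟧ * ⟦ Bad y v ⟧))) ⟩
    ∑ (λ y → E * ∑ (λ v → ⟦ A y ⟧ * ⟦ Bad y v ⟧))          ≡⟨ ∑-cong (λ y → cong (E *_) (∑-* ⟦ A y ⟧ (λ v → ⟦ Bad y v ⟧))) ⟩
    ∑ (λ y → E * (⟦ A y ⟧ * # (Bad y)))                    ≤⟨ ∑-mono (λ y → lem (A y) (# (Bad y)) (bd y)) ⟩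
    ∑ (λ y → h * ⟦ A y ⟧)                                  ≡⟨ ∑-* h (λ y → ⟦ A y ⟧) ⟩
    h * # A                                                ≡⟨ *-comm h _ ⟩
    # A * h                                                ∎
    where
    open ≤-Reasoning
    pt : ∀ v → ⟦ some (λ y → A y ∧ Bad y v) ⟧ ≤ ∑ (λ y → ⟦ A y ⟧ * ⟦ Bad y v ⟧)
    pt v with some (λ y → A y ∧ Bad y v) in eq
    ... | false = z≤n
    ... | true with some⁻ (λ y → A y ∧ Bad y v) eq
    ... | y , e = ≤-trans (≤-reflexive (trans (cong ⟦_⟧ (sym e)) (⟦⟧-∧ (A y) (Bad y v)))) (term≤∑ (λ y → ⟦ A y ⟧ * ⟦ Bad y v ⟧) y)
    lem : ∀ a b → (a ≡ true → E * b ≤ h) → E * (⟦ a ⟧ * b) ≤ h * ⟦ a ⟧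
    lem true b bd rewrite +-identityʳ b | *-identityʳ h = bd refl
    lem false b bd rewrite *-zeroʳ E = z≤n

-- Images and counting along injections

image : ∀ {m n} → (Fin m → Fin n) → Sub m → Sub n
image φ S v = some (λ x → S x ∧ [ φ x ≐ v ])

image⁺ : ∀ {m n} (φ : Fin m → Fin n) (S : Sub m) {x} → x ∈ S → φ x ∈ image φ S
image⁺ φ S {x} s = some⁺ (λ y → S y ∧ [ φ y ≐ φ x ]) x (∧⁺ s (≐-refl (φ x)))

image⁻ : ∀ {m n} (φ : Fin m → Fin n) (S : Sub m) {v} → v ∈ image φ S → ∃ λ x → x ∈ S × φ x ≡ v
image⁻ φ S {v} e with some⁻ (λ y → S y ∧ [ φ y ≐ v ]) e
... | x , p = x , ∧ˡ p , ≐⁻ (∧ʳ {S x} p)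

#-image-≤ : ∀ {m n} (φ : Fin m → Fin n) (S : Sub m) → # (image φ S) ≤ # S
#-image-≤ φ S = subst₂ _≤_ (*-identityˡ _) (*-identityʳ _)
  (union-bound S (λ x v → [ φ x ≐ v ]) 1 1 (λ y _ → ≤-reflexive (trans (*-identityˡ _) (#-only (φ y)))))

opaque
  unfolding #

  #-injection : ∀ {m n} (φ : Fin m → Fin n) (S : Sub m) (P : Sub n) → (∀ x → x ∈ S → φ x ∈ P) →
                (∀ x y → x ∈ S → y ∈ S → φ x ≡ φ y → x ≡ y) → # S ≤ # P
  #-injection φ S P into inj = begin
    # S                                                     ≤⟨ ∑-mono step ⟩
    ∑ (λ x → ∑ (λ v → ⟦ P v ⟧ * ⟦ S x ∧ [ φ x ≐ v ] ⟧))      ≡⟨ ∑-swap (λ x v → ⟦ P v ⟧ * ⟦ S x ∧ [ φ x ≐ v ] ⟧) ⟩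
    ∑ (λ v → ∑ (λ x → ⟦ P v ⟧ * ⟦ S x ∧ [ φ x ≐ v ] ⟧))      ≡⟨ ∑-cong (λ v → ∑-* ⟦ P v ⟧ (λ x → ⟦ S x ∧ [ φ x ≐ v ] ⟧)) ⟩
    ∑ (λ v → ⟦ P v ⟧ * # (λ x → S x ∧ [ φ x ≐ v ]))          ≤⟨ ∑-mono (λ v → *-monoʳ-≤ ⟦ P v ⟧ (#≤1 _ (λ x y p q → inj x y (∧ˡ p) (∧ˡ q) (trans (≐⁻ (∧ʳ {S x} p)) (sym (≐⁻ (∧ʳ {S y} q))))))) ⟩
    ∑ (λ v → ⟦ P v ⟧ * 1)                                    ≡⟨ ∑-cong (λ v → *-identityʳ ⟦ P v ⟧) ⟩
    # P                                                      ∎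
    where
    open ≤-Reasoning
    step : ∀ x → ⟦ S x ⟧ ≤ ∑ (λ v → ⟦ P v ⟧ * ⟦ S x ∧ [ φ x ≐ v ] ⟧)
    step x with S x in eq
    ... | false = z≤n
    ... | true = ≤-trans (≤-reflexive (sym one)) (term≤∑ (λ v → ⟦ P v ⟧ * ⟦ [ φ x ≐ v ] ⟧) (φ x))
      where
      one : ⟦ P (φ x) ⟧ * ⟦ [ φ x ≐ φ x ] ⟧ ≡ 1
      one rewrite into x eq | ≐-refl (φ x) = refl

#-image : ∀ {m n} (φ : Fin m → Fin n) (S : Sub m) →
          (∀ x y → x ∈ S → y ∈ S → φ x ≡ φ y → x ≡ y) → # (image φ S) ≡ # S
#-image φ S inj = ≤-antisym (#-image-≤ φ S) (#-injection φ S (image φ S) (λ x → image⁺ φ S) inj)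

_◂_ : ∀ {C : Set} {n} → C → (Fin n → C) → Fin (suc n) → C
(b ◂ P) zero = b
(b ◂ P) (suc v) = P v

opaque
  unfolding ∑ #

  subset-of-size : ∀ {n} (P : Sub n) p → p ≤ # P → ∃ λ Q → Q ⊆ P × # Q ≡ p
  subset-of-size {n} P zero h = ∅ , (λ v ()) , ∑-zero n
  subset-of-size {suc n} P (suc p) h with P zero in eq
  ... | true with subset-of-size (P ∘ suc) p (s≤s⁻¹ h)
  ... | Q , s , c = true ◂ Q , (λ { zero _ → eq ; (suc v) → s v }) , cong suc c
  subset-of-size {suc n} P (suc p) h | false with subset-of-size (P ∘ suc) (suc p) h
  ... | Q , s , c = false ◂ Q , (λ { zero () ; (suc v) → s v }) , c

-- Extremal choices, pigeonhole and exhaustive search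

argmax : ∀ {r} → Fin r → (g : Fin r → ℕ) → ∃ λ c → ∀ c' → g c' ≤ g c
argmax {suc zero} _ g = zero , λ { zero → ≤-refl }
argmax {suc (suc r)} _ g with argmax {suc r} zero (g ∘ suc)
... | c , h with ≤-total (g zero) (g (suc c))
... | inj₁ le = suc c , λ { zero → le ; (suc c') → h c' }
... | inj₂ ge = zero , λ { zero → ≤-refl ; (suc c') → ≤-trans (h c') ge }

argmin : ∀ {n} (P : Sub n) (κ : Fin n → ℕ) →
         (∀ v → v ∉ P) ⊎ (∃ λ x → x ∈ P × (∀ y → y ∈ P → κ x ≤ κ y))
argmin {zero} P κ = inj₁ λ ()
argmin {suc n} P κ with argmin (P ∘ suc) (κ ∘ suc) | P zero in eq
... | inj₁ e | false = inj₁ λ { zero → eq ; (suc v) → e v }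
... | inj₁ e | true = inj₂ (zero , eq , λ { zero _ → ≤-refl ; (suc y) p → ⊥-elim (true≢false p (e y)) })
... | inj₂ (x , p , h) | false = inj₂ (suc x , p , λ { zero q → ⊥-elim (true≢false q eq) ; (suc y) → h y })
... | inj₂ (x , p , h) | true with ≤-total (κ zero) (κ (suc x))
... | inj₁ le = inj₂ (zero , eq , λ { zero _ → ≤-refl ; (suc y) q → ≤-trans le (h y q) })
... | inj₂ ge = inj₂ (suc x , p , λ { zero _ → ge ; (suc y) → h y })

opaque
  unfolding #

  popular : ∀ {n r} → Fin r → (P : Sub n) (f : Fin n → Fin r) →
            ∃ λ c → # P ≤ r * # (λ v → P v ∧ [ f v ≐ c ])
  popular {n} {r} i P f with argmax i (λ c → # (λ v → P v ∧ [ f v ≐ c ]))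
  ... | c , mx = c , (begin
    # P                                            ≤⟨ ∑-mono pt ⟩
    ∑ (λ v → ∑ (λ c → ⟦ P v ∧ [ f v ≐ c ] ⟧))        ≡⟨ ∑-swap (λ v c → ⟦ P v ∧ [ f v ≐ c ] ⟧) ⟩
    ∑ (λ c → # (λ v → P v ∧ [ f v ≐ c ]))            ≤⟨ ∑-mono mx ⟩
    ∑ {r} (λ _ → # (λ v → P v ∧ [ f v ≐ c ]))        ≡⟨ ∑-const r _ ⟩
    r * # (λ v → P v ∧ [ f v ≐ c ])                  ∎)
    where
    open ≤-Reasoning
    pt : ∀ v → ⟦ P v ⟧ ≤ ∑ (λ c → ⟦ P v ∧ [ f v ≐ c ] ⟧)
    pt v = ≤-trans (⟦⟧-mono (λ p → ∧⁺ p (≐-refl (f v)))) (term≤∑ (λ c → ⟦ P v ∧ [ f v ≐ c ] ⟧) (f v))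

-- Brute force over all `2 ^ n` subsets. It makes the existence of a sparse set or square decidable,
-- which is what allows the density arguments to branch on it constructively. The second hypothesis
-- stands in for function extensionality.
search : ∀ {n} (t : Sub n → Bool) → (∀ X Y → (∀ v → X v ≡ Y v) → t X ≡ t Y) →
         (∃ λ X → t X ≡ true) ⊎ (∀ X → t X ≡ false)
search {zero} t ext with t (λ ()) in eq
... | true = inj₁ ((λ ()) , eq)
... | false = inj₂ λ X → trans (ext X (λ ()) (λ ())) eq
search {suc n} t ext
  with search (λ X → t (true ◂ X)) (λ X Y h → ext _ _ λ { zero → refl ; (suc v) → h v })
     | search (λ X → t (false ◂ X)) (λ X Y h → ext _ _ λ { zero → refl ; (suc v) → h v })
... | inj₁ (X , e) | _ = inj₁ (true ◂ X , e)
... | inj₂ _ | inj₁ (X , e) = inj₁ (false ◂ X , e)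
... | inj₂ e₁ | inj₂ e₀ = inj₂ go
  where
  go : ∀ X → t X ≡ false
  go X with X zero in eq
  ... | true = trans (ext X (true ◂ (X ∘ suc)) λ { zero → eq ; (suc v) → refl }) (e₁ (X ∘ suc))
  ... | false = trans (ext X (false ◂ (X ∘ suc)) λ { zero → eq ; (suc v) → refl }) (e₀ (X ∘ suc))

⊆? : ∀ {n} → Sub n → Sub n → Bool
⊆? P Q = not (some (P ∖ Q))

⊆?⁺ : ∀ {n} (P Q : Sub n) → P ⊆ Q → ⊆? P Q ≡ true
⊆?⁺ P Q h with some (P ∖ Q) in eq
... | false = refl
... | true with some⁻ (P ∖ Q) eq
... | v , e = ⊥-elim (true≢false (h v (∖ˡ P Q e)) (∖ʳ P Q e))

⊆?⁻ : ∀ {n} (P Q : Sub n) → ⊆? P Q ≡ true → P ⊆ Q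
⊆?⁻ P Q e v p with Q v in eq
... | true = refl
... | false = ⊥-elim (true≢false (∖⁺ P Q p eq) (some⁻ᶠ (P ∖ Q) (not⁻ e) v))

some-cong : ∀ {n} {P Q : Sub n} → (∀ v → P v ≡ Q v) → some P ≡ some Q
some-cong {P = P} {Q} h with some P in p | some Q in q
... | true | true = refl
... | false | false = refl
... | true | false with some⁻ P p
... | v , e = ⊥-elim (true≢false (trans (sym (h v)) e) (some⁻ᶠ Q q v))
some-cong {P = P} {Q} h | false | true with some⁻ Q q
... | v , e = ⊥-elim (true≢false (trans (h v) e) (some⁻ᶠ P p v))

-- `m` is the integer part of `x / a`. As it is at least one, rounding loses at most a factor of
-- two; this is the 2 in `rate`, `rate₂` and `Θ₁`.
chunk : ∀ a x → 0 < a → a ≤ x → ∃ λ m → 0 < m × a * m ≤ x × x ≤ 2 * a * m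
chunk (suc a) x _ le = m , 0<m , ≤-trans (≤-reflexive (*-comm (suc a) m)) (m/n*n≤m x (suc a)) , upper
  where
  m = x / suc a
  lt : x < suc m * suc a
  lt = subst (_< suc m * suc a) (sym (m≡m%n+[m/n]*n x (suc a))) (+-monoˡ-< (m * suc a) (m%n<n x (suc a)))
  0<m : 0 < m
  0<m with m in eq
  ... | zero = ⊥-elim (<⇒≱ (subst (λ z → x < suc z * suc a) eq lt) (≤-trans (≤-reflexive (+-identityʳ (suc a))) le))
  ... | suc _ = s≤s z≤n
  upper : x ≤ 2 * suc a * m
  upper = begin
    x                        ≤⟨ <⇒≤ lt ⟩
    suc a + m * suc a        ≤⟨ +-monoˡ-≤ (m * suc a) (m≤n*m (suc a) m ⦃ >-nonZero 0<m ⦄) ⟩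
    m * suc a + m * suc a    ≡⟨ lem m (suc a) ⟩
    2 * suc a * m            ∎
    where
    open ≤-Reasoning
    lem : ∀ m a → m * a + m * a ≡ 2 * a * m
    lem = solve-∀

-- Partial tilings

module Tilings {r n : ℕ} (F : GraphSeq) (c : Colouring r n) where

  -- A tiling of a subset by tiles inside it, so that covers of disjoint pieces can be joined.
  record Cover (S : Sub n) (t : ℕ) : Set where
    field
      tile     : Fin t → Member r n F c
      inside   : ∀ k u → embed (tile k) u ∈ S
      covers   : ∀ w → w ∈ S → ∃ λ k → ∃ λ u → embed (tile k) u ≡ w
      disjoint : ∀ k k' u u' → embed (tile k) u ≡ embed (tile k') u' → k ≡ k'

  open Cover

  Cover≤ : Sub n → ℕ → Set
  Cover≤ S B = ∃ λ t → t ≤ B × Cover S t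

  weaken : ∀ {S B B'} → B ≤ B' → Cover≤ S B → Cover≤ S B'
  weaken le (t , b , C) = t , ≤-trans b le , C

  cover-∅ : ∀ {S} → (∀ v → v ∉ S) → Cover S 0
  cover-∅ e = record
    { tile = λ () ; inside = λ () ; covers = λ w s → ⊥-elim (true≢false s (e w)) ; disjoint = λ () }

  cover-one : ∀ {S} (m : Member r n F c) → (∀ u → embed m u ∈ S) →
              (∀ w → w ∈ S → ∃ λ u → embed m u ≡ w) → Cover S 1
  cover-one m ins cov = record
    { tile = λ _ → m ; inside = λ _ → ins ; covers = λ w s → zero , cov w s
    ; disjoint = λ { zero zero _ _ _ → refl } }

  cover-ext : ∀ {S S' t} → S ⊆ S' → S' ⊆ S → Cover S t → Cover S' t
  cover-ext to from C = record
    { tile = tile C ; inside = λ k u → to _ (inside C k u)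
    ; covers = λ w s → covers C w (from w s) ; disjoint = disjoint C }

  cover-∪ : ∀ {P Q t t'} → (∀ v → v ∈ P → v ∉ Q) → Cover P t → Cover Q t' → Cover (P ∪ Q) (t + t')
  cover-∪ {P} {Q} {t} {t'} dj C C' = record
    { tile = λ k → pick' (splitAt t k)
    ; inside = λ k → inside' (splitAt t k)
    ; covers = cov
    ; disjoint = λ k k' u u' e → subst₂ _≡_ (Fin.join-splitAt t t' k) (Fin.join-splitAt t t' k')
                     (cong (Fin.join t t') (dis (splitAt t k) (splitAt t k') u u' e)) }
    where
    pick' : Fin t ⊎ Fin t' → Member r n F c
    pick' = [ tile C , tile C' ]′
    inside' : ∀ s u → embed (pick' s) u ∈ P ∪ Q
    inside' (inj₁ k) u = ∨⁺ˡ (inside C k u)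
    inside' (inj₂ k) u = ∨⁺ʳ (inside C' k u)
    cov : ∀ w → w ∈ P ∪ Q → ∃ λ k → ∃ λ u → embed (pick' (splitAt t k)) u ≡ w
    cov w s with ∨⁻ {P w} s
    ... | inj₁ p = k ↑ˡ t' , eq
      where
      k = proj₁ (covers C w p)
      eq : ∃ λ u → embed (pick' (splitAt t (k ↑ˡ t'))) u ≡ w
      eq rewrite Fin.splitAt-↑ˡ t k t' = proj₂ (covers C w p)
    ... | inj₂ q = t ↑ʳ k , eq
      where
      k = proj₁ (covers C' w q)
      eq : ∃ λ u → embed (pick' (splitAt t (t ↑ʳ k))) u ≡ w
      eq rewrite Fin.splitAt-↑ʳ t t' k = proj₂ (covers C' w q)
    dis : ∀ s s' u u' → embed (pick' s) u ≡ embed (pick' s') u' → s ≡ s'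
    dis (inj₁ k) (inj₁ k') u u' e = cong inj₁ (disjoint C k k' u u' e)
    dis (inj₂ k) (inj₂ k') u u' e = cong inj₂ (disjoint C' k k' u u' e)
    dis (inj₁ k) (inj₂ k') u u' e =
      ⊥-elim (true≢false (subst (_∈ Q) (sym e) (inside C' k' u')) (dj _ (inside C k u)))
    dis (inj₂ k) (inj₁ k') u u' e =
      ⊥-elim (true≢false (subst (_∈ Q) e (inside C' k u)) (dj _ (inside C k' u')))

  cover≤-∪ : ∀ {P Q B B'} → (∀ v → v ∈ P → v ∉ Q) → Cover≤ P B → Cover≤ Q B' → Cover≤ (P ∪ Q) (B + B')
  cover≤-∪ dj (t , b , C) (t' , b' , C') = t + t' , +-mono-≤ b b' , cover-∪ dj C C'

  cover≤-ext : ∀ {S S' B} → S ⊆ S' → S' ⊆ S → Cover≤ S B → Cover≤ S' B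
  cover≤-ext to from (t , b , C) = t , b , cover-ext to from C

  cover-copy : ∀ {S} m (φ : Fin (suc m) → Fin n) (γ : Fin r) → (∀ u v → φ u ≡ φ v → u ≡ v) →
               (∀ u v → adj (F m) u v ≡ true → col c (φ u) (φ v) ≡ γ) →
               (∀ u → φ u ∈ S) → (∀ w → w ∈ S → ∃ λ u → φ u ≡ w) → Cover≤ S 1
  cover-copy m φ γ inj mono ins cov = 1 , ≤-refl , cover-one
    (record { index = m ; embed = φ ; embed-inj = λ {x} {y} → inj x y ; colour = γ ; mono = mono }) ins cov

  -- The graph `F 0` has one vertex and no edge, so each single vertex is a tile of any colour.
  cover-singletons : Fin r → ∀ S → Cover≤ S (# S)
  cover-singletons γ S = go (# S) S refl
    where
    single : ∀ v → Cover≤ (only v) 1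
    single v = cover-copy 0 (λ _ → v) γ (λ { zero zero _ → refl })
      (λ { zero zero e → ⊥-elim (true≢false e (irrefl (F 0) zero)) })
      (λ _ → ≐-refl v) (λ w e → zero , ≐⁻ e)
    go : ∀ s S → # S ≡ s → Cover≤ S s
    go zero S e = 0 , z≤n , cover-∅ (#≡0⇒∉ S e)
    go (suc s) S e with 0<#⇒∈ S (subst (0 <_) (sym e) (s≤s z≤n))
    ... | v , p = cover≤-ext to from (cover≤-∪ (λ w o → ¬true⇒false λ q → ≐⁻ᶠ (∖ʳ S (only v) q) (≐⁻ o)) (single v) (go s (S ∖ only v) eq))
      where
      sub : only v ⊆ S
      sub w o = subst (_∈ S) (≐⁻ o) p
      eq : # (S ∖ only v) ≡ s
      eq = suc-injective (begin
        suc (# (S ∖ only v))          ≡⟨ +-comm 1 _ ⟩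
        # (S ∖ only v) + 1            ≡⟨ cong (# (S ∖ only v) +_) (sym (#-only v)) ⟩
        # (S ∖ only v) + # (only v)   ≡⟨ #-∖-⊆ S (only v) sub ⟩
        # S                           ≡⟨ e ⟩
        suc s                         ∎)
        where open ≡-Reasoning
      to : only v ∪ (S ∖ only v) ⊆ S
      to w q with ∨⁻ {only v w} q
      ... | inj₁ o = sub w o
      ... | inj₂ d = ∖ˡ S (only v) d
      from : S ⊆ only v ∪ (S ∖ only v)
      from w q with bool (only v w)
      ... | inj₁ o = ∨⁺ˡ o
      ... | inj₂ o = ∨⁺ʳ {only v w} (∖⁺ S (only v) q o)

  cover⇒tiling : ∀ {t} → Cover full t → MonoTiling r n F c t
  cover⇒tiling C = record { member = tile C ; covers = λ w → covers C w refl ; disjoint = disjoint C }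

-- Colourings and packings of graphs of bounded degree

opaque
  unfolding ∑ #

  length-filter-tabulate : ∀ {m n} (f : Fin m → Fin n) (P : Sub n) → length (filterᵇ P (tabulate f)) ≡ # (P ∘ f)
  length-filter-tabulate {zero} f P = refl
  length-filter-tabulate {suc m} f P with P (f zero)
  ... | true = cong suc (length-filter-tabulate (f ∘ suc) P)
  ... | false = length-filter-tabulate (f ∘ suc) P

  #-tail : ∀ {n} (P : Sub (suc n)) → # (P ∘ suc) ≤ # P
  #-tail P = m≤n+m _ _

degree≡# : ∀ {n} (G : Graph n) v → degree G v ≡ # (adj G v)
degree≡# G v = length-filter-tabulate id (adj G v)

-- Vertex zero is coloured last: its at most `d` neighbours cannot block all `d + 1` colours. The
-- relation is a bare Boolean function because it is also applied to the square of a graph.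
greedy-colouring : ∀ {M} d (H : Fin M → Fin M → Bool) → (∀ x y → H x y ≡ H y x) → (∀ x → H x x ≡ false) →
                   (∀ x → # (H x) ≤ d) →
                   ∃ λ (g : Fin M → Fin (suc d)) → ∀ x y → H x y ≡ true → ¬ (g x ≡ g y)
greedy-colouring {zero} d H sy ir dg = (λ ()) , λ ()
greedy-colouring {suc M} d H sy ir dg
  with greedy-colouring d (λ x y → H (suc x) (suc y)) (λ x y → sy (suc x) (suc y)) (λ x → ir (suc x))
         (λ x → ≤-trans (#-tail (H (suc x))) (dg (suc x)))
... | g , proper = g' , proper'
  where
  nb : Sub M
  nb y = H zero (suc y)
  free : ∃ λ γ → γ ∈ full × γ ∉ image g nb
  free = pick full (image g nb) (<-≤-trans (s≤s (≤-trans (#-image-≤ g nb) (≤-trans (#-tail (H zero)) (dg zero))))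
           (≤-reflexive (sym (#-full (suc d)))))
  g' : Fin (suc M) → Fin (suc d)
  g' zero = proj₁ free
  g' (suc x) = g x
  fresh : ∀ y → H zero (suc y) ≡ true → ¬ (proj₁ free ≡ g y)
  fresh y h e = true≢false (subst (_∈ image g nb) (sym e) (image⁺ g nb h)) (proj₂ (proj₂ free))
  proper' : ∀ x y → H x y ≡ true → ¬ (g' x ≡ g' y)
  proper' zero zero h = ⊥-elim (true≢false h (ir zero))
  proper' zero (suc y) h = fresh y h
  proper' (suc x) zero h e = fresh x (trans (sy zero (suc x)) h) (sym e)
  proper' (suc x) (suc y) = proper x y

large-class : ∀ {M} d (g : Fin M → Fin (suc d)) → ∃ λ γ → M ≤ suc d * # (λ x → [ g x ≐ γ ])
large-class {M} d g with popular zero full g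
... | γ , h = γ , subst (_≤ suc d * # (λ x → [ g x ≐ γ ])) (#-full M) h

-- A colour class of the square of the graph: vertices of P are at pairwise distance at least three.
packing : ∀ {M} Δ (G : Graph M) → (∀ x → # (adj G x) ≤ Δ) →
          ∃ λ (P : Sub M) → M ≤ suc (suc Δ * suc Δ) * # P ×
            (∀ x y → x ∈ P → y ∈ P → adj G x y ≡ false) ×
            (∀ x y z → x ∈ P → y ∈ P → adj G z x ≡ true → adj G z y ≡ true → x ≡ y)
packing {M} Δ G dg = P , proj₂ large , indep , unique
  where
  nb : Fin M → Sub M
  nb x = only x ∪ adj G x
  nb-sym : ∀ x y → nb x y ≡ true → nb y x ≡ true
  nb-sym x y h with ∨⁻ {[ x ≐ y ]} h
  ... | inj₁ e rewrite ≐⁻ e = ∨⁺ˡ (≐-refl y)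
  ... | inj₂ a = ∨⁺ʳ {[ y ≐ x ]} (trans (adj-sym G y x) a)
  H : Fin M → Fin M → Bool
  H x y = not [ x ≐ y ] ∧ some (λ z → nb x z ∧ nb z y)
  H-sym' : ∀ x y → H x y ≡ true → H y x ≡ true
  H-sym' x y h with some⁻ (λ z → nb x z ∧ nb z y) (∧ʳ {not [ x ≐ y ]} h)
  ... | z , e = ∧⁺ (not⁺ (≐⁺ᶠ λ y≡x → ≐⁻ᶠ (not⁻ (∧ˡ h)) (sym y≡x)))
                   (some⁺ (λ z → nb y z ∧ nb z x) z (∧⁺ (nb-sym z y (∧ʳ {nb x z} e)) (nb-sym x z (∧ˡ e))))
  H-sym : ∀ x y → H x y ≡ H y x
  H-sym x y with bool (H x y) | bool (H y x)
  ... | inj₁ a | inj₁ b = trans a (sym b)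
  ... | inj₂ a | inj₂ b = trans a (sym b)
  ... | inj₁ a | inj₂ b = ⊥-elim (true≢false (H-sym' x y a) b)
  ... | inj₂ a | inj₁ b = ⊥-elim (true≢false (H-sym' y x b) a)
  H-irr : ∀ x → H x x ≡ false
  H-irr x rewrite ≐-refl x = refl
  nb-deg : ∀ x → # (nb x) ≤ suc Δ
  nb-deg x = ≤-trans (#-∪ (only x) (adj G x)) (+-mono-≤ (≤-reflexive (#-only x)) (dg x))
  H-deg : ∀ x → # (H x) ≤ suc Δ * suc Δ
  H-deg x = begin
    # (H x)                                     ≤⟨ #-mono {P = H x} (λ v → ∧ʳ {not [ x ≐ v ]}) ⟩
    # (λ y → some (λ z → nb x z ∧ nb z y))      ≡⟨ sym (*-identityˡ _) ⟩
    1 * # (λ y → some (λ z → nb x z ∧ nb z y))  ≤⟨ union-bound (nb x) nb 1 (suc Δ) (λ z _ → ≤-trans (≤-reflexive (*-identityˡ _)) (nb-deg z)) ⟩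
    # (nb x) * suc Δ                            ≤⟨ *-monoˡ-≤ (suc Δ) (nb-deg x) ⟩
    suc Δ * suc Δ                               ∎
    where open ≤-Reasoning
  colouring = greedy-colouring (suc Δ * suc Δ) H H-sym H-irr H-deg
  g = proj₁ colouring
  large = large-class (suc Δ * suc Δ) g
  P : Sub M
  P x = [ g x ≐ proj₁ large ]
  apart : ∀ x y z → x ∈ P → y ∈ P → nb x z ≡ true → nb z y ≡ true → x ≡ y
  apart x y z p q a b with x Fin.≟ y
  ... | yes e = e
  ... | no ne = ⊥-elim (proj₂ colouring x y
    (∧⁺ (not⁺ (≐⁺ᶠ ne)) (some⁺ (λ z → nb x z ∧ nb z y) z (∧⁺ a b))) (trans (≐⁻ p) (sym (≐⁻ q))))
  indep : ∀ x y → x ∈ P → y ∈ P → adj G x y ≡ false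
  indep x y p q with bool (adj G x y)
  ... | inj₂ e = e
  ... | inj₁ e rewrite apart x y y p q (∨⁺ʳ {[ x ≐ y ]} e) (∨⁺ˡ (≐-refl y)) = irrefl G y
  unique : ∀ x y z → x ∈ P → y ∈ P → adj G z x ≡ true → adj G z y ≡ true → x ≡ y
  unique x y z p q a b = apart x y z p q (∨⁺ʳ {[ x ≐ z ]} (trans (adj-sym G x z) a)) (∨⁺ʳ {[ z ≐ y ]} b)

-- One-sided density

bad : ∀ {m n} → (Fin m → Fin n → Bool) → Sub m → ℕ → Sub n → Sub m
bad G A D X a = A a ∧ ⌊ D * # (G a ∩ X) <? # X ⌋

-- The one-sided lower half of regularity. `E` measures both how small a test set in `B` may be and
-- how few vertices of `A` may fail on it; `1/D` is the share of the test set that the others see.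
Dense : ∀ {m n} → (Fin m → Fin n → Bool) → Sub m → Sub n → ℕ → ℕ → Set
Dense G A B E D = ∀ X → X ⊆ B → # B ≤ E * # X → E * # (bad G A D X) ≤ # A

Sparse : ∀ {m n} → (Fin m → Fin n → Bool) → Sub m → Sub n → ℕ → ℕ → Set
Sparse G A B E D = ∃ λ X → X ⊆ B × # B ≤ E * # X × # A < E * # (bad G A D X)

dense-or-sparse : ∀ {m n} (G : Fin m → Fin n → Bool) A B E D → Dense G A B E D ⊎ Sparse G A B E D
dense-or-sparse {m} {n} G A B E D with search test ext
  where
  test : Sub n → Bool
  test X = ⊆? X B ∧ (⌊ # B ≤? E * # X ⌋ ∧ ⌊ # A <? E * # (bad G A D X) ⌋)
  ext : ∀ X Y → (∀ v → X v ≡ Y v) → test X ≡ test Y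
  ext X Y h = cong₂ _∧_ (cong not (some-cong (λ v → cong (_∧ not (B v)) (h v))))
    (cong₂ _∧_ (cong (λ k → ⌊ # B ≤? E * k ⌋) sz) (cong (λ k → ⌊ # A <? E * k ⌋) (#-cong λ a → cong (A a ∧_)
      (cong₂ (λ p q → ⌊ D * p <? q ⌋) (#-cong (λ v → cong (G a v ∧_) (h v))) sz))))
    where
    sz : # X ≡ # Y
    sz = #-cong h
... | inj₁ (X , e) = inj₂ (X , ⊆?⁻ X B (∧ˡ e) , dec⁻ (_ ≤? _) (∧ˡ {⌊ # B ≤? E * # X ⌋} (∧ʳ {⊆? X B} e))
                             , dec⁻ (_ <? _) (∧ʳ {⌊ # B ≤? E * # X ⌋} (∧ʳ {⊆? X B} e)))
... | inj₂ none = inj₁ λ X sub big → ≮⇒≥ λ lt →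
  true≢false (∧⁺ (⊆?⁺ X B sub) (∧⁺ (dec⁺ (_ ≤? _) big) (dec⁺ (_ <? _) lt))) (none X)

all-dense-or-sparse : ∀ {m n} j (G : Fin j → Fin m → Fin n → Bool) A (B : Fin j → Sub n) E D →
                      (∀ i → Dense (G i) A (B i) E D) ⊎ (∃ λ i → Sparse (G i) A (B i) E D)
all-dense-or-sparse zero G A B E D = inj₁ λ ()
all-dense-or-sparse (suc j) G A B E D
  with dense-or-sparse (G zero) A (B zero) E D | all-dense-or-sparse j (G ∘ suc) A (B ∘ suc) E D
... | inj₂ s | _ = inj₂ (zero , s)
... | inj₁ d | inj₂ (i , s) = inj₂ (suc i , s)
... | inj₁ d | inj₁ ds = inj₁ λ { zero → d ; (suc i) → ds i }

bad-mono : ∀ {m n} (G : Fin m → Fin n → Bool) {A A'} D X → A' ⊆ A → bad G A' D X ⊆ bad G A D X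
bad-mono G {A} {A'} D X h a e = ∧⁺ (h a (∧ˡ e)) (∧ʳ {A' a} e)

-- A 1/`E` share of `B'` is at least a 1/(`κ * E`) share of `B`, and the exceptional vertices are
-- compared with an `A'` that is at most `κ` times smaller. The single factor `κ` in the density
-- parameter pays for both.
Dense-shrink : ∀ {m n} (G : Fin m → Fin n → Bool) {A A' B B'} κ E D → 0 < κ → A' ⊆ A → B' ⊆ B →
               # A ≤ κ * # A' → # B ≤ κ * # B' → Dense G A B (κ * E) D → Dense G A' B' E D
Dense-shrink G {A} {A'} {B} {B'} κ E D 0<κ sa sb la lb den X sx big =
  *-cancelˡ-≤ κ ⦃ >-nonZero 0<κ ⦄ (begin
    κ * (E * # (bad G A' D X))   ≡⟨ sym (*-assoc κ E _) ⟩
    κ * E * # (bad G A' D X)     ≤⟨ *-monoʳ-≤ (κ * E) (#-mono (bad-mono G D X sa)) ⟩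
    κ * E * # (bad G A D X)      ≤⟨ den X (λ v x → sb v (sx v x)) big' ⟩
    # A                          ≤⟨ la ⟩
    κ * # A'                     ∎)
  where
  open ≤-Reasoning
  big' : # B ≤ κ * E * # X
  big' = begin
    # B              ≤⟨ lb ⟩
    κ * # B'         ≤⟨ *-monoʳ-≤ κ big ⟩
    κ * (E * # X)    ≡⟨ sym (*-assoc κ E _) ⟩
    κ * E * # X      ∎

Dense-weaken : ∀ {m n} (G : Fin m → Fin n → Bool) {A B E E'} D → E' ≤ E → Dense G A B E D → Dense G A B E' D
Dense-weaken G D le den X sx big =
  ≤-trans (*-monoˡ-≤ _ le) (den X sx (≤-trans big (*-monoˡ-≤ _ le)))

-- Purification of one set against several others

infix 8 _[_↦_]

_[_↦_] : ∀ {j} {C : Set} → (Fin j → C) → Fin j → C → Fin j → C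
(f [ i ↦ x ]) k = if [ i ≐ k ] then x else f k

opaque
  unfolding ∑

  -- The sum is the measure that decreases in the purification loop and in Ramsey's theorem.
  ∑-update : ∀ {j} (f : Fin j → ℕ) i m → f i ≡ suc m → suc (∑ (f [ i ↦ m ])) ≡ ∑ f
  ∑-update {suc j} f zero m e = cong (_+ ∑ (f ∘ suc)) (sym e)
  ∑-update {suc j} f (suc i) m e = trans (sym (+-suc (f zero) _))
    (cong (f zero +_) (trans (cong suc (∑-cong lem)) (∑-update (f ∘ suc) i m e)))
    where
    lem : ∀ k → (f [ suc i ↦ m ]) (suc k) ≡ ((f ∘ suc) [ i ↦ m ]) k
    lem k with i Fin.≟ k
    ... | yes _ = refl
    ... | no _ = refl

-- If density fails at X, pass to the vertices of A with few neighbours in X and discard X from B; as hardly any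
-- degree is lost, B never shrinks below a 1/2D fraction, which bounds the number of such steps.
module Purify {m n j : ℕ} (G : Fin j → Fin m → Fin n → Bool) (B : Fin j → Sub n) (D E : ℕ)
              (0<D : 0 < D) (0<E : 0 < E) (0<B : ∀ i → 0 < # (B i)) where

  Rich : Sub m → Set
  Rich A = ∀ a i → a ∈ A → # (B i) ≤ D * # (G i a ∩ B i)

  -- `lost`: the part discarded from `B i` has density at most 1/`2D` towards every surviving
  -- vertex. `fuel`: as long as `C i` is a 1/`2D` share of `B i`, each discarded set is at least a
  -- 1/`2DE` share of it, so `f i` bounds the discards still possible.
  record Inv (A : Sub m) (C : Fin j → Sub n) (f : Fin j → ℕ) : Set where
    field
      nonempty : 0 < # A
      rich : Rich A
      sub : ∀ i → C i ⊆ B i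
      lost : ∀ a i → a ∈ A → 2 * D * # (G i a ∩ (B i ∖ C i)) ≤ # (B i ∖ C i)
      fuel : ∀ i → 2 * D * E * # (C i) ≤ f i * # (B i)

  open Inv

  -- Take any surviving vertex. It sees at least a 1/`D` share of `B i`, and at most half of these
  -- neighbours lie in the discarded part; the other half must lie in `C i`.
  kept : ∀ {A C f} → Inv A C f → ∀ i → # (B i) ≤ 2 * D * # (C i)
  kept {A} {C} I i with 0<#⇒∈ A (nonempty I)
  ... | a , p = +-cancelʳ-≤ (# (B i)) _ _ (begin
    # (B i) + # (B i)                                      ≤⟨ +-mono-≤ (rich I a i p) (rich I a i p) ⟩
    D * # (G i a ∩ B i) + D * # (G i a ∩ B i)              ≡⟨ arith₁ D _ ⟩
    2 * D * # (G i a ∩ B i)                                ≡⟨ cong (2 * D *_) (#-split (G i a ∩ B i) (C i)) ⟩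
    2 * D * (# (G i a ∩ B i ∩ C i) + # (G i a ∩ B i ∖ C i)) ≤⟨ *-monoʳ-≤ (2 * D) (+-mono-≤
                                                                 (#-mono {P = G i a ∩ B i ∩ C i} {C i} (λ v → ∧ʳ {(G i a ∩ B i) v}))
                                                                 (#-mono {P = G i a ∩ B i ∖ C i} {G i a ∩ (B i ∖ C i)} reassoc)) ⟩
    2 * D * (# (C i) + # (G i a ∩ (B i ∖ C i)))            ≡⟨ *-distribˡ-+ (2 * D) (# (C i)) _ ⟩
    2 * D * # (C i) + 2 * D * # (G i a ∩ (B i ∖ C i))      ≤⟨ +-monoʳ-≤ (2 * D * # (C i)) (lost I a i p) ⟩
    2 * D * # (C i) + # (B i ∖ C i)                        ≤⟨ +-monoʳ-≤ (2 * D * # (C i)) (#-mono {P = B i ∖ C i} (λ v → ∧ˡ)) ⟩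
    2 * D * # (C i) + # (B i)                              ∎)
    where
    open ≤-Reasoning
    arith₁ : ∀ D x → D * x + D * x ≡ 2 * D * x
    arith₁ = solve-∀
    reassoc : G i a ∩ B i ∖ C i ⊆ G i a ∩ (B i ∖ C i)
    reassoc v e = ∧⁺ {G i a v} (∧ˡ {G i a v} (∧ˡ {G i a v ∧ B i v} e)) (∧⁺ (∧ʳ {G i a v} (∧ˡ {G i a v ∧ B i v} e)) (∧ʳ {G i a v ∧ B i v} e))

  Result : Sub m → ℕ → Set
  Result A s = ∃ λ A' → ∃ λ (B' : Fin j → Sub n) → A' ⊆ A × (∀ i → B' i ⊆ B i) × (∀ i → Dense (G i) A' (B' i) E (2 * D)) ×
                 (∀ i → # (B i) ≤ 2 * D * # (B' i)) × # A ≤ E ^ s * # A'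

  loop : ∀ s A C f → ∑ f ≤ s → Inv A C f → Result A s
  loop s A C f bound I with all-dense-or-sparse j G A C E (2 * D)
  ... | inj₁ den = A , C , (λ _ p → p) , sub I , den , kept I , m≤n*m (# A) (E ^ s) ⦃ m^n≢0 E s ⦃ >-nonZero 0<E ⦄ ⦄
  ... | inj₂ (i , X , sx , big , few) with f i in eq
  -- Without fuel `C i` would be empty, whereas `kept` leaves it a positive share of `B i`.
  ... | zero = ⊥-elim (<-irrefl refl (begin-strict
      0                          <⟨ 0<B i ⟩
      # (B i)                    ≤⟨ kept I i ⟩
      2 * D * # (C i)            ≤⟨ *-monoˡ-≤ (# (C i)) (m≤m*n (2 * D) E ⦃ >-nonZero 0<E ⦄) ⟩
      2 * D * E * # (C i)        ≤⟨ fuel I i ⟩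
      f i * # (B i)              ≡⟨ cong (_* # (B i)) eq ⟩
      0                          ∎))
    where open ≤-Reasoning
  loop zero A C f bound I | inj₂ (i , X , sx , big , few) | suc k =
    ⊥-elim (<⇒≱ (subst (0 <_) (sym eq) (s≤s z≤n)) (≤-trans (term≤∑ f i) bound))
  loop (suc s) A C f bound I | inj₂ (i , X , sx , big , few) | suc k
    with loop s A₁ C₁ (f [ i ↦ k ]) (s≤s⁻¹ (≤-trans (≤-reflexive (∑-update f i k eq)) bound)) I₁
    where
    open ≤-Reasoning
    A₁ = bad (G i) A (2 * D) X
    C₁ = C [ i ↦ C i ∖ X ]
    sz : # (C i ∖ X) + # X ≡ # (C i)
    sz = #-∖-⊆ (C i) X sx
    rem : B i ∖ (C i ∖ X) ⊆ (B i ∖ C i) ∪ X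
    rem v e with bool (X v)
    ... | inj₁ x = ∨⁺ʳ {(B i ∖ C i) v} x
    ... | inj₂ x = ∨⁺ˡ (∖⁺ (B i) (C i) (∖ˡ (B i) (C i ∖ X) e)
                     (¬true⇒false λ q → true≢false (∖⁺ (C i) X q x) (∖ʳ (B i) (C i ∖ X) e)))
    rem' : (B i ∖ C i) ∪ X ⊆ B i ∖ (C i ∖ X)
    rem' v e with ∨⁻ {(B i ∖ C i) v} e
    ... | inj₁ q = ∖⁺ (B i) (C i ∖ X) (∖ˡ (B i) (C i) q) (∉-⊆ {P = C i ∖ X} {C i} (λ w → ∖ˡ (C i) X) (∖ʳ (B i) (C i) q))
    ... | inj₂ x = ∖⁺ (B i) (C i ∖ X) (sub I i v (sx v x)) (¬true⇒false λ q → true≢false x (∖ʳ (C i) X q))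
    lost-here : ∀ a → a ∈ A₁ → 2 * D * # (G i a ∩ (B i ∖ (C i ∖ X))) ≤ # (B i ∖ (C i ∖ X))
    lost-here a p = begin
      2 * D * # (G i a ∩ (B i ∖ (C i ∖ X)))
        ≤⟨ *-monoʳ-≤ (2 * D) (≤-trans (#-mono {P = G i a ∩ (B i ∖ (C i ∖ X))} {(G i a ∩ (B i ∖ C i)) ∪ (G i a ∩ X)} dist) (#-∪ (G i a ∩ (B i ∖ C i)) (G i a ∩ X))) ⟩
      2 * D * (# (G i a ∩ (B i ∖ C i)) + # (G i a ∩ X))
        ≡⟨ *-distribˡ-+ (2 * D) (# (G i a ∩ (B i ∖ C i))) _ ⟩
      2 * D * # (G i a ∩ (B i ∖ C i)) + 2 * D * # (G i a ∩ X)
        ≤⟨ +-mono-≤ (lost I a i (∧ˡ p)) (<⇒≤ (dec⁻ (_ <? _) (∧ʳ {A a} p))) ⟩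
      # (B i ∖ C i) + # X
        ≡⟨ sym (#-∪-disjoint (B i ∖ C i) X λ v q → ¬true⇒false λ x → true≢false (sx v x) (∖ʳ (B i) (C i) q)) ⟩
      # ((B i ∖ C i) ∪ X)
        ≤⟨ #-mono rem' ⟩
      # (B i ∖ (C i ∖ X)) ∎
      where
      dist : G i a ∩ (B i ∖ (C i ∖ X)) ⊆ (G i a ∩ (B i ∖ C i)) ∪ (G i a ∩ X)
      dist v e with ∨⁻ {(B i ∖ C i) v} (rem v (∧ʳ {G i a v} e))
      ... | inj₁ q = ∨⁺ˡ (∧⁺ {G i a v} (∧ˡ e) q)
      ... | inj₂ x = ∨⁺ʳ {(G i a ∩ (B i ∖ C i)) v} (∧⁺ (∧ˡ e) x)
    fuel-here : 2 * D * E * # (C i ∖ X) ≤ k * # (B i)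
    fuel-here = +-cancelʳ-≤ (2 * D * E * # X) _ _ (begin
      2 * D * E * # (C i ∖ X) + 2 * D * E * # X   ≡⟨ sym (*-distribˡ-+ (2 * D * E) (# (C i ∖ X)) (# X)) ⟩
      2 * D * E * (# (C i ∖ X) + # X)             ≡⟨ cong (2 * D * E *_) sz ⟩
      2 * D * E * # (C i)                         ≤⟨ fuel I i ⟩
      f i * # (B i)                               ≡⟨ cong (_* # (B i)) eq ⟩
      # (B i) + k * # (B i)                       ≤⟨ +-monoˡ-≤ (k * # (B i)) (≤-trans (kept I i) (*-monoʳ-≤ (2 * D) big)) ⟩
      2 * D * (E * # X) + k * # (B i)             ≡⟨ cong (_+ k * # (B i)) (sym (*-assoc (2 * D) E (# X))) ⟩
      2 * D * E * # X + k * # (B i)               ≡⟨ +-comm (2 * D * E * # X) _ ⟩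
      k * # (B i) + 2 * D * E * # X               ∎)
    sub₁ : ∀ i' → C₁ i' ⊆ B i'
    sub₁ i' v p with i Fin.≟ i'
    ... | yes refl = sub I i v (∖ˡ (C i) X p)
    ... | no _ = sub I i' v p
    lost₁ : ∀ a i' → a ∈ A₁ → 2 * D * # (G i' a ∩ (B i' ∖ C₁ i')) ≤ # (B i' ∖ C₁ i')
    lost₁ a i' p with i Fin.≟ i'
    ... | yes refl = lost-here a p
    ... | no _ = lost I a i' (∧ˡ p)
    fuel₁ : ∀ i' → 2 * D * E * # (C₁ i') ≤ (f [ i ↦ k ]) i' * # (B i')
    fuel₁ i' with i Fin.≟ i'
    ... | yes refl = fuel-here
    ... | no _ = fuel I i'
    I₁ : Inv A₁ C₁ (f [ i ↦ k ])
    I₁ = record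
      { nonempty = n≢0⇒n>0 λ z → <⇒≱ few (≤-trans (≤-reflexive (trans (cong (E *_) z) (*-zeroʳ E))) z≤n)
      ; rich = λ a i' p → rich I a i' (∧ˡ p)
      ; sub = sub₁ ; lost = lost₁ ; fuel = fuel₁ }
  ... | A' , B' , sa , sb , den , lb , la = A' , B' , (λ a p → ∧ˡ (sa a p)) , sb , den , lb ,
    ≤-trans (<⇒≤ few) (≤-trans (*-monoʳ-≤ E la) (≤-reflexive (sym (*-assoc E (E ^ s) _))))

  -- Each of the `j` graphs starts with `2 * D * E` units of fuel, and every unit that is burnt
  -- costs `A` a factor of at most `E`.
  purify : ∀ A → 0 < # A → Rich A → Result A (j * (2 * D * E))
  purify A 0<A ri = loop _ A B (λ _ → 2 * D * E) (≤-reflexive (∑-const j _)) (record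
    { nonempty = 0<A ; rich = ri ; sub = λ i v p → p
    ; lost = λ a i p → ≤-trans (≤-reflexive (trans (cong (2 * D *_) (#-empty (G i a ∩ (B i ∖ B i)) (none a i))) (*-zeroʳ (2 * D)))) z≤n
    ; fuel = λ i → ≤-refl })
    where
    none : ∀ a i v → v ∉ G i a ∩ (B i ∖ B i)
    none a i v = ¬true⇒false λ p → true≢false (∖ˡ (B i) (B i) (∧ʳ {G i a v} p)) (∖ʳ (B i) (B i) (∧ʳ {G i a v} p))

-- Ramsey's theorem for colourings of the pairs i < j

next : ∀ {N r} → (Fin N → Fin N → Fin r) → Fin r → Sub N → Fin N → Sub N
next γ c P i j = P j ∧ (⌊ i Fin.<? j ⌋ ∧ [ γ i j ≐ c ])

-- P contains an increasing sequence of k indices all of whose pairs have colour c.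
Mono : ∀ {N r} → (Fin N → Fin N → Fin r) → Fin r → ℕ → Sub N → Set
Mono γ c zero P = ⊤
Mono γ c (suc k) P = ∃ λ i → i ∈ P × Mono γ c k (next γ c P i)

mono? : ∀ {N r} (γ : Fin N → Fin N → Fin r) c k P → Dec (Mono γ c k P)
mono? γ c zero P = yes tt
mono? γ c (suc k) P = Fin.any? (λ i → (P i Bool.≟ true) ×-dec mono? γ c k (next γ c P i))

Mono-⊆ : ∀ {N r} (γ : Fin N → Fin N → Fin r) c k {P Q} → P ⊆ Q → Mono γ c k P → Mono γ c k Q
Mono-⊆ γ c zero h _ = tt
Mono-⊆ γ c (suc k) {P} {Q} h (i , p , m) =
  i , h i p , Mono-⊆ γ c k (λ j q → ∧⁺ (h j (∧ˡ q)) (∧ʳ {P j} q)) m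

Mono⇒sequence : ∀ {N r} (γ : Fin N → Fin N → Fin r) c k {P} → Mono γ c k P →
                ∃ λ (f : Fin k → Fin N) → (∀ a → f a ∈ P) × (∀ a b → a Fin.< b → f a Fin.< f b × γ (f a) (f b) ≡ c)
Mono⇒sequence γ c zero _ = (λ ()) , (λ ()) , λ ()
Mono⇒sequence γ c (suc k) {P} (i , p , m) with Mono⇒sequence γ c k m
... | f , inP , inc = i ◂ f , (λ { zero → p ; (suc a) → ∧ˡ (inP a) }) , inc'
  where
  inc' : ∀ a b → a Fin.< b → (i ◂ f) a Fin.< (i ◂ f) b × γ ((i ◂ f) a) ((i ◂ f) b) ≡ c
  inc' zero (suc b) _ = dec⁻ (i Fin.<? f b) (∧ˡ (∧ʳ {P (f b)} (inP b))) , ≐⁻ (∧ʳ {⌊ i Fin.<? f b ⌋} (∧ʳ {P (f b)} (inP b)))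
  inc' (suc a) (suc b) lt = inc a b (s≤s⁻¹ lt)

-- The least index passes to its most frequent colour among the later indices, and the target of
-- that colour drops by one; hence the targets `k` differ by colour. With base `r + 1` instead of
-- `r` the removed index is paid for: `(r + 1) * y ≤ 1 + r * x` with `y` and `r` positive forces
-- `y ≤ x`.
ramsey : ∀ {N r} (γ : Fin N → Fin N → Fin r) → Fin r → ∀ s (k : Fin r → ℕ) → ∑ k ≤ s → ∀ P → suc r ^ s ≤ # P →
         ∃ λ c → Mono γ c (k c) P
ramsey γ c₀ zero k bound P big = c₀ , subst (λ z → Mono γ c₀ z P) (sym (n≤0⇒n≡0 (≤-trans (term≤∑ k c₀) bound))) tt
ramsey {N} {r} γ c₀ (suc s) k bound P big with argmin P toℕ
... | inj₁ none = ⊥-elim (<⇒≱ (≤-trans (m^n>0 (suc r) (suc s)) big) (≤-reflexive (#-empty P none)))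
... | inj₂ (i , p , least) with popular c₀ (λ j → P j ∧ ⌊ i Fin.<? j ⌋) (γ i)
... | c , pop with k c in eq
... | zero = c , subst (λ z → Mono γ c z P) (sym eq) tt
... | suc m with ramsey γ c₀ s (k [ c ↦ m ]) (s≤s⁻¹ (≤-trans (≤-reflexive (∑-update k c m eq)) bound)) (next γ c P i) big'
  where
  open ≤-Reasoning
  rest : Sub N
  rest j = P j ∧ ⌊ i Fin.<? j ⌋
  cover : P ⊆ only i ∪ rest
  cover j q with i Fin.≟ j
  ... | yes _ = refl
  ... | no ne = ∧⁺ q (dec⁺ (i Fin.<? j) (≤∧≢⇒< (least j q) (λ e → ne (Fin.toℕ-injective e))))
  x y : ℕ
  x = # (next γ c P i)
  y = suc r ^ s
  total : y + r * y ≤ 1 + r * x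
  total = begin
    y + r * y                                     ≤⟨ big ⟩
    # P                                           ≤⟨ #-mono cover ⟩
    # (only i ∪ rest)                             ≤⟨ #-∪ (only i) rest ⟩
    # (only i) + # rest                           ≡⟨ cong (_+ # rest) (#-only i) ⟩
    1 + # rest                                    ≤⟨ +-monoʳ-≤ 1 pop ⟩
    1 + r * # (λ j → rest j ∧ [ γ i j ≐ c ])      ≤⟨ +-monoʳ-≤ 1 (*-monoʳ-≤ r (#-mono {P = λ j → rest j ∧ [ γ i j ≐ c ]}
                                                       (λ j q → ∧⁺ (∧ˡ {P j} (∧ˡ {rest j} q)) (∧⁺ (∧ʳ {P j} (∧ˡ {rest j} q)) (∧ʳ {rest j} q))))) ⟩
    1 + r * x                                     ∎
  big' : y ≤ x
  big' = ≮⇒≥ λ lt → <⇒≱ {1} {y + r} (+-mono-≤ (m^n>0 (suc r) s) (≤-trans (s≤s z≤n) (Fin.toℕ<n c₀)))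
    (+-cancelʳ-≤ (r * y) (y + r) 1 (begin
      y + r + r * y       ≡⟨ arith y r (r * y) ⟩
      y + r * y + r       ≤⟨ +-monoˡ-≤ r total ⟩
      1 + r * x + r       ≡⟨ cong suc (trans (+-comm (r * x) r) (sym (*-suc r x))) ⟩
      1 + r * suc x       ≤⟨ +-monoʳ-≤ 1 (*-monoʳ-≤ r lt) ⟩
      1 + r * y           ∎))
    where
    arith : ∀ a b c → a + b + c ≡ a + c + b
    arith = solve-∀
... | c' , mo = c' , lift c' mo
  where
  lift : ∀ c' → Mono γ c' ((k [ c ↦ m ]) c') (next γ c P i) → Mono γ c' (k c') P
  lift c' mo with c Fin.≟ c'
  ... | yes refl = subst (λ z → Mono γ c z P) (sym eq) (i , p , mo)
  ... | no _ = Mono-⊆ γ c' (k c') (λ j q → ∧ˡ q) mo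

-- Only increasing pairs are ever read, and the new layer has index zero; `c₀` fills the other
-- entries.
extend-γ : ∀ {j r} → Fin r → (Fin j → Fin r) → (Fin j → Fin j → Fin r) → Fin (suc j) → Fin (suc j) → Fin r
extend-γ c₀ σ γ zero zero = c₀
extend-γ c₀ σ γ zero (suc b) = σ b
extend-γ c₀ σ γ (suc a) zero = c₀
extend-γ c₀ σ γ (suc a) (suc b) = γ a b

Mono-extend⁻ : ∀ {j r} (c₀ : Fin r) (σ : Fin j → Fin r) γ c k {P} → Mono (extend-γ c₀ σ γ) c k P → zero ∉ P → Mono γ c k (P ∘ suc)
Mono-extend⁻ c₀ σ γ c zero _ _ = tt
Mono-extend⁻ c₀ σ γ c (suc k) (zero , p , m) z = ⊥-elim (true≢false p z)
Mono-extend⁻ c₀ σ γ c (suc k) {P} (suc i , p , m) z =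
  i , p , Mono-⊆ γ c k down (Mono-extend⁻ c₀ σ γ c k m (¬true⇒false λ q → true≢false (∧ʳ {P zero} q) refl))
  where
  down : next (extend-γ c₀ σ γ) c P (suc i) ∘ suc ⊆ next γ c (P ∘ suc) i
  down j q = ∧⁺ {P (suc j)} (∧ˡ q) (∧⁺ (dec⁺ (i Fin.<? j) (s≤s⁻¹ (dec⁻ (suc i Fin.<? suc j) (∧ˡ (∧ʳ {P (suc j)} q)))))
                           (∧ʳ {⌊ suc i Fin.<? suc j ⌋} (∧ʳ {P (suc j)} q)))

-- This keeps a growing chain free of large cliques. A clique through the new index leaves one that
-- is smaller by one among the indices seen in colour `c`, and this is just what would have made the
-- vertices of the new layer absorbable.
Mono-extend : ∀ {j r} (c₀ : Fin r) (σ : Fin j → Fin r) γ c k → Mono (extend-γ c₀ σ γ) c (suc k) full →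
              Mono γ c k (λ i → [ σ i ≐ c ]) ⊎ Mono γ c (suc k) full
Mono-extend c₀ σ γ c k (zero , p , m) = inj₁ (Mono-⊆ γ c k (λ i q → ∧ʳ {⌊ zero {n = 0} Fin.<? suc i ⌋} q) (Mono-extend⁻ c₀ σ γ c k m refl))
Mono-extend c₀ σ γ c k (suc i , p , m) = inj₂ (i , p , Mono-⊆ γ c k down (Mono-extend⁻ c₀ σ γ c k m refl))
  where
  down : next (extend-γ c₀ σ γ) c full (suc i) ∘ suc ⊆ next γ c full i
  down j q = ∧⁺ (dec⁺ (i Fin.<? j) (s≤s⁻¹ (dec⁻ (suc i Fin.<? suc j) (∧ˡ q)))) (∧ʳ {⌊ suc i Fin.<? suc j ⌋} q)

-- Chains of layers

module Chains {r n : ℕ} (c : Colouring r n) (c₀ : Fin r) (D₀ : ℕ) (r≤D₀ : r ≤ D₀) where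

  0<r : 0 < r
  0<r = ≤-trans (s≤s z≤n) (Fin.toℕ<n c₀)

  0<D₀ : 0 < D₀
  0<D₀ = ≤-trans 0<r r≤D₀

  -- What an older layer may lose in one step: a factor 2 for the deletion of used vertices and
  -- `2 * D₀` for purification.
  κ : ℕ
  κ = 2 * (2 * D₀)

  0<κ : 0 < κ
  0<κ = *-mono-≤ {1} {2} (s≤s z≤n) (*-mono-≤ {1} {2} (s≤s z≤n) 0<D₀)

  N[_] : Fin r → Fin n → Sub n
  N[ γ ] u v = [ col c u v ≐ γ ]

  -- Layer 0 is the most recent one; the density of a pair of layers is that seen from the more recent one.
  record Chain (j E : ℕ) : Set where
    field
      layer : Fin j → Sub n
      pair  : Fin j → Fin j → Fin r
      dense : ∀ a b → a Fin.< b → Dense N[ pair a b ] (layer a) (layer b) E (2 * D₀)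

  open Chain public

  -- The factor by which `purify` may shrink a new layer that faces `j` older ones.
  loss : ℕ → ℕ → ℕ
  loss j E = E ^ (j * (2 * D₀ * E))

  -- `Y₁` stands for the older layers without the vertices that are already used. Old pairs pay for
  -- their shrinking with the factor `κ` of their density parameter; new pairs are purified at the
  -- full strength `E₀`.
  extend : ∀ {j E} E₀ (K : Chain j (κ * E)) → E ≤ E₀ → 0 < E₀ → (Y₁ : Fin j → Sub n) → (∀ i → Y₁ i ⊆ layer K i) →
           (∀ i → # (layer K i) ≤ 2 * # (Y₁ i)) → (∀ i → 0 < # (Y₁ i)) →
           ∀ A σ → 0 < # A → (∀ a i → a ∈ A → # (Y₁ i) ≤ D₀ * # (N[ σ i ] a ∩ Y₁ i)) →
           ∃ λ A' → ∃ λ (Y' : Fin j → Sub n) → A' ⊆ A × (∀ i → Y' i ⊆ Y₁ i) × (∀ i → # (layer K i) ≤ κ * # (Y' i)) ×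
             # A ≤ loss j E₀ * # A' ×
             (∃ λ (K' : Chain (suc j) E) → layer K' ≡ A' ◂ Y' × pair K' ≡ extend-γ c₀ σ (pair K))
  extend {j} {E} E₀ K le 0<E₀ Y₁ sub half pos A σ 0<A rich
    with Purify.purify (λ i → N[ σ i ]) Y₁ D₀ E₀ 0<D₀ 0<E₀ pos A 0<A rich
  ... | A' , Y' , sa , sy , den , ly , la =
    A' , Y' , sa , sy , size , la , record { layer = A' ◂ Y' ; pair = extend-γ c₀ σ (pair K) ; dense = dense' } , refl , refl
    where
    size : ∀ i → # (layer K i) ≤ κ * # (Y' i)
    size i = ≤-trans (half i) (≤-trans (*-monoʳ-≤ 2 (ly i)) (≤-reflexive (sym (*-assoc 2 (2 * D₀) _))))
    dense' : ∀ a b → a Fin.< b → Dense N[ extend-γ c₀ σ (pair K) a b ] ((A' ◂ Y') a) ((A' ◂ Y') b) E (2 * D₀)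
    dense' zero (suc b) _ = Dense-weaken N[ σ b ] (2 * D₀) le (den b)
    dense' (suc a) (suc b) lt = Dense-shrink N[ pair K a b ] κ E (2 * D₀) 0<κ (λ v p → sub a v (sy a v p)) (λ v p → sub b v (sy b v p))
      (size a) (size b) (dense K a b (s≤s⁻¹ lt))

  majority : ∀ (w : Fin n) (P : Sub n) → ∃ λ γ → # P ≤ r * # (N[ γ ] w ∩ P)
  majority w P with popular c₀ P (col c w)
  ... | γ , h = γ , subst (λ z → # P ≤ r * z) (#-cong (λ v → ∧-comm (P v) [ col c w v ≐ γ ])) h

  -- The type of a vertex: its majority colours towards the layers. The numerical code allows
  -- pigeonholing over the types and processing them one by one.
  key : ∀ {j} → (Fin j → Sub n) → Fin n → Fin (r ^ j)
  key Y w = funToFin (λ i → proj₁ (majority w (Y i)))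

  key-majority : ∀ {j} (Y : Fin j → Sub n) w q → key Y w ≡ q → ∀ i → # (Y i) ≤ r * # (N[ finToFun q i ] w ∩ Y i)
  key-majority {j} Y w q refl i = subst (λ γ → # (Y i) ≤ r * # (N[ γ ] w ∩ Y i))
    (sym (Fin.finToFun-funToFin (λ i → proj₁ (majority w (Y i))) i)) (proj₂ (majority w (Y i)))

  popular-key : ∀ {j} (Y : Fin j → Sub n) (W : Sub n) → 0 < # W →
                ∃ λ q → # W ≤ r ^ j * # (λ w → W w ∧ [ key Y w ≐ q ])
  popular-key Y W 0<W with 0<#⇒∈ W 0<W
  ... | w , _ = popular (key Y w) W (key Y)

  -- Long chains inside a given set and their one-coloured subchains

  module Hosts (N E : ℕ) (0<E : 0 < E) where

    -- The density parameter that is required while `f` further extensions are still to come.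
    level : ℕ → ℕ
    level zero = E
    level (suc f) = κ * level f

    E₀ : ℕ
    E₀ = level N

    -- `Λ` is what a new layer loses against `W`, by pigeonholing over its type and by purification;
    -- `Γ` adds the factor `κ` for each of at most `N` later extensions.
    Λ Γ : ℕ
    Λ = r ^ N * loss N E₀
    Γ = κ ^ N * Λ

    level-mono : ∀ {f g} → f ≤ g → level f ≤ level g
    level-mono {zero} {zero} _ = ≤-refl
    level-mono {zero} {suc g} _ = ≤-trans (level-mono {zero} {g} z≤n) (m≤n*m (level g) κ ⦃ >-nonZero 0<κ ⦄)
    level-mono (s≤s le) = *-monoʳ-≤ κ (level-mono le)

    0<E₀ : 0 < E₀
    0<E₀ = ≤-trans 0<E (level-mono {0} {N} z≤n)

    0<loss : ∀ j → 0 < loss j E₀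
    0<loss j = m^n>0 E₀ ⦃ >-nonZero 0<E₀ ⦄ (j * (2 * D₀ * E₀))

    loss≤ : ∀ {j} → j ≤ N → loss j E₀ ≤ loss N E₀
    loss≤ le = ^-monoʳ-≤ E₀ ⦃ >-nonZero 0<E₀ ⦄ (*-monoˡ-≤ (2 * D₀ * E₀) le)

    r^≤ : ∀ {j} → j ≤ N → r ^ j ≤ r ^ N
    r^≤ = ^-monoʳ-≤ r ⦃ >-nonZero 0<r ⦄

    -- Every layer is cut from the whole of `W`, within its most frequent type, and is thus a fixed
    -- share of `W`. The layers may overlap; the embeddings avoid used vertices themselves.
    chain-in : ∀ W → 0 < # W → ∀ j f → j + f ≡ N →
               ∃ λ (K : Chain j (level f)) → (∀ i → layer K i ⊆ W) × (∀ i → # W ≤ κ ^ j * Λ * # (layer K i))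
    chain-in W 0<W zero f eq = record { layer = λ () ; pair = λ () ; dense = λ () } , (λ ()) , λ ()
    chain-in W 0<W (suc j) f eq with chain-in W 0<W j (suc f) (trans (+-suc j f) eq)
    ... | K₀ , sub , big with popular-key (layer K₀) W 0<W
    ... | q , pop with extend E₀ K₀ (level-mono {f} {N} (≤-trans (m≤n+m f (suc j)) (≤-reflexive eq))) 0<E₀
                        (layer K₀) (λ i v p → p)
                        (λ i → m≤n*m _ 2)
                        pos A (finToFun q) 0<A
                        (λ a i p → ≤-trans (key-majority (layer K₀) a q (≐⁻ (∧ʳ {W a} p)) i) (*-monoˡ-≤ _ r≤D₀))
      where
      pos : ∀ i → 0 < # (layer K₀ i)
      pos i = n≢0⇒n>0 λ z → <⇒≱ 0<W (≤-trans (big i) (≤-reflexive (trans (cong (κ ^ j * Λ *_) z) (*-zeroʳ (κ ^ j * Λ)))))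
      A : Sub n
      A w = W w ∧ [ key (layer K₀) w ≐ q ]
      0<A : 0 < # A
      0<A = n≢0⇒n>0 λ z → <⇒≱ 0<W (≤-trans pop (≤-reflexive (trans (cong (r ^ j *_) z) (*-zeroʳ (r ^ j)))))
    ... | A' , Y' , sa , sy , ly , la , K , eqY , _ = K , subst (λ Y → ∀ i → Y i ⊆ W) (sym eqY) sub' , subst (λ Y → ∀ i → # W ≤ κ ^ suc j * Λ * # (Y i)) (sym eqY) big'
      where
      open ≤-Reasoning
      j≤N : j ≤ N
      j≤N = ≤-trans (m≤m+n j (suc f)) (≤-reflexive (trans (+-suc j f) eq))
      sub' : ∀ i → (A' ◂ Y') i ⊆ W
      sub' zero v p = ∧ˡ (sa v p)
      sub' (suc i) v p = sub i v (sy i v p)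
      arith : ∀ a b c d → a * b * (c * d) ≡ c * a * b * d
      arith = solve-∀
      big' : ∀ i → # W ≤ κ ^ suc j * Λ * # ((A' ◂ Y') i)
      big' (suc i) = begin
        # W                              ≤⟨ big i ⟩
        κ ^ j * Λ * # (layer K₀ i)           ≤⟨ *-monoʳ-≤ (κ ^ j * Λ) (ly i) ⟩
        κ ^ j * Λ * (κ * # (Y' i))       ≡⟨ arith (κ ^ j) Λ κ (# (Y' i)) ⟩
        κ ^ suc j * Λ * # (Y' i)         ∎
      big' zero = begin
        # W                                           ≤⟨ pop ⟩
        r ^ j * _                                     ≤⟨ *-monoʳ-≤ (r ^ j) la ⟩
        r ^ j * (loss j E₀ * # A')                    ≡⟨ sym (*-assoc (r ^ j) _ _) ⟩
        r ^ j * loss j E₀ * # A'                      ≤⟨ *-monoˡ-≤ (# A') (*-mono-≤ (r^≤ j≤N) (loss≤ j≤N)) ⟩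
        Λ * # A'                                      ≤⟨ *-monoˡ-≤ (# A') (m≤n*m Λ (κ ^ suc j) ⦃ m^n≢0 κ (suc j) ⦃ >-nonZero 0<κ ⦄ ⦄) ⟩
        κ ^ suc j * Λ * # A'                          ∎

    record HostSystem (k : ℕ) (W : Sub n) : Set where
      field
        H : Fin k → Sub n
        hue : Fin r
        H⊆ : ∀ i → H i ⊆ W
        H-dense : ∀ a b → a Fin.< b → Dense N[ hue ] (H a) (H b) E (2 * D₀)
        H-big : ∀ i → # W ≤ Γ * # (H i)

    hosts : ∀ k W → suc r ^ (r * k) ≤ N → 0 < # W → HostSystem k W
    hosts k W le 0<W with chain-in W 0<W N 0 (+-identityʳ N)
    ... | K , sub , big with ramsey (pair K) c₀ (r * k) (λ _ → k) (≤-reflexive (∑-const r k)) full (≤-trans le (≤-reflexive (sym (#-full N))))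
    ... | g , mo with Mono⇒sequence (pair K) g k mo
    ... | f , _ , inc = record
      { H = layer K ∘ f ; hue = g ; H⊆ = λ i → sub (f i)
      ; H-dense = λ a b lt → subst (λ z → Dense N[ z ] (layer K (f a)) (layer K (f b)) E (2 * D₀)) (proj₂ (inc a b lt)) (dense K (f a) (f b) (proj₁ (inc a b lt)))
      ; H-big = λ i → big (f i) }

-- Greedy embedding of bounded-degree graphs

-- Candidate sets start with at least a 1/`d₀` share of their layer, and each embedded neighbour
-- costs a factor `D`, so a 1/`L` share always remains. The bounds on `E` and on the layers make the
-- exceptional vertices at most half of a candidate set and the occupied ones less than half.
module Embedding {M n k : ℕ} (a : Fin M → Fin M → Bool) (a-sym : ∀ x y → a x y ≡ a y x)
  (Δ : ℕ) (0<Δ : 0 < Δ) (a-deg : ∀ x → # (a x) ≤ Δ)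
  (G : Fin n → Fin n → Bool) (G-sym : ∀ u v → G u v ≡ G v u)
  (κ : Fin M → Fin k) (H : Fin k → Sub n) (d₀ D E : ℕ) (0<D : 0 < D)
  (H-dense : ∀ i j → i Fin.< j → Dense G (H i) (H j) E D)
  (big-E : 2 * (d₀ * D ^ Δ) * Δ ≤ E) (H-big : ∀ i → 2 * (d₀ * D ^ Δ) * M < # (H i)) where

  L : ℕ
  L = d₀ * D ^ Δ

  -- The vertices of `Q` outside `S` remain open but keep large candidate sets; in an absorber they
  -- are placed afterwards by a matching and by representatives.
  record Embedded (S Q : Sub M) (C₀ : Fin M → Sub n) : Set where
    field
      φ     : Fin M → Fin n
      C     : Fin M → Sub n
      φ∈C₀  : ∀ x → x ∈ S → φ x ∈ C₀ x
      φ-inj : ∀ x y → x ∈ S → y ∈ S → φ x ≡ φ y → x ≡ y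
      edge  : ∀ x y → x ∈ S → y ∈ S → a x y ≡ true → G (φ x) (φ y) ≡ true
      C⊆C₀  : ∀ y → C y ⊆ C₀ y
      C-adj : ∀ x y u → x ∈ S → a x y ≡ true → u ∈ C y → G (φ x) u ≡ true
      C-big : ∀ y → y ∈ Q → y ∉ S → # (H (κ y)) ≤ L * # (C y)

  -- Vertices are placed in increasing order of κ, i.e. the most recent layers are used first, so that density of a
  -- pair of layers is only needed in one direction.
  module _ (S Q : Sub M) (S⊆Q : S ⊆ Q)
    (proper : ∀ x y → x ∈ S → y ∈ S → a x y ≡ true → ¬ (κ x ≡ κ y))
    (before : ∀ x y → x ∈ S → y ∈ Q → y ∉ S → a x y ≡ true → κ x Fin.< κ y)
    (C₀ : Fin M → Sub n) (C₀⊆H : ∀ y → C₀ y ⊆ H (κ y)) (C₀-big : ∀ y → y ∈ Q → # (H (κ y)) ≤ d₀ * # (C₀ y)) where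

    record State (e : Sub M) : Set where
      field
        φ     : Fin M → Fin n
        C     : Fin M → Sub n
        e⊆S   : e ⊆ S
        φ∈C₀  : ∀ x → x ∈ e → φ x ∈ C₀ x
        φ-inj : ∀ x y → x ∈ e → y ∈ e → φ x ≡ φ y → x ≡ y
        edge  : ∀ x y → x ∈ e → y ∈ e → a x y ≡ true → G (φ x) (φ y) ≡ true
        C⊆C₀  : ∀ y → C y ⊆ C₀ y
        C-adj : ∀ x y u → x ∈ e → a x y ≡ true → u ∈ C y → G (φ x) u ≡ true
        C-big : ∀ y → y ∈ Q → y ∉ e → # (H (κ y)) ≤ d₀ * D ^ # (a y ∩ e) * # (C y)

    C-big-L : ∀ {e} (s : State e) y → y ∈ Q → y ∉ e → # (H (κ y)) ≤ L * # (State.C s y)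
    C-big-L {e} s y q ne = ≤-trans (State.C-big s y q ne) (*-monoˡ-≤ (# (State.C s y)) (*-monoʳ-≤ d₀
      (^-monoʳ-≤ D ⦃ >-nonZero 0<D ⦄ (≤-trans (#-mono {P = a y ∩ e} (λ v → ∧ˡ)) (a-deg y)))))

    -- Minimality of `κ x` puts every neighbour still to be served into a strictly later layer: ties
    -- are excluded by `proper`, vertices outside `S` are covered by `before`. So `H-dense` applies
    -- to each neighbour, and a union bound over at most `Δ` of them leaves a good vertex.
    choose : ∀ {e} (s : State e) x → x ∈ S → x ∉ e → (∀ y → y ∈ S ∖ e → toℕ (κ x) ≤ toℕ (κ y)) →
             ∃ λ v → v ∈ State.C s x × v ∉ image (State.φ s) e ×
               (∀ y → y ∈ a x ∩ (Q ∖ e) → # (State.C s y) ≤ D * # (G v ∩ State.C s y))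
    choose {e} s x xS xe least = finish (pick (C x) (Bd ∪ used) room)
      where
      open State s
      open ≤-Reasoning
      h = # (H (κ x))
      Ny = a x ∩ (Q ∖ e)
      Bd used : Sub n
      Bd v = some (λ y → Ny y ∧ bad G (H (κ x)) D (C y) v)
      used = image φ e
      later : ∀ y → y ∈ Ny → κ x Fin.< κ y
      later y p with bool (S y)
      ... | inj₂ no' = before x y xS (∖ˡ Q e (∧ʳ {a x y} p)) no' (∧ˡ p)
      ... | inj₁ yS = ≤∧≢⇒< (least y (∖⁺ S e yS (∖ʳ Q e (∧ʳ {a x y} p)))) (λ eq → proper x y xS yS (∧ˡ p) (Fin.toℕ-injective eq))
      L≤E : L ≤ E
      L≤E = begin
        L            ≤⟨ m≤n*m L 2 ⟩
        2 * L        ≤⟨ m≤m*n (2 * L) Δ ⦃ >-nonZero 0<Δ ⦄ ⟩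
        2 * L * Δ    ≤⟨ big-E ⟩
        E            ∎
      few : E * # Bd ≤ Δ * h
      few = ≤-trans (union-bound Ny (λ y → bad G (H (κ x)) D (C y)) E h (λ y p → H-dense (κ x) (κ y) (later y p) (C y)
          (λ u q → C₀⊆H y u (C⊆C₀ y u q))
          (≤-trans (C-big-L s y (∖ˡ Q e (∧ʳ {a x y} p)) (∖ʳ Q e (∧ʳ {a x y} p))) (*-monoˡ-≤ (# (C y)) L≤E))))
        (*-monoˡ-≤ h (≤-trans (#-mono {P = Ny} (λ v → ∧ˡ)) (a-deg x)))
      Bd-small : 2 * L * # Bd ≤ h
      Bd-small = *-cancelˡ-≤ Δ ⦃ >-nonZero 0<Δ ⦄ (begin
        Δ * (2 * L * # Bd)   ≡⟨ arith Δ (2 * L) (# Bd) ⟩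
        2 * L * Δ * # Bd     ≤⟨ *-monoˡ-≤ (# Bd) big-E ⟩
        E * # Bd             ≤⟨ few ⟩
        Δ * h                ∎)
        where
        arith : ∀ a b c → a * (b * c) ≡ b * a * c
        arith = solve-∀
      room : # (Bd ∪ used) < # (C x)
      room = *-cancelˡ-< (2 * L) _ _ (begin-strict
        2 * L * # (Bd ∪ used)           ≤⟨ *-monoʳ-≤ (2 * L) (#-∪ Bd used) ⟩
        2 * L * (# Bd + # used)         ≡⟨ *-distribˡ-+ (2 * L) (# Bd) _ ⟩
        2 * L * # Bd + 2 * L * # used   ≤⟨ +-mono-≤ Bd-small (*-monoʳ-≤ (2 * L) (≤-trans (#-image-≤ φ e) (≤-trans (#-mono {P = e} (λ _ _ → refl)) (≤-reflexive (#-full M))))) ⟩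
        h + 2 * L * M                   <⟨ +-monoʳ-< h (H-big (κ x)) ⟩
        h + h                           ≤⟨ +-mono-≤ hL hL ⟩
        L * # (C x) + L * # (C x)       ≡⟨ arith L (# (C x)) ⟩
        2 * L * # (C x)                 ∎)
        where
        hL = C-big-L s x (S⊆Q x xS) xe
        arith : ∀ a b → a * b + a * b ≡ 2 * a * b
        arith = solve-∀
      good : ∀ v → v ∈ C x → v ∉ Bd → ∀ y → y ∈ Ny → # (C y) ≤ D * # (G v ∩ C y)
      good v v∈C v∉Bd y p = ≮⇒≥ λ lt → true≢false (∧⁺ p (∧⁺ (C₀⊆H x v (C⊆C₀ x v v∈C)) (dec⁺ (_ <? _) lt)))
        (some⁻ᶠ (λ y → Ny y ∧ bad G (H (κ x)) D (C y) v) v∉Bd y)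
      finish : (∃ λ v → v ∈ C x × v ∉ Bd ∪ used) → ∃ λ v → v ∈ C x × v ∉ used × (∀ y → y ∈ Ny → # (C y) ≤ D * # (G v ∩ C y))
      finish (v , v∈C , out) = v , v∈C , ∉-⊆ {P = used} {Bd ∪ used} (λ w → ∨⁺ʳ {Bd w}) out
                                 , good v v∈C (∉-⊆ {P = Bd} {Bd ∪ used} (λ w → ∨⁺ˡ) out)

    place : ∀ {e} (s : State e) x → x ∈ S → x ∉ e → ∀ v → v ∈ State.C s x → v ∉ image (State.φ s) e →
            (∀ y → y ∈ a x ∩ (Q ∖ e) → # (State.C s y) ≤ D * # (G v ∩ State.C s y)) → State (e ∪ only x)
    place {e} s x xS xe v v∈C v∉used v-good = record
      { φ = φ' ; C = C' ; e⊆S = e'⊆S ; φ∈C₀ = in' ; φ-inj = inj' ; edge = edge'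
      ; C⊆C₀ = λ y u p → C⊆C₀ y u (C'⊆C y u p) ; C-adj = adj' ; C-big = big' }
      where
      open State s
      open ≤-Reasoning
      φ' : Fin M → Fin n
      φ' = φ [ x ↦ v ]
      C' : Fin M → Sub n
      C' y = if a x y then G v ∩ C y else C y
      φ'-x : φ' x ≡ v
      φ'-x rewrite ≐-refl x = refl
      φ'-e : ∀ y → y ∈ e → φ' y ≡ φ y
      φ'-e y p with x Fin.≟ y
      ... | yes refl = ⊥-elim (true≢false p xe)
      ... | no _ = refl
      cases : ∀ y → y ∈ e ∪ only x → y ∈ e ⊎ x ≡ y
      cases y p with ∨⁻ {e y} p
      ... | inj₁ q = inj₁ q
      ... | inj₂ q = inj₂ (≐⁻ q)
      e'⊆S : e ∪ only x ⊆ S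
      e'⊆S y p with cases y p
      ... | inj₁ q = e⊆S y q
      ... | inj₂ refl = xS
      C'⊆C : ∀ y → C' y ⊆ C y
      C'⊆C y u p with a x y
      ... | true = ∧ʳ {G v u} p
      ... | false = p
      in' : ∀ y → y ∈ e ∪ only x → φ' y ∈ C₀ y
      in' y p with cases y p
      ... | inj₁ q rewrite φ'-e y q = φ∈C₀ y q
      ... | inj₂ refl rewrite φ'-x = C⊆C₀ x v v∈C
      fresh : ∀ y → y ∈ e → ¬ (φ y ≡ v)
      fresh y q eq = true≢false (subst (_∈ image φ e) eq (image⁺ φ e q)) v∉used
      inj' : ∀ y z → y ∈ e ∪ only x → z ∈ e ∪ only x → φ' y ≡ φ' z → y ≡ z
      inj' y z p q eq with cases y p | cases z q
      ... | inj₁ p' | inj₁ q' = φ-inj y z p' q' (trans (sym (φ'-e y p')) (trans eq (φ'-e z q')))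
      ... | inj₂ refl | inj₂ refl = refl
      ... | inj₁ p' | inj₂ refl = ⊥-elim (fresh y p' (trans (sym (φ'-e y p')) (trans eq φ'-x)))
      ... | inj₂ refl | inj₁ q' = ⊥-elim (fresh z q' (trans (sym (φ'-e z q')) (trans (sym eq) φ'-x)))
      edge' : ∀ y z → y ∈ e ∪ only x → z ∈ e ∪ only x → a y z ≡ true → G (φ' y) (φ' z) ≡ true
      edge' y z p q ad with cases y p | cases z q
      ... | inj₁ p' | inj₁ q' rewrite φ'-e y p' | φ'-e z q' = edge y z p' q' ad
      ... | inj₂ refl | inj₂ refl = ⊥-elim (proper x x xS xS ad refl)
      ... | inj₁ p' | inj₂ refl rewrite φ'-e y p' | φ'-x = C-adj y x v p' ad v∈C
      ... | inj₂ refl | inj₁ q' rewrite φ'-x | φ'-e z q' =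
        trans (G-sym v (φ z)) (C-adj z x v q' (trans (a-sym z x) ad) v∈C)
      adj' : ∀ y z u → y ∈ e ∪ only x → a y z ≡ true → u ∈ C' z → G (φ' y) u ≡ true
      adj' y z u p ad m with cases y p
      ... | inj₁ p' rewrite φ'-e y p' = C-adj y z u p' ad (C'⊆C z u m)
      ... | inj₂ refl rewrite φ'-x | ad = ∧ˡ m
      big' : ∀ y → y ∈ Q → y ∉ e ∪ only x → # (H (κ y)) ≤ d₀ * D ^ # (a y ∩ (e ∪ only x)) * # (C' y)
      big' y yQ ye' with a x y in ad
      ... | false = ≤-trans (C-big y yQ y∉e) (*-monoˡ-≤ (# (C y)) (*-monoʳ-≤ d₀ (^-monoʳ-≤ D ⦃ >-nonZero 0<D ⦄
                      (#-mono {P = a y ∩ e} (λ z p → ∧⁺ {a y z} (∧ˡ p) (∨⁺ˡ (∧ʳ {a y z} p)))))))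
        where
        y∉e : y ∉ e
        y∉e = ¬true⇒false λ p → true≢false (∨⁺ˡ {e y} {only x y} p) ye'
      ... | true = begin
        # (H (κ y))                                       ≤⟨ C-big y yQ y∉e ⟩
        d₀ * D ^ m * # (C y)                              ≤⟨ *-monoʳ-≤ (d₀ * D ^ m) (v-good y (∧⁺ ad (∖⁺ Q e yQ y∉e))) ⟩
        d₀ * D ^ m * (D * # (G v ∩ C y))                  ≡⟨ arith d₀ (D ^ m) D _ ⟩
        d₀ * D ^ suc m * # (G v ∩ C y)                    ≤⟨ *-monoˡ-≤ (# (G v ∩ C y)) (*-monoʳ-≤ d₀ (^-monoʳ-≤ D ⦃ >-nonZero 0<D ⦄ more)) ⟩
        d₀ * D ^ # (a y ∩ (e ∪ only x)) * # (G v ∩ C y)   ∎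
        where
        m = # (a y ∩ e)
        y∉e : y ∉ e
        y∉e = ¬true⇒false λ p → true≢false (∨⁺ˡ {e y} {only x y} p) ye'
        arith : ∀ a b c d → a * b * (c * d) ≡ a * (c * b) * d
        arith = solve-∀
        more : suc m ≤ # (a y ∩ (e ∪ only x))
        more = begin
          suc m                       ≡⟨ +-comm 1 m ⟩
          m + 1                       ≡⟨ cong (m +_) (sym (#-only x)) ⟩
          m + # (only x)              ≡⟨ sym (#-∪-disjoint (a y ∩ e) (only x) (λ z p → ≐⁺ᶠ λ { refl → true≢false (∧ʳ {a y x} p) xe })) ⟩
          # ((a y ∩ e) ∪ only x)      ≤⟨ #-mono {P = (a y ∩ e) ∪ only x} incl ⟩
          # (a y ∩ (e ∪ only x))      ∎
          where
          incl : (a y ∩ e) ∪ only x ⊆ a y ∩ (e ∪ only x)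
          incl z p with ∨⁻ {(a y ∩ e) z} p
          ... | inj₁ q = ∧⁺ {a y z} (∧ˡ q) (∨⁺ˡ (∧ʳ {a y z} q))
          ... | inj₂ q with ≐⁻ {x = x} {z} q
          ... | refl = ∧⁺ (trans (a-sym y x) ad) (∨⁺ʳ {e x} q)

    step : ∀ {e} → State e → ∀ x → x ∈ S → x ∉ e → (∀ y → y ∈ S ∖ e → toℕ (κ x) ≤ toℕ (κ y)) → State (e ∪ only x)
    step {e} s x xS xe least = finish (choose s x xS xe least)
      where
      finish : (∃ λ v → v ∈ State.C s x × v ∉ image (State.φ s) e × (∀ y → y ∈ a x ∩ (Q ∖ e) → # (State.C s y) ≤ D * # (G v ∩ State.C s y))) → State (e ∪ only x)
      finish (v , v∈C , v∉used , v-good) = place s x xS xe v v∈C v∉used v-good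

    run : ∀ t {e} → State e → # (S ∖ e) ≤ t → Embedded S Q C₀
    run t {e} s le with argmin (S ∖ e) (toℕ ∘ κ)
    ... | inj₁ none = record
        { φ = φ ; C = C ; φ∈C₀ = λ x p → φ∈C₀ x (all x p)
        ; φ-inj = λ x y p q → φ-inj x y (all x p) (all y q)
        ; edge = λ x y p q → edge x y (all x p) (all y q)
        ; C⊆C₀ = C⊆C₀ ; C-adj = λ x y u p → C-adj x y u (all x p)
        ; C-big = λ y yQ yS → C-big-L s y yQ (∉-⊆ {P = e} {S} e⊆S yS) }
      where
      open State s
      all : S ⊆ e
      all x p with bool (e x)
      ... | inj₁ q = q
      ... | inj₂ q = ⊥-elim (true≢false (∖⁺ S e p q) (none x))
    run zero {e} s le | inj₂ (x , p , least) = ⊥-elim (<⇒≱ (∈⇒0<# (S ∖ e) p) le)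
    run (suc t) {e} s le | inj₂ (x , p , least) =
      run t (step s x (∖ˡ S e p) (∖ʳ S e p) least) (s≤s⁻¹ (begin
        suc (# (S ∖ (e ∪ only x)))               ≤⟨ s≤s (#-mono {P = S ∖ (e ∪ only x)} incl) ⟩
        suc (# (S ∖ e ∖ only x))                 ≡⟨ +-comm 1 _ ⟩
        # (S ∖ e ∖ only x) + 1                   ≡⟨ cong (# (S ∖ e ∖ only x) +_) (sym (#-only x)) ⟩
        # (S ∖ e ∖ only x) + # (only x)          ≡⟨ #-∖-⊆ (S ∖ e) (only x) (λ z q → subst (_∈ S ∖ e) (≐⁻ q) p) ⟩
        # (S ∖ e)                                ≤⟨ le ⟩
        suc t                                    ∎))
      where
      open ≤-Reasoning
      incl : S ∖ (e ∪ only x) ⊆ S ∖ e ∖ only x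
      incl z q = ∖⁺ (S ∖ e) (only x) (∖⁺ S e (∖ˡ S (e ∪ only x) q) (¬true⇒false λ w → true≢false (∨⁺ˡ {e z} {only x z} w) (∖ʳ S (e ∪ only x) q)))
                    (¬true⇒false λ w → true≢false (∨⁺ʳ {e z} {only x z} w) (∖ʳ S (e ∪ only x) q))

    embedding : Embedded S Q C₀
    embedding = run _ start ≤-refl
      where
      start : State ∅
      start = record
        -- Outside the embedded part the values of `φ` are arbitrary; `H-big` supplies some vertex.
        { φ = λ x → proj₁ (0<#⇒∈ (H (κ x)) (≤-trans (s≤s z≤n) (H-big (κ x)))) ; C = C₀
        ; e⊆S = λ _ () ; φ∈C₀ = λ _ () ; φ-inj = λ _ _ () ; edge = λ _ _ () ; C⊆C₀ = λ _ _ p → p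
        ; C-adj = λ _ _ _ () ; C-big = λ y q _ → subst (λ z → # (H (κ y)) ≤ d₀ * D ^ z * # (C₀ y))
            (sym (#-empty (a y ∩ ∅) (λ v → ¬true⇒false λ p → true≢false (∧ʳ {a y v} p) refl)))
            (≤-trans (C₀-big y q) (≤-reflexive (cong (_* # (C₀ y)) (sym (*-identityʳ d₀))))) }

-- Perfect matchings in bipartite graphs without large empty rectangles

⊆-of-equal-size : ∀ {n} (P Q : Sub n) → P ⊆ Q → # Q ≤ # P → Q ⊆ P
⊆-of-equal-size P Q s le v q with bool (P v)
... | inj₁ p = p
... | inj₂ np = ⊥-elim (<⇒≱ (∈⇒0<# (Q ∖ P) (∖⁺ Q P q np)) (+-cancelʳ-≤ (# P) _ _ (≤-trans (≤-reflexive (#-∖-⊆ Q P s)) le)))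

-- No appeal to Hall's theorem: with all degrees at least `p` and an edge in every `p` by `p`
-- rectangle, augmenting paths of at most five edges suffice.
module Matching {m n : ℕ} (B : Fin m → Fin n → Bool) (I : Sub m) (Y : Sub n) (p : ℕ) (size : # I ≡ # Y)
  (degˡ : ∀ x → x ∈ I → p ≤ # (B x ∩ Y)) (degʳ : ∀ y → y ∈ Y → p ≤ # (λ x → I x ∧ B x y))
  (rect : ∀ A X → A ⊆ I → X ⊆ Y → p ≤ # A → p ≤ # X → ∃ λ x → ∃ λ v → x ∈ A × v ∈ X × B x v ≡ true) where

  record Match (P : Sub m) (μ : Fin m → Fin n) : Set where
    field
      P⊆I : P ⊆ I
      μ∈Y : ∀ x → x ∈ P → μ x ∈ Y
      μ-edge : ∀ x → x ∈ P → B x (μ x) ≡ true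
      μ-inj : ∀ x y → x ∈ P → y ∈ P → μ x ≡ μ y → x ≡ y

  open Match

  update-same : ∀ (μ : Fin m → Fin n) z u → (μ [ z ↦ u ]) z ≡ u
  update-same μ z u rewrite ≐-refl z = refl

  update-other : ∀ (μ : Fin m → Fin n) z u x → ¬ (x ≡ z) → (μ [ z ↦ u ]) x ≡ μ x
  update-other μ z u x ne with z Fin.≟ x
  ... | yes e = ⊥-elim (ne (sym e))
  ... | no _ = refl

  -- `z` may be new or already matched. The last hypothesis spares `z`, which gives up its former
  -- partner.
  reassign : ∀ {P μ} → Match P μ → ∀ z u → z ∈ I → u ∈ Y → B z u ≡ true → (∀ x → x ∈ P → ¬ (x ≡ z) → ¬ (μ x ≡ u)) →
             Match (P ∪ only z) (μ [ z ↦ u ])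
  reassign {P} {μ} M z u zI uY e free = record
    { P⊆I = λ x p → [ P⊆I M x , (λ { refl → zI }) ]′ (cases x p)
    ; μ∈Y = in' ; μ-edge = edge' ; μ-inj = inj' }
    where
    cases : ∀ x → x ∈ P ∪ only z → x ∈ P ⊎ x ≡ z
    cases x p with ∨⁻ {P x} p
    ... | inj₁ q = inj₁ q
    ... | inj₂ q = inj₂ (sym (≐⁻ q))
    old : ∀ x → x ∈ P ∪ only z → ¬ (x ≡ z) → x ∈ P
    old x p ne = [ id , (λ e → ⊥-elim (ne e)) ]′ (cases x p)
    in' : ∀ x → x ∈ P ∪ only z → (μ [ z ↦ u ]) x ∈ Y
    in' x p with x Fin.≟ z
    ... | yes refl rewrite update-same μ x u = uY
    ... | no ne rewrite update-other μ z u x ne = μ∈Y M x (old x p ne)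
    edge' : ∀ x → x ∈ P ∪ only z → B x ((μ [ z ↦ u ]) x) ≡ true
    edge' x p with x Fin.≟ z
    ... | yes refl rewrite update-same μ x u = e
    ... | no ne rewrite update-other μ z u x ne = μ-edge M x (old x p ne)
    inj' : ∀ x y → x ∈ P ∪ only z → y ∈ P ∪ only z → (μ [ z ↦ u ]) x ≡ (μ [ z ↦ u ]) y → x ≡ y
    inj' x y p q eq with x Fin.≟ z | y Fin.≟ z
    ... | yes refl | yes refl = refl
    ... | yes refl | no ne = ⊥-elim (free y (old y q ne) ne (trans (sym (update-other μ z u y ne)) (trans (sym eq) (update-same μ x u))))
    ... | no ne | yes refl = ⊥-elim (free x (old x p ne) ne (trans (sym (update-other μ z u x ne)) (trans eq (update-same μ y u))))
    ... | no ne | no ne' = μ-inj M x y (old x p ne) (old y q ne')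
                             (trans (sym (update-other μ z u x ne)) (trans eq (update-other μ z u y ne')))

  Larger : Sub m → Set
  Larger P = ∃ λ P' → ∃ λ μ' → Match P' μ' × # P < # P'

  grown : ∀ {P P' : Sub m} → P ⊆ P' → ∀ x → x ∈ P' → x ∉ P → # P < # P'
  grown {P} {P'} s x p np = <-≤-trans (m<n+m (# P) (∈⇒0<# (P' ∖ P) (∖⁺ P' P p np))) (≤-reflexive (#-∖-⊆ P' P s))

  -- An unmatched x takes the partner of s, s takes the partner of s', and s' takes the unmatched y.
  shift : ∀ {P μ} → Match P μ → ∀ x y s s' → x ∈ I → x ∉ P → y ∈ Y → y ∉ image μ P → s ∈ P → s' ∈ P →
          B x (μ s) ≡ true → B s (μ s') ≡ true → B s' y ≡ true → Larger P
  shift {P} {μ} M x y s s' xI xP yY yP sP s'P b₁ b₂ b₃ with s Fin.≟ s'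
  ... | yes refl = _ , _ , M₂ , grown {P} {P ∪ only s ∪ only x} (λ z q → ∨⁺ˡ (∨⁺ˡ {P z} q)) x (∨⁺ʳ {(P ∪ only s) x} (≐-refl x)) xP
    where
    y≢ : ∀ z → z ∈ P → ¬ (μ z ≡ y)
    y≢ z q e = true≢false (subst (_∈ image μ P) e (image⁺ μ P q)) yP
    M₁ : Match (P ∪ only s) (μ [ s ↦ y ])
    M₁ = reassign M s y (P⊆I M s sP) yY b₃ (λ z q _ → y≢ z q)
    free : ∀ z → z ∈ P ∪ only s → ¬ (z ≡ x) → ¬ ((μ [ s ↦ y ]) z ≡ μ s)
    free z q _ e with z Fin.≟ s
    ... | yes refl = y≢ s sP (trans (sym e) (update-same μ s y))
    ... | no ne with ∨⁻ {P z} q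
    ... | inj₁ q' = ne (μ-inj M z s q' sP (trans (sym (update-other μ s y z ne)) e))
    ... | inj₂ q' = ne (sym (≐⁻ q'))
    M₂ : Match (P ∪ only s ∪ only x) (μ [ s ↦ y ] [ x ↦ μ s ])
    M₂ = reassign M₁ x (μ s) xI (μ∈Y M s sP) b₁ free
  ... | no s≢s' = _ , _ , M₃ , grown {P} {P ∪ only s' ∪ only s ∪ only x} (λ z q → ∨⁺ˡ (∨⁺ˡ (∨⁺ˡ {P z} q))) x (∨⁺ʳ {(P ∪ only s' ∪ only s) x} (≐-refl x)) xP
    where
    y≢ : ∀ z → z ∈ P → ¬ (μ z ≡ y)
    y≢ z q e = true≢false (subst (_∈ image μ P) e (image⁺ μ P q)) yP
    μ₁ μ₂ : Fin m → Fin n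
    μ₁ = μ [ s' ↦ y ]
    μ₂ = μ₁ [ s ↦ μ s' ]
    M₁ : Match (P ∪ only s') μ₁
    M₁ = reassign M s' y (P⊆I M s' s'P) yY b₃ (λ z q _ → y≢ z q)
    back : ∀ z → z ∈ P ∪ only s' → z ∈ P
    back z q with ∨⁻ {P z} q
    ... | inj₁ q' = q'
    ... | inj₂ q' = subst (_∈ P) (≐⁻ q') s'P
    free₁ : ∀ z → z ∈ P ∪ only s' → ¬ (z ≡ s) → ¬ (μ₁ z ≡ μ s')
    free₁ z q _ e with z Fin.≟ s'
    ... | yes refl = y≢ z s'P (trans (sym e) (update-same μ z y))
    ... | no ne = ne (μ-inj M z s' (back z q) s'P (trans (sym (update-other μ s' y z ne)) e))
    M₂ : Match (P ∪ only s' ∪ only s) μ₂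
    M₂ = reassign M₁ s (μ s') (P⊆I M s sP) (μ∈Y M s' s'P) b₂ free₁
    free₂ : ∀ z → z ∈ P ∪ only s' ∪ only s → ¬ (z ≡ x) → ¬ (μ₂ z ≡ μ s)
    free₂ z q _ e with z Fin.≟ s
    ... | yes refl = s≢s' (sym (μ-inj M s' z s'P sP (trans (sym (update-same μ₁ z (μ s'))) e)))
    ... | no ne with ∨⁻ {(P ∪ only s') z} q
    ... | inj₂ q' = ne (sym (≐⁻ q'))
    ... | inj₁ q' with z Fin.≟ s'
    ... | yes refl = y≢ s sP (trans (sym e) (trans (update-other μ₁ s (μ z) z ne) (update-same μ z y)))
    ... | no ne' = ne (μ-inj M z s (back z q') sP (trans (sym (trans (update-other μ₁ s (μ s') z ne) (update-other μ s' y z ne'))) e))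
    M₃ : Match (P ∪ only s' ∪ only s ∪ only x) (μ₂ [ x ↦ μ s ])
    M₃ = reassign M₂ x (μ s) xI (μ∈Y M s sP) b₁ free₂

  -- If neither `x` nor the unmatched `y` has an unmatched neighbour, then `p` matched vertices have
  -- partners adjacent to `x`, and `p` partners belong to neighbours of `y`. An edge of the
  -- rectangle between these two sets is the middle of an augmenting path.
  augment : ∀ {P μ} → Match P μ → ∀ x → x ∈ I → x ∉ P → Larger P
  augment {P} {μ} M x xI xP
    with pick Y (image μ P) (<-≤-trans (≤-<-trans (#-image-≤ μ P) (grown {P} {I} (P⊆I M) x xI xP)) (≤-reflexive size))
  ... | y , yY , yP with find (λ v → (B x ∩ Y) v ∧ not (image μ P v)) | find (λ z → (I z ∧ B z y) ∧ not (P z))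
  ... | inj₁ (v , q) | _ = _ , _ , reassign M x v xI (∧ʳ {B x v} (∧ˡ q)) (∧ˡ {B x v} (∧ˡ q))
          (λ z zP _ e → true≢false (subst (_∈ image μ P) e (image⁺ μ P zP)) (not⁻ (∧ʳ {(B x ∩ Y) v} q))) ,
          grown {P} {P ∪ only x} (λ z → ∨⁺ˡ) x (∨⁺ʳ {P x} (≐-refl x)) xP
  ... | inj₂ _ | inj₁ (z , q) = _ , _ , reassign M z y (∧ˡ (∧ˡ {I z ∧ B z y} q)) yY (∧ʳ {I z} (∧ˡ q))
          (λ w wP _ e → true≢false (subst (_∈ image μ P) e (image⁺ μ P wP)) yP) ,
          grown {P} {P ∪ only z} (λ w → ∨⁺ˡ) z (∨⁺ʳ {P z} (≐-refl z)) (not⁻ (∧ʳ {I z ∧ B z y} q))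
  ... | inj₂ noˡ | inj₂ noʳ = conclude (rect X₁ (image μ S₁) X₁⊆I V₁⊆Y big₁ big₂)
    where
    X₁ S₁ : Sub m
    X₁ s = P s ∧ B x (μ s)
    S₁ s = P s ∧ B s y
    X₁⊆I : X₁ ⊆ I
    X₁⊆I s q = P⊆I M s (∧ˡ q)
    V₁⊆Y : image μ S₁ ⊆ Y
    V₁⊆Y v q with image⁻ μ S₁ q
    ... | s , s∈ , refl = μ∈Y M s (∧ˡ s∈)
    big₁ : p ≤ # X₁
    big₁ = ≤-trans (degˡ x xI) (≤-trans (#-mono incl) (#-image-≤ μ X₁))
      where
      incl : B x ∩ Y ⊆ image μ X₁
      incl v q with bool (image μ P v)
      ... | inj₂ out = ⊥-elim (true≢false (∧⁺ q (not⁺ out)) (noˡ v))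
      ... | inj₁ q' with image⁻ μ P q'
      ... | s , sP , refl = image⁺ μ X₁ (∧⁺ sP (∧ˡ q))
    big₂ : p ≤ # (image μ S₁)
    big₂ = ≤-trans (degʳ y yY) (≤-trans (#-mono incl)
             (≤-reflexive (sym (#-image μ S₁ (λ s s' q q' → μ-inj M s s' (∧ˡ q) (∧ˡ q'))))))
      where
      incl : (λ z → I z ∧ B z y) ⊆ S₁
      incl z q with bool (P z)
      ... | inj₁ zP = ∧⁺ zP (∧ʳ {I z} q)
      ... | inj₂ out = ⊥-elim (true≢false (∧⁺ q (not⁺ out)) (noʳ z))
    conclude : (∃ λ s → ∃ λ v → s ∈ X₁ × v ∈ image μ S₁ × B s v ≡ true) → Larger P
    conclude (s , v , sX , vV , b) with image⁻ μ S₁ vV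
    ... | s' , s'S , refl = shift M x y s s' xI xP yY yP (∧ˡ sX) (∧ˡ s'S) (∧ʳ {P s} sX) b (∧ʳ {P s'} s'S)

  record Perfect : Set where
    field
      μ : Fin m → Fin n
      μ∈Y : ∀ x → x ∈ I → μ x ∈ Y
      μ-edge : ∀ x → x ∈ I → B x (μ x) ≡ true
      μ-inj : ∀ x y → x ∈ I → y ∈ I → μ x ≡ μ y → x ≡ y
      μ-onto : ∀ y → y ∈ Y → ∃ λ x → x ∈ I × μ x ≡ y

  complete : ∀ t {P μ} → Match P μ → # I ≤ t + # P → Perfect
  complete t {P} {μ} M le with find (I ∖ P)
  ... | inj₂ none = record { μ = μ ; μ∈Y = λ x q → μ∈Y M x (all x q) ; μ-edge = λ x q → μ-edge M x (all x q)
      ; μ-inj = inj ; μ-onto = λ y q → image⁻ μ I (⊆-of-equal-size (image μ I) Y into (≤-reflexive (trans (sym size) (sym (#-image μ I inj)))) y q) }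
    where
    all : I ⊆ P
    all x q with bool (P x)
    ... | inj₁ q' = q'
    ... | inj₂ out = ⊥-elim (true≢false (∖⁺ I P q out) (none x))
    inj : ∀ x y → x ∈ I → y ∈ I → μ x ≡ μ y → x ≡ y
    inj x y q q' = μ-inj M x y (all x q) (all y q')
    into : image μ I ⊆ Y
    into v q with image⁻ μ I q
    ... | x , xI , refl = μ∈Y M x (all x xI)
  complete zero {P} M le | inj₁ (x , q) = ⊥-elim (<⇒≱ (grown {P} {I} (P⊆I M) x (∖ˡ I P q) (∖ʳ I P q)) le)
  complete (suc t) {P} M le | inj₁ (x , q) with augment M x (∖ˡ I P q) (∖ʳ I P q)
  ... | P' , μ' , M' , lt = complete t M' (≤-trans le (≤-trans (≤-reflexive (sym (+-suc t (# P)))) (+-monoʳ-≤ t lt)))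

  perfect : (Fin m → Fin n) → Perfect
  perfect μ₀ = complete (# I) {∅} {μ₀} (record { P⊆I = λ _ () ; μ∈Y = λ _ () ; μ-edge = λ _ () ; μ-inj = λ _ _ () }) (m≤m+n _ _)

-- Averaging and edge counts

weight : ∀ {n} → (Fin n → ℕ) → Sub n → ℕ
weight w P = ∑ (λ v → ⟦ P v ⟧ * w v)

weight-split : ∀ {n} (w : Fin n → ℕ) (P Q : Sub n) → Q ⊆ P → weight w P ≡ weight w Q + weight w (P ∖ Q)
weight-split w P Q s = trans (∑-cong (λ v → lem (P v) (Q v) (w v) (s v))) (∑-+ _ _)
  where
  lem : ∀ a b k → (b ≡ true → a ≡ true) → ⟦ a ⟧ * k ≡ ⟦ b ⟧ * k + ⟦ a ∧ not b ⟧ * k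
  lem a true k h rewrite h refl = sym (+-identityʳ _)
  lem true false k h = refl
  lem false false k h = refl

weight-mono : ∀ {n} (w w' : Fin n → ℕ) (P : Sub n) → (∀ v → v ∈ P → w v ≤ w' v) → weight w P ≤ weight w' P
weight-mono w w' P h = ∑-mono (λ v → lem (P v) (h v))
  where
  lem : ∀ {x y} b → (b ≡ true → x ≤ y) → ⟦ b ⟧ * x ≤ ⟦ b ⟧ * y
  lem true h = +-monoˡ-≤ 0 (h refl)
  lem false h = z≤n

opaque
  unfolding #

  weight-const : ∀ {n} k (P : Sub n) → weight (λ _ → k) P ≡ k * # P
  weight-const k P = trans (∑-cong (λ v → *-comm ⟦ P v ⟧ k)) (∑-* k (λ v → ⟦ P v ⟧))

weight-* : ∀ {n} k (w : Fin n → ℕ) P → weight (λ v → k * w v) P ≡ k * weight w P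
weight-* k w P = trans (∑-cong (λ v → lem ⟦ P v ⟧ k (w v))) (∑-* k (λ v → ⟦ P v ⟧ * w v))
  where
  lem : ∀ a b c → a * (b * c) ≡ b * (a * c)
  lem = solve-∀

weight-cong : ∀ {n} {w w' : Fin n → ℕ} {P Q : Sub n} → (∀ v → w v ≡ w' v) → (∀ v → P v ≡ Q v) → weight w P ≡ weight w' Q
weight-cong h g = ∑-cong (λ v → cong₂ (λ a b → ⟦ a ⟧ * b) (g v) (h v))

-- Deleting an element of least weight never lowers the average; `d` counts the deletions.
heavy-subset : ∀ {n} (w : Fin n → ℕ) d (P : Sub n) p → # P ≡ p + d →
               ∃ λ X → X ⊆ P × # X ≡ p × p * weight w P ≤ # P * weight w X
heavy-subset w zero P p e = P , (λ _ q → q) , trans e (+-identityʳ p) , *-monoˡ-≤ (weight w P) (≤-reflexive (sym (trans e (+-identityʳ p))))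
heavy-subset {n} w (suc d) P p e with argmin P w
... | inj₁ none = ⊥-elim (<⇒≱ (subst (0 <_) (sym (trans e (+-suc p d))) (s≤s z≤n)) (≤-reflexive (#-empty P none)))
... | inj₂ (v , vP , least) = X , (λ z q → ∖ˡ P (only v) (X⊆ z q)) , #X , bound
  where
  open ≤-Reasoning
  P' = P ∖ only v
  k = # P'
  one⊆ : only v ⊆ P
  one⊆ z q = subst (_∈ P) (≐⁻ q) vP
  #P : # P ≡ suc k
  #P = begin-equality
    # P               ≡⟨ sym (#-∖-⊆ P (only v) one⊆) ⟩
    k + # (only v)    ≡⟨ cong (k +_) (#-only v) ⟩
    k + 1             ≡⟨ +-comm k 1 ⟩
    suc k             ∎
  k≡ : k ≡ p + d
  k≡ = suc-injective (trans (sym #P) (trans e (+-suc p d)))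
  rec = heavy-subset w d P' p k≡
  X = proj₁ rec
  X⊆ = proj₁ (proj₂ rec)
  #X = proj₁ (proj₂ (proj₂ rec))
  drop : k * weight w P ≤ suc k * weight w P'
  drop = begin
    k * weight w P                                   ≡⟨ cong (k *_) (weight-split w P (only v) one⊆) ⟩
    k * (weight w (only v) + weight w P')            ≤⟨ *-monoʳ-≤ k (+-monoˡ-≤ (weight w P') wv) ⟩
    k * (w v + weight w P')                          ≡⟨ *-distribˡ-+ k (w v) _ ⟩
    k * w v + k * weight w P'                        ≤⟨ +-monoˡ-≤ (k * weight w P') kw ⟩
    weight w P' + k * weight w P'                    ∎
    where
    wv : weight w (only v) ≤ w v
    wv = begin
      weight w (only v)                ≤⟨ weight-mono w (λ _ → w v) (only v) (λ z q → ≤-reflexive (cong w (sym (≐⁻ q)))) ⟩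
      weight (λ _ → w v) (only v)      ≡⟨ weight-const (w v) (only v) ⟩
      w v * # (only v)                 ≡⟨ cong (w v *_) (#-only v) ⟩
      w v * 1                          ≡⟨ *-identityʳ (w v) ⟩
      w v                              ∎
    kw : k * w v ≤ weight w P'
    kw = begin
      k * w v                      ≡⟨ *-comm k (w v) ⟩
      w v * k                      ≡⟨ sym (weight-const (w v) P') ⟩
      weight (λ _ → w v) P'        ≤⟨ weight-mono (λ _ → w v) w P' (λ z q → least z (∖ˡ P (only v) q)) ⟩
      weight w P'                  ∎
  bound : p * weight w P ≤ # P * weight w X
  bound with 0 <? k
  ... | no k≯0 = subst (λ z → z * weight w P ≤ # P * weight w X)
          (sym (n≤0⇒n≡0 (≤-trans (m≤m+n p d) (≤-trans (≤-reflexive (sym k≡)) (≮⇒≥ k≯0))))) z≤n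
  ... | yes 0<k = *-cancelˡ-≤ k ⦃ >-nonZero 0<k ⦄ (begin
    k * (p * weight w P)                 ≡⟨ swap k p _ ⟩
    p * (k * weight w P)                 ≤⟨ *-monoʳ-≤ p drop ⟩
    p * (suc k * weight w P')            ≡⟨ swap p (suc k) _ ⟩
    suc k * (p * weight w P')            ≤⟨ *-monoʳ-≤ (suc k) (proj₂ (proj₂ (proj₂ rec))) ⟩
    suc k * (k * weight w X)             ≡⟨ swap (suc k) k _ ⟩
    k * (suc k * weight w X)             ≡⟨ cong (λ z → k * (z * weight w X)) (sym #P) ⟩
    k * (# P * weight w X)               ∎)
    where
    swap : ∀ a b c → a * (b * c) ≡ b * (a * c)
    swap = solve-∀

-- The complement of a heavy subset has at most average weight.
light-subset : ∀ {n} (w : Fin n → ℕ) (P : Sub n) p → p ≤ # P →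
               ∃ λ X → X ⊆ P × # X ≡ p × # P * weight w X ≤ p * weight w P
light-subset w P p le with heavy-subset w p P (# P ∸ p) (sym (m∸n+n≡m le))
... | X , s , c , h = P ∖ X , (λ v → ∖ˡ P X) , size , +-cancelʳ-≤ (# P * weight w X) _ _ (begin
    # P * weight w (P ∖ X) + # P * weight w X        ≡⟨ trans (+-comm (# P * weight w (P ∖ X)) _) (sym (*-distribˡ-+ (# P) (weight w X) _)) ⟩
    # P * (weight w X + weight w (P ∖ X))            ≡⟨ cong (# P *_) (sym (weight-split w P X s)) ⟩
    # P * weight w P                                 ≡⟨ cong (_* weight w P) (sym (m+[n∸m]≡n le)) ⟩
    (p + (# P ∸ p)) * weight w P                     ≡⟨ *-distribʳ-+ (weight w P) p (# P ∸ p) ⟩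
    p * weight w P + (# P ∸ p) * weight w P          ≤⟨ +-monoʳ-≤ (p * weight w P) h ⟩
    p * weight w P + # P * weight w X                ∎)
  where
  open ≤-Reasoning
  size : # (P ∖ X) ≡ p
  size = +-cancelʳ-≡ (# X) _ _ (begin-equality
    # (P ∖ X) + # X   ≡⟨ #-∖-⊆ P X s ⟩
    # P               ≡⟨ sym (m+[n∸m]≡n le) ⟩
    p + (# P ∸ p)     ≡⟨ cong (p +_) (sym c) ⟩
    p + # X           ∎)

module Edges {m n : ℕ} (B : Fin m → Fin n → Bool) where

  degˡ : Sub n → Fin m → ℕ
  degˡ X a = # (B a ∩ X)

  degʳ : Sub m → Fin n → ℕ
  degʳ A v = # (λ a → A a ∧ B a v)

  e : Sub m → Sub n → ℕ
  e A X = weight (degˡ X) A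

  opaque
    unfolding #

    e-flip : ∀ A X → e A X ≡ weight (degʳ A) X
    e-flip A X = begin
      ∑ (λ a → ⟦ A a ⟧ * ∑ (λ v → ⟦ B a v ∧ X v ⟧))        ≡⟨ ∑-cong (λ a → sym (∑-* ⟦ A a ⟧ (λ v → ⟦ B a v ∧ X v ⟧))) ⟩
      ∑ (λ a → ∑ (λ v → ⟦ A a ⟧ * ⟦ B a v ∧ X v ⟧))        ≡⟨ ∑-swap (λ a v → ⟦ A a ⟧ * ⟦ B a v ∧ X v ⟧) ⟩
      ∑ (λ v → ∑ (λ a → ⟦ A a ⟧ * ⟦ B a v ∧ X v ⟧))        ≡⟨ ∑-cong (λ v → ∑-cong (λ a → lem (A a) (B a v) (X v))) ⟩
      ∑ (λ v → ∑ (λ a → ⟦ X v ⟧ * ⟦ A a ∧ B a v ⟧))        ≡⟨ ∑-cong (λ v → ∑-* ⟦ X v ⟧ (λ a → ⟦ A a ∧ B a v ⟧)) ⟩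
      ∑ (λ v → ⟦ X v ⟧ * ∑ (λ a → ⟦ A a ∧ B a v ⟧))        ∎
      where
      open ≡-Reasoning
      lem : ∀ a b x → ⟦ a ⟧ * ⟦ b ∧ x ⟧ ≡ ⟦ x ⟧ * ⟦ a ∧ b ⟧
      lem true true true = refl
      lem true true false = refl
      lem true false true = refl
      lem true false false = refl
      lem false b true = refl
      lem false b false = refl

  e-splitˡ : ∀ A A' X → A' ⊆ A → e A X ≡ e A' X + e (A ∖ A') X
  e-splitˡ A A' X = weight-split (degˡ X) A A'

  e-splitʳ : ∀ A X X' → X' ⊆ X → e A X ≡ e A X' + e A (X ∖ X')
  e-splitʳ A X X' s = trans (e-flip A X) (trans (weight-split (degʳ A) X X' s) (sym (cong₂ _+_ (e-flip A X') (e-flip A (X ∖ X')))))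

  e-cong : ∀ {A A' X X'} → (∀ v → A v ≡ A' v) → (∀ v → X v ≡ X' v) → e A X ≡ e A' X'
  e-cong h g = weight-cong (λ a → #-cong (λ v → cong (B a v ∧_) (g v))) h

  e≤ : ∀ A X → e A X ≤ # X * # A
  e≤ A X = ≤-trans (weight-mono (degˡ X) (λ _ → # X) A (λ a _ → #-mono {P = B a ∩ X} (λ v → ∧ʳ {B a v}))) (≤-reflexive (weight-const (# X) A))

  e>0⇒edge : ∀ A X → 0 < e A X → ∃ λ a → ∃ λ v → a ∈ A × v ∈ X × B a v ≡ true
  e>0⇒edge A X pos with find (λ a → A a ∧ some (B a ∩ X))
  ... | inj₁ (a , q) with some⁻ (B a ∩ X) (∧ʳ {A a} q)
  ... | v , q' = a , v , ∧ˡ q , ∧ʳ {B a v} q' , ∧ˡ q'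
  e>0⇒edge A X pos | inj₂ none = ⊥-elim (<⇒≱ pos (≤-trans
      (weight-mono (degˡ X) (λ _ → 0) A (λ a q → ≤-reflexive (#-empty (B a ∩ X) (λ v → ¬true⇒false λ z → true≢false (∧⁺ q (some⁺ (B a ∩ X) v z)) (none a)))))
      (≤-reflexive (weight-const 0 A))))

  -- Keep the rows of largest degree, then the columns of largest degree into these rows.
  shrink : ∀ τ V A X p → 0 < # A → 0 < # X → p ≤ # A → p ≤ # X → τ * (# A * # X) ≤ V * e A X →
           ∃ λ A' → ∃ λ X' → A' ⊆ A × X' ⊆ X × # A' ≡ p × # X' ≡ p × τ * (p * p) ≤ V * e A' X'
  shrink τ V A X p 0<A 0<X pA pX den
    with heavy-subset (degˡ X) (# A ∸ p) A p (sym (m+[n∸m]≡n pA))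
  ... | A' , sA , cA , hA with heavy-subset (degʳ A') (# X ∸ p) X p (sym (m+[n∸m]≡n pX))
  ... | X' , sX , cX , hX = A' , X' , sA , sX , cA , cX , *-cancelˡ-≤ (# A * # X) ⦃ >-nonZero (*-mono-≤ 0<A 0<X) ⦄ (begin
    # A * # X * (τ * (p * p))                ≡⟨ ar₁ (# A * # X) τ p ⟩
    p * p * (τ * (# A * # X))                ≤⟨ *-monoʳ-≤ (p * p) den ⟩
    p * p * (V * e A X)                      ≡⟨ ar₂ p p V (e A X) ⟩
    V * (p * (p * e A X))                    ≤⟨ *-monoʳ-≤ V (*-monoʳ-≤ p hA) ⟩
    V * (p * (# A * e A' X))                 ≡⟨ ar₃ V p (# A) (e A' X) ⟩
    V * (# A * (p * e A' X))                 ≡⟨ cong (λ z → V * (# A * (p * z))) (e-flip A' X) ⟩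
    V * (# A * (p * weight (degʳ A') X))     ≤⟨ *-monoʳ-≤ V (*-monoʳ-≤ (# A) hX) ⟩
    V * (# A * (# X * weight (degʳ A') X'))  ≡⟨ cong (λ z → V * (# A * (# X * z))) (sym (e-flip A' X')) ⟩
    V * (# A * (# X * e A' X'))              ≡⟨ ar₄ V (# A) (# X) (e A' X') ⟩
    # A * # X * (V * e A' X')                ∎)
    where
    open ≤-Reasoning
    ar₁ : ∀ a t p → a * (t * (p * p)) ≡ p * p * (t * a)
    ar₁ = solve-∀
    ar₂ : ∀ p q V x → p * q * (V * x) ≡ V * (p * (q * x))
    ar₂ = solve-∀
    ar₃ : ∀ V p a x → V * (p * (a * x)) ≡ V * (a * (p * x))
    ar₃ = solve-∀
    ar₄ : ∀ V a b x → V * (a * (b * x)) ≡ a * b * (V * x)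
    ar₄ = solve-∀

  NoSparseSquare : ℕ → ℕ → Sub m → Sub n → Set
  NoSparseSquare q p A X = ∀ A' X' → A' ⊆ A → X' ⊆ X → # A' ≡ p → # X' ≡ p → p * p ≤ q * e A' X'

  -- A pair of subsets is coded as one subset of `Fin (m + n)`, to which `search` applies.
  find-sparse-square : ∀ q p A X → NoSparseSquare q p A X ⊎
    (∃ λ A' → ∃ λ X' → A' ⊆ A × X' ⊆ X × # A' ≡ p × # X' ≡ p × q * e A' X' < p * p)
  find-sparse-square q p A X with search (λ S → test (λ a → S (a ↑ˡ n)) (λ v → S (m ↑ʳ v)))
      (λ S S' h → ext (λ a → h (a ↑ˡ n)) (λ v → h (m ↑ʳ v)))
    where
    test : Sub m → Sub n → Bool
    test A' X' = ⊆? A' A ∧ (⊆? X' X ∧ (⌊ # A' ≟ p ⌋ ∧ (⌊ # X' ≟ p ⌋ ∧ ⌊ q * e A' X' <? p * p ⌋)))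
    ext : ∀ {A' A'' X' X''} → (∀ v → A' v ≡ A'' v) → (∀ v → X' v ≡ X'' v) → test A' X' ≡ test A'' X''
    ext {A'} {A''} {X'} {X''} h g = cong₂ _∧_ (cong not (some-cong (λ v → cong (_∧ not (A v)) (h v))))
      (cong₂ _∧_ (cong not (some-cong (λ v → cong (_∧ not (X v)) (g v))))
      (cong₂ _∧_ (cong (λ z → ⌊ z ≟ p ⌋) (#-cong h)) (cong₂ _∧_ (cong (λ z → ⌊ z ≟ p ⌋) (#-cong g))
        (cong (λ z → ⌊ q * z <? p * p ⌋) (e-cong h g)))))
  ... | inj₁ (S , t) = inj₂ (A' , X' , ⊆?⁻ A' A (∧ˡ t) , ⊆?⁻ X' X (∧ˡ t₁) , dec⁻ (# A' ≟ p) (∧ˡ t₂) , dec⁻ (# X' ≟ p) (∧ˡ t₃) , dec⁻ (_ <? _) t₄)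
    where
    A' : Sub m
    A' a = S (a ↑ˡ n)
    X' : Sub n
    X' v = S (m ↑ʳ v)
    t₁ = ∧ʳ {⊆? A' A} t
    t₂ = ∧ʳ {⊆? X' X} t₁
    t₃ = ∧ʳ {⌊ # A' ≟ p ⌋} t₂
    t₄ = ∧ʳ {⌊ # X' ≟ p ⌋} t₃
  ... | inj₂ none = inj₁ λ A' X' sA sX cA cX → ≮⇒≥ λ lt →
    let S : Sub (m + n)
        S i = [ A' , X' ]′ (splitAt m i)
        A″ : Sub m
        A″ a = S (a ↑ˡ n)
        X″ : Sub n
        X″ v = S (m ↑ʳ v)
        h : ∀ a → A″ a ≡ A' a
        h a = cong [ A' , X' ]′ (Fin.splitAt-↑ˡ m a n)
        g : ∀ v → X″ v ≡ X' v
        g v = cong [ A' , X' ]′ (Fin.splitAt-↑ʳ m n v)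
    in true≢false (∧⁺ (⊆?⁺ A″ A (λ a z → sA a (trans (sym (h a)) z)))
      (∧⁺ (⊆?⁺ X″ X (λ a z → sX a (trans (sym (g a)) z))) (∧⁺ (dec⁺ (# A″ ≟ p) (trans (#-cong h) cA))
      (∧⁺ (dec⁺ (# X″ ≟ p) (trans (#-cong g) cX)) (dec⁺ (q * e A″ X″ <? p * p) (subst (λ z → q * z < p * p) (sym (e-cong h g)) lt)))))) (none S)

  low-degree : ℕ → ℕ → Sub m → Sub n → Sub m
  low-degree q s A X a = A a ∧ ⌊ q * degˡ X a <? s ⌋

  -- Among the edges leaving `p` rows of low degree, the `p` lightest columns receive at most their
  -- share, and these rows and columns would form a sparse square.
  few-low-degree : ∀ q p A X → 0 < p → p ≤ # X → NoSparseSquare q p A X → # (low-degree q (# X) A X) < p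
  few-low-degree q p A X 0<p pX ns = ≰⇒> λ ge → contra (subset-of-size (low-degree q s A X) p ge)
    where
    open ≤-Reasoning
    s = # X
    contra : (∃ λ A' → A' ⊆ low-degree q s A X × # A' ≡ p) → ⊥
    contra (A' , sub , cA) with light-subset (degʳ A') X p pX
    ... | X' , sX , cX , light = <⇒≱ {s * (p * p)} {s * (p * p) + p * p} (m<m+n _ (*-mono-≤ 0<p 0<p)) (begin
      s * (p * p) + p * p               ≤⟨ +-monoˡ-≤ (p * p) (*-monoʳ-≤ s (ns A' X' (λ a z → ∧ˡ (sub a z)) sX cA cX)) ⟩
      s * (q * e A' X') + p * p         ≡⟨ cong (λ z → s * (q * z) + p * p) (e-flip A' X') ⟩
      s * (q * weight (degʳ A') X') + p * p  ≡⟨ cong (_+ p * p) (swap s q _) ⟩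
      q * (s * weight (degʳ A') X') + p * p  ≤⟨ +-monoˡ-≤ (p * p) (*-monoʳ-≤ q light) ⟩
      q * (p * weight (degʳ A') X) + p * p   ≡⟨ cong (λ z → q * (p * z) + p * p) (sym (e-flip A' X)) ⟩
      q * (p * e A' X) + p * p          ≡⟨ trans (cong (_+ p * p) (swap q p _)) (sym (*-distribˡ-+ p (q * e A' X) p)) ⟩
      p * (q * e A' X + p)              ≤⟨ *-monoʳ-≤ p total ⟩
      p * (s * p)                       ≡⟨ swap p s p ⟩
      s * (p * p)                       ∎)
      where
      swap : ∀ a b c → a * (b * c) ≡ b * (a * c)
      swap = solve-∀
      -- Low degree is a strict inequality; the unit gained in each of the `p` rows makes the
      -- contradiction strict.
      total : q * e A' X + p ≤ s * p
      total = begin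
        q * e A' X + p                                                      ≡⟨ cong₂ _+_ (sym (weight-* q (degˡ X) A')) (trans (sym cA) (trans (sym (*-identityˡ _)) (sym (weight-const 1 A')))) ⟩
        weight (λ a → q * degˡ X a) A' + weight (λ _ → 1) A'                ≡⟨ sym (trans (∑-cong (λ a → *-distribˡ-+ ⟦ A' a ⟧ (q * degˡ X a) 1)) (∑-+ _ _)) ⟩
        weight (λ a → q * degˡ X a + 1) A'                                  ≤⟨ weight-mono _ (λ _ → s) A' (λ a z → ≤-trans (≤-reflexive (+-comm _ 1)) (dec⁻ (_ <? _) (∧ʳ {A a} (sub a z)))) ⟩
        weight (λ _ → s) A'                                                 ≡⟨ weight-const s A' ⟩
        s * # A'                                                            ≡⟨ cong (s *_) cA ⟩
        s * p                                                               ∎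

-- Density increment

-- Densities are written `τ / V`. The start is `H / V`, that is 1/`ℓ`; each increment raises `τ` by
-- one and divides the side by `h`, and as no density exceeds one there are fewer than `f₀`
-- increments. Compared with density `τ / V`, a `p` by `p` square of density below 1/`q`, half of
-- 1/`ℓ`, lacks more than `H * p * p / 2` edges in units of 1/`V`. With `H = 2 * (h * h)` this is
-- one unit for each pair of the surrounding square of side `h * p`, so the rest gains a full unit.
-- The choice `h = 4 * q` turns degrees of a 1/`q` share into at least `4 * p`.
module Robust {m n : ℕ} (B : Fin m → Fin n → Bool) (ℓ q h H V f₀ : ℕ) (0<ℓ : 0 < ℓ)
  (q≡ : q ≡ 2 * ℓ) (h≡ : h ≡ 4 * q) (H≡ : H ≡ 2 * (h * h)) (V≡ : V ≡ ℓ * H) (f₀≡ : H + f₀ ≡ suc V) where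
  open Edges B

  0<q : 0 < q
  0<q = subst (0 <_) (sym q≡) (*-mono-≤ {1} {2} (s≤s z≤n) 0<ℓ)

  4≤h : 4 ≤ h
  4≤h = subst (4 ≤_) (sym h≡) (≤-trans (≤-reflexive (sym (*-identityʳ 4))) (*-monoʳ-≤ 4 0<q))

  0<h : 0 < h
  0<h = ≤-trans (s≤s z≤n) 4≤h

  Result : ℕ → Sub m → Sub n → Set
  Result p₀ A X = ∃ λ p → ∃ λ A' → ∃ λ X' → p₀ ≤ p × A' ⊆ A × X' ⊆ X × # A' ≡ h * p × # X' ≡ h * p × NoSparseSquare q p A' X'

  -- Outside a sparse square lie the p × u and u × s rectangles (s = h p = p + u); one of them beats the density τ / V of the whole.
  denser : ∀ τ p u e₀ e₁ e₂ → H ≤ τ → p + u ≡ h * p → 0 < p → q * e₀ < p * p → τ * (h * p * (h * p)) ≤ V * (e₀ + (e₁ + e₂)) →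
           V * e₁ < suc τ * (p * u) → V * e₂ < suc τ * (u * (h * p)) → ⊥
  denser τ p u e₀ e₁ e₂ Hτ su 0<p sparse den lt₁ lt₂ = <⇒≱ strictly (begin
    H * (p * p) + H * (p * p)       ≡⟨ sym (*-distribʳ-+ (p * p) H H) ⟩
    (H + H) * (p * p)               ≤⟨ *-monoˡ-≤ (p * p) (+-mono-≤ Hτ Hτ) ⟩
    (τ + τ) * (p * p)               ≤⟨ *-monoˡ-≤ (p * p) (+-mono-≤ (n≤1+n τ) (n≤1+n τ)) ⟩
    (suc τ + suc τ) * (p * p)       ≡⟨ a₀ (suc τ) (p * p) ⟩
    2 * (suc τ * (p * p))           ∎)
    where
    open ≤-Reasoning
    s = h * p
    a₀ : ∀ t x → (t + t) * x ≡ 2 * (t * x)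
    a₀ = solve-∀
    a₁ : ∀ t V a b c → 2 * (V * (a + (b + c))) + t ≡ 2 * (V * a) + 2 * (V * b + V * c) + t
    a₁ = solve-∀
    a₂ : ∀ ℓ H x → 2 * (ℓ * H * x) ≡ H * (2 * ℓ * x)
    a₂ = solve-∀
    a₃ : ∀ x T p u w → x + 2 * (T * (p * u) + T * (u * w)) + 2 * (T * (p * p)) ≡ x + 2 * (T * (p * (p + u) + u * w))
    a₃ = solve-∀
    a₄ : ∀ p u w → p * w + u * w ≡ (p + u) * w
    a₄ = solve-∀
    a₅ : ∀ x t w → x + 2 * (suc t * w) ≡ 2 * (t * w) + (x + 2 * w)
    a₅ = solve-∀
    a₆ : ∀ h p → 2 * (h * p * (h * p)) ≡ 2 * (h * h) * (p * p)
    a₆ = solve-∀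
    strictly : 2 * (suc τ * (p * p)) < H * (p * p) + H * (p * p)
    strictly = +-cancelˡ-< (2 * (τ * (s * s))) _ _ (begin-strict
      2 * (τ * (s * s)) + 2 * (suc τ * (p * p))
        ≤⟨ +-monoˡ-≤ (2 * (suc τ * (p * p))) (*-monoʳ-≤ 2 den) ⟩
      2 * (V * (e₀ + (e₁ + e₂))) + 2 * (suc τ * (p * p))
        ≡⟨ a₁ (2 * (suc τ * (p * p))) V e₀ e₁ e₂ ⟩
      2 * (V * e₀) + 2 * (V * e₁ + V * e₂) + 2 * (suc τ * (p * p))
        ≡⟨ cong (λ z → z + 2 * (V * e₁ + V * e₂) + 2 * (suc τ * (p * p))) (trans (cong (λ z → 2 * (z * e₀)) V≡) (trans (a₂ ℓ H e₀) (cong (λ z → H * (z * e₀)) (sym q≡)))) ⟩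
      H * (q * e₀) + 2 * (V * e₁ + V * e₂) + 2 * (suc τ * (p * p))
        ≤⟨ +-monoˡ-≤ (2 * (suc τ * (p * p))) (+-monoˡ-≤ (2 * (V * e₁ + V * e₂)) (*-monoʳ-≤ H (<⇒≤ sparse))) ⟩
      H * (p * p) + 2 * (V * e₁ + V * e₂) + 2 * (suc τ * (p * p))
        <⟨ +-monoˡ-< (2 * (suc τ * (p * p))) (+-monoʳ-< (H * (p * p)) (*-monoʳ-< 2 (+-mono-< lt₁ lt₂))) ⟩
      H * (p * p) + 2 * (suc τ * (p * u) + suc τ * (u * s)) + 2 * (suc τ * (p * p))
        ≡⟨ a₃ (H * (p * p)) (suc τ) p u s ⟩
      H * (p * p) + 2 * (suc τ * (p * (p + u) + u * s))
        ≡⟨ cong (λ z → H * (p * p) + 2 * (suc τ * z)) (trans (cong (λ z → p * z + u * s) su) (trans (a₄ p u s) (cong (_* s) su))) ⟩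
      H * (p * p) + 2 * (suc τ * (s * s))
        ≡⟨ a₅ (H * (p * p)) τ (s * s) ⟩
      2 * (τ * (s * s)) + (H * (p * p) + 2 * (s * s))
        ≡⟨ cong (λ z → 2 * (τ * (s * s)) + (H * (p * p) + z)) (trans (a₆ h p) (cong (_* (p * p)) (sym H≡))) ⟩
      2 * (τ * (s * s)) + (H * (p * p) + H * (p * p)) ∎)

  increment : ∀ f τ p₀ A X → 0 < p₀ → H ≤ τ → τ + f ≡ suc V → # A ≡ p₀ * h ^ f → # X ≡ p₀ * h ^ f →
              τ * (# A * # X) ≤ V * e A X → Result p₀ A X
  -- Here `τ` has reached `V + 1`, a density above one.
  increment zero τ p₀ A X 0<p₀ Hτ tf cA cX den = ⊥-elim (<⇒≱ {V * (# A * # X)} {suc V * (# A * # X)}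
      (m<n+m (V * (# A * # X)) (*-mono-≤ pos-A pos-X))
      (begin
        suc V * (# A * # X)     ≡⟨ cong (_* (# A * # X)) (trans (sym tf) (+-identityʳ τ)) ⟩
        τ * (# A * # X)         ≤⟨ den ⟩
        V * e A X               ≤⟨ *-monoʳ-≤ V (≤-trans (e≤ A X) (≤-reflexive (*-comm (# X) (# A)))) ⟩
        V * (# A * # X)         ∎))
    where
    open ≤-Reasoning
    pos-A : 0 < # A
    pos-A = subst (0 <_) (sym (trans cA (*-identityʳ p₀))) 0<p₀
    pos-X : 0 < # X
    pos-X = subst (0 <_) (sym (trans cX (*-identityʳ p₀))) 0<p₀
  increment (suc f) τ p₀ A X 0<p₀ Hτ tf cA cX den = go (find-sparse-square q p A X)
    where
    open ≤-Reasoning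
    p = p₀ * h ^ f
    s≡ : p₀ * (h * h ^ f) ≡ h * p
    s≡ = ar p₀ h (h ^ f)
      where
      ar : ∀ a b c → a * (b * c) ≡ b * (a * c)
      ar = solve-∀
    cA' : # A ≡ h * p
    cA' = trans cA s≡
    cX' : # X ≡ h * p
    cX' = trans cX s≡
    p₀≤p : p₀ ≤ p
    p₀≤p = m≤m*n p₀ (h ^ f) ⦃ m^n≢0 h f ⦃ >-nonZero 0<h ⦄ ⦄
    0<p : 0 < p
    0<p = ≤-trans 0<p₀ p₀≤p
    2p≤s : p + p ≤ h * p
    2p≤s = ≤-trans (≤-reflexive (cong (p +_) (sym (+-identityʳ p)))) (*-monoˡ-≤ p (≤-trans (s≤s (s≤s z≤n)) 4≤h))
    recurse : ∀ A' X' → A' ⊆ A → X' ⊆ X → 0 < # A' → 0 < # X' → p ≤ # A' → p ≤ # X' →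
              suc τ * (# A' * # X') ≤ V * e A' X' → Result p₀ A X
    recurse A' X' sA sX 0<A' 0<X' pA pX den' = outer (shrink (suc τ) V A' X' p 0<A' 0<X' pA pX den')
      where
      inner : ∀ A″ X″ → A″ ⊆ A' → X″ ⊆ X' → Result p₀ A″ X″ → Result p₀ A X
      inner A″ X″ sA' sX' (p' , A₁ , X₁ , le , s₁ , s₂ , z₁ , z₂ , ns) =
        p' , A₁ , X₁ , le , (λ v w → sA v (sA' v (s₁ v w))) , (λ v w → sX v (sX' v (s₂ v w))) , z₁ , z₂ , ns
      outer : (∃ λ A″ → ∃ λ X″ → A″ ⊆ A' × X″ ⊆ X' × # A″ ≡ p × # X″ ≡ p × suc τ * (p * p) ≤ V * e A″ X″) → Result p₀ A X
      outer (A″ , X″ , sA' , sX' , c₁ , c₂ , den″) = inner A″ X″ sA' sX'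
        (increment f (suc τ) p₀ A″ X″ 0<p₀ (≤-trans Hτ (n≤1+n τ)) (trans (sym (+-suc τ f)) tf) c₁ c₂
             (subst₂ (λ a b → suc τ * (a * b) ≤ V * e A″ X″) (sym c₁) (sym c₂) den″))
    go : NoSparseSquare q p A X ⊎ (∃ λ A' → ∃ λ X' → A' ⊆ A × X' ⊆ X × # A' ≡ p × # X' ≡ p × q * e A' X' < p * p) → Result p₀ A X
    go (inj₁ ns) = p , A , X , p₀≤p , (λ _ z → z) , (λ _ z → z) , cA' , cX' , ns
    go (inj₂ (A' , X' , sA , sX , c₁ , c₂ , sparse))
      with suc τ * (p * # (X ∖ X')) ≤? V * e A' (X ∖ X') | suc τ * (# (A ∖ A') * (h * p)) ≤? V * e (A ∖ A') X
    ... | yes d | _ = recurse A' (X ∖ X') sA (λ v → ∖ˡ X X') (subst (0 <_) (sym c₁) 0<p) (≤-trans 0<p pu) (≤-reflexive (sym c₁)) pu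
                        (subst (λ z → suc τ * (z * # (X ∖ X')) ≤ V * e A' (X ∖ X')) (sym c₁) d)
      where
      pu : p ≤ # (X ∖ X')
      pu = +-cancelʳ-≤ p _ _ (≤-trans 2p≤s (≤-reflexive (trans (sym cX') (trans (sym (#-∖-⊆ X X' sX)) (cong (# (X ∖ X') +_) c₂)))))
    ... | no _ | yes d = recurse (A ∖ A') X (λ v → ∖ˡ A A') (λ _ z → z) (≤-trans 0<p pu) (subst (0 <_) (sym cX') (≤-trans 0<p p≤s)) pu
                           (≤-trans p≤s (≤-reflexive (sym cX')))
                           (subst (λ z → suc τ * (# (A ∖ A') * z) ≤ V * e (A ∖ A') X) (sym cX') d)
      where
      p≤s : p ≤ h * p
      p≤s = ≤-trans (m≤m+n p p) 2p≤s
      pu : p ≤ # (A ∖ A')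
      pu = +-cancelʳ-≤ p _ _ (≤-trans 2p≤s (≤-reflexive (trans (sym cA') (trans (sym (#-∖-⊆ A A' sA)) (cong (# (A ∖ A') +_) c₁)))))
    ... | no d₁ | no d₂ = ⊥-elim (denser τ p u (e A' X') (e A' (X ∖ X')) (e (A ∖ A') X) Hτ su 0<p sparse
            (≤-trans (≤-reflexive (cong₂ (λ a b → τ * (a * b)) (sym cA') (sym cX'))) (≤-trans den (≤-reflexive (cong (V *_) total))))
            (≰⇒> d₁) (subst (λ z → V * e (A ∖ A') X < suc τ * (z * (h * p))) uA (≰⇒> d₂)))
      where
      u = # (X ∖ X')
      su : p + u ≡ h * p
      su = trans (+-comm p u) (trans (cong (u +_) (sym c₂)) (trans (#-∖-⊆ X X' sX) cX'))
      uA : # (A ∖ A') ≡ u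
      uA = +-cancelʳ-≡ p _ _ (trans (cong (# (A ∖ A') +_) (sym c₁)) (trans (#-∖-⊆ A A' sA) (trans cA' (trans (sym su) (+-comm p u)))))
      total : e A X ≡ e A' X' + (e A' (X ∖ X') + e (A ∖ A') X)
      total = trans (e-splitˡ A A' X sA) (trans (cong (_+ e (A ∖ A') X) (e-splitʳ A' X X' sX)) (+-assoc (e A' X') _ _))

  -- Matchings that tolerate the removal of any set of fixed size

  MatchOnto : Sub m → Sub n → Set
  MatchOnto I' Y = ∃ λ (μ : Fin m → Fin n) → (∀ x → x ∈ I' → μ x ∈ Y) × (∀ x → x ∈ I' → B x (μ x) ≡ true) ×
    (∀ x y → x ∈ I' → y ∈ I' → μ x ≡ μ y → x ≡ y) × (∀ y → y ∈ Y → ∃ λ x → x ∈ I' × μ x ≡ y)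

  -- The same slots `I'` serve every `T` of size `t`. This uniformity lets an absorber be built
  -- before it is known which vertices of `Y` will be used elsewhere.
  Slots : Sub m → Sub n → ℕ → Set
  Slots I Y t = ∃ λ I' → I' ⊆ I × # I' + t ≡ # Y × (∀ T → T ⊆ Y → # T ≡ t → MatchOnto I' (Y ∖ T))

  record Flexible (I : Sub m) (U : Sub n) (p₀ : ℕ) : Set where
    field
      p    : ℕ
      p₀≤p : p₀ ≤ p
      Y    : Sub n
      Y⊆U  : Y ⊆ U
      #Y   : # Y + p ≡ h * p
      slots : ∀ t → t ≤ p → Slots I Y t

  -- h = 4q, so a vertex that is not of low degree has degree at least 4p.
  high : ∀ p d → ¬ (q * d < h * p) → 4 * p ≤ d
  high p d nlt = *-cancelˡ-≤ q ⦃ >-nonZero 0<q ⦄ (≤-trans (≤-reflexive (trans (ar q p) (cong (_* p) (sym h≡)))) (≮⇒≥ nlt))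
    where
    ar : ∀ q p → q * (4 * p) ≡ 4 * q * p
    ar = solve-∀

  -- Passing from `Q` to `Z` deletes `t + p` elements, at most `2 * p`, so a degree of `4 * p` into
  -- `Q` survives as at least `p`.
  shave : ∀ {k} (P Q Z : Sub k) p t → t ≤ p → Z ⊆ Q → # Q ≡ # Z + t + p → 4 * p ≤ # (P ∩ Q) → p ≤ # (P ∩ Z)
  shave P Q Z p t t≤p ZQ cQ big = +-cancelʳ-≤ (3 * p) _ _ (begin
    p + 3 * p                      ≡⟨⟩
    4 * p                          ≤⟨ big ⟩
    # (P ∩ Q)                      ≤⟨ #-mono incl ⟩
    # ((P ∩ Z) ∪ (Q ∖ Z))          ≤⟨ #-∪ (P ∩ Z) (Q ∖ Z) ⟩
    # (P ∩ Z) + # (Q ∖ Z)          ≤⟨ +-monoʳ-≤ (# (P ∩ Z)) small ⟩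
    # (P ∩ Z) + 3 * p              ∎)
    where
    open ≤-Reasoning
    incl : P ∩ Q ⊆ (P ∩ Z) ∪ (Q ∖ Z)
    incl v z with bool (Z v)
    ... | inj₁ y = ∨⁺ˡ (∧⁺ {P v} (∧ˡ z) y)
    ... | inj₂ y = ∨⁺ʳ {(P ∩ Z) v} (∖⁺ Q Z (∧ʳ {P v} z) y)
    ar : ∀ a b c → a + b + c ≡ b + c + a
    ar = solve-∀
    small : # (Q ∖ Z) ≤ 3 * p
    small = ≤-trans (≤-reflexive (+-cancelʳ-≡ (# Z) (# (Q ∖ Z)) (t + p) (trans (#-∖-⊆ Q Z ZQ) (trans cQ (ar (# Z) t p)))))
                    (≤-trans (+-monoˡ-≤ p t≤p) (+-monoʳ-≤ p (m≤m+n p _)))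

  match : ∀ p A X I' Y' t → 0 < p → t ≤ p → NoSparseSquare q p A X → I' ⊆ A → Y' ⊆ X → # A ≡ # I' + t + p → # X ≡ # Y' + t + p →
          (∀ x → x ∈ I' → 4 * p ≤ # (B x ∩ X)) → (∀ y → y ∈ Y' → 4 * p ≤ # ((λ x → B x y) ∩ A)) →
          # I' ≡ # Y' → (Fin m → Fin n) → MatchOnto I' Y'
  match p A X I' Y' t 0<p t≤p ns sI sY cA cX hiA hiX eq μ₀ = unpack (perfect μ₀)
    where
    dl : ∀ x → x ∈ I' → p ≤ # (B x ∩ Y')
    dl x z = shave (B x) X Y' p t t≤p sY cX (hiA x z)
    dr : ∀ y → y ∈ Y' → p ≤ # (λ x → I' x ∧ B x y)
    dr y z = ≤-trans (shave (λ x → B x y) A I' p t t≤p sI cA (hiX y z)) (≤-reflexive (#-cong (λ x → ∧-comm (B x y) (I' x))))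
    rect : ∀ A' X' → A' ⊆ I' → X' ⊆ Y' → p ≤ # A' → p ≤ # X' → ∃ λ x → ∃ λ v → x ∈ A' × v ∈ X' × B x v ≡ true
    rect A' X' s₁ s₂ l₁ l₂ = go (subset-of-size A' p l₁) (subset-of-size X' p l₂)
      where
      go : (∃ λ A″ → A″ ⊆ A' × # A″ ≡ p) → (∃ λ X″ → X″ ⊆ X' × # X″ ≡ p) → ∃ λ x → ∃ λ v → x ∈ A' × v ∈ X' × B x v ≡ true
      go (A″ , t₁ , c₁) (X″ , t₂ , c₂) = conv (e>0⇒edge A″ X″ (n≢0⇒n>0 λ z → <⇒≱ (*-mono-≤ 0<p 0<p)
            (≤-trans (ns A″ X″ (λ v w → sI v (s₁ v (t₁ v w))) (λ v w → sY v (s₂ v (t₂ v w))) c₁ c₂)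
                     (≤-reflexive (trans (cong (q *_) z) (*-zeroʳ q))))))
        where
        conv : (∃ λ x → ∃ λ v → x ∈ A″ × v ∈ X″ × B x v ≡ true) → ∃ λ x → ∃ λ v → x ∈ A' × v ∈ X' × B x v ≡ true
        conv (x , v , xA , vX , b) = x , v , t₁ x xA , t₂ v vX , b
    open Matching B I' Y' p eq dl dr rect using (Perfect; perfect)
    unpack : Perfect → MatchOnto I' Y'
    unpack M = Perfect.μ M , Perfect.μ∈Y M , Perfect.μ-edge M , Perfect.μ-inj M , Perfect.μ-onto M

  slots-in : ∀ p g A X A₁ Y → 0 < p → p ≤ g → NoSparseSquare q p A X → A₁ ⊆ A → Y ⊆ X → # A ≡ g + p → # X ≡ g + p → g ≤ # A₁ → # Y ≡ g →
          (∀ x → x ∈ A₁ → 4 * p ≤ # (B x ∩ X)) → (∀ y → y ∈ Y → 4 * p ≤ # ((λ x → B x y) ∩ A)) → (Fin m → Fin n) →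
          ∀ t → t ≤ p → Slots A Y t
  slots-in p g A X A₁ Y 0<p p≤g ns sA sY cA cX room cY hiA hiX μ₀ t t≤p = go (subset-of-size A₁ (g ∸ t) (≤-trans (m∸n≤m g t) room))
    where
    go : (∃ λ I' → I' ⊆ A₁ × # I' ≡ g ∸ t) → Slots A Y t
    go (I' , I'⊆ , cI') = I' , (λ v z → sA v (I'⊆ v z)) , trans cI (sym cY) , λ T TY cT →
      match p A X I' (Y ∖ T) t 0<p t≤p ns (λ v z → sA v (I'⊆ v z)) (λ v z → sY v (∖ˡ Y T z))
        (trans cA (cong (_+ p) (sym cI))) (trans cX (cong (_+ p) (sym (YT T TY cT))))
        (λ x z → hiA x (I'⊆ x z)) (λ y z → hiX y (∖ˡ Y T z)) (+-cancelʳ-≡ t _ _ (trans cI (sym (YT T TY cT)))) μ₀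
      where
      cI : # I' + t ≡ g
      cI = trans (cong (_+ t) cI') (m∸n+n≡m (≤-trans t≤p p≤g))
      YT : ∀ T → T ⊆ Y → # T ≡ t → # (Y ∖ T) + t ≡ g
      YT T TY cT = trans (cong (# (Y ∖ T) +_) (sym cT)) (trans (#-∖-⊆ Y T TY) cY)

  -- Fewer than `p` vertices on each side have low degree; without them at least `h * p - p` remain,
  -- all of large degree into the other side.
  trim : ∀ p A X → 0 < p → # A ≡ h * p → # X ≡ h * p → NoSparseSquare q p A X → (Fin m → Fin n) →
         ∃ λ Y → Y ⊆ X × # Y + p ≡ h * p × (∀ t → t ≤ p → Slots A Y t)
  trim p A X 0<p cA cX ns μ₀ = go (subset-of-size (X ∖ LX) g roomX)
    where
    g = h * p ∸ p
    p≤s : p ≤ h * p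
    p≤s = m≤n*m p h ⦃ >-nonZero 0<h ⦄
    gp : g + p ≡ h * p
    gp = m∸n+n≡m p≤s
    p≤g : p ≤ g
    p≤g = +-cancelʳ-≤ p _ _ (≤-trans (≤-trans (≤-reflexive (cong (p +_) (sym (+-identityʳ p)))) (*-monoˡ-≤ p (≤-trans (s≤s (s≤s z≤n)) 4≤h))) (≤-reflexive (sym gp)))
    LA : Sub m
    LA = low-degree q (# X) A X
    LX : Sub n
    LX = Edges.low-degree (λ v a → B a v) q (# A) X A
    fewA : # LA < p
    fewA = few-low-degree q p A X 0<p (≤-trans p≤s (≤-reflexive (sym cX))) ns
    flip-e : ∀ A' X' → e A' X' ≡ Edges.e (λ v a → B a v) X' A'
    flip-e A' X' = trans (e-flip A' X') (weight-cong {P = X'} {Q = X'} (λ v → #-cong (λ a → ∧-comm (A' a) (B a v))) (λ _ → refl))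
    fewX : # LX < p
    fewX = Edges.few-low-degree (λ v a → B a v) q p X A 0<p (≤-trans p≤s (≤-reflexive (sym cA)))
             (λ X' A' s₁ s₂ c₁ c₂ → ≤-trans (ns A' X' s₂ s₁ c₂ c₁) (≤-reflexive (cong (q *_) (flip-e A' X'))))
    roomX : g ≤ # (X ∖ LX)
    roomX = +-cancelʳ-≤ p _ _ (≤-trans (≤-reflexive (trans gp (sym cX))) (≤-trans (#-∖ X LX) (+-monoʳ-≤ (# (X ∖ LX)) (<⇒≤ fewX))))
    roomA : g ≤ # (A ∖ LA)
    roomA = +-cancelʳ-≤ p _ _ (≤-trans (≤-reflexive (trans gp (sym cA))) (≤-trans (#-∖ A LA) (+-monoʳ-≤ (# (A ∖ LA)) (<⇒≤ fewA))))
    hiA : ∀ x → x ∈ A ∖ LA → 4 * p ≤ # (B x ∩ X)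
    hiA x z = high p _ (λ lt → true≢false (∧⁺ (∖ˡ A LA z) (dec⁺ (q * degˡ X x <? # X) (<-≤-trans lt (≤-reflexive (sym cX))))) (∖ʳ A LA z))
    hiX : ∀ y → y ∈ X ∖ LX → 4 * p ≤ # ((λ x → B x y) ∩ A)
    hiX y z = high p _ (λ lt → true≢false (∧⁺ (∖ˡ X LX z) (dec⁺ (q * Edges.degˡ (λ v a → B a v) A y <? # A) (<-≤-trans lt (≤-reflexive (sym cA))))) (∖ʳ X LX z))
    go : (∃ λ Y → Y ⊆ X ∖ LX × # Y ≡ g) → ∃ λ Y → Y ⊆ X × # Y + p ≡ h * p × (∀ t → t ≤ p → Slots A Y t)
    go (Y , Y⊆ , cY) = Y , (λ v z → ∖ˡ X LX (Y⊆ v z)) , trans (cong (_+ p) cY) gp ,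
      slots-in p g A X (A ∖ LA) Y 0<p p≤g ns (λ v → ∖ˡ A LA) (λ v z → ∖ˡ X LX (Y⊆ v z)) (trans cA (sym gp)) (trans cX (sym gp)) roomA cY
        hiA (λ y z → hiX y (Y⊆ y z)) μ₀

  flexible : ∀ I U p₀ → 0 < p₀ → p₀ * h ^ f₀ ≤ # I → p₀ * h ^ f₀ ≤ # U → (∀ x → x ∈ I → # U ≤ ℓ * degˡ U x) → (Fin m → Fin n) →
             Flexible I U p₀
  flexible I U p₀ 0<p₀ leI leU rich μ₀ = finish (initial (shrink H V I U (p₀ * h ^ f₀) (≤-trans 0<s leI) (≤-trans 0<s leU) leI leU den))
    where
    open ≤-Reasoning
    0<s : 0 < p₀ * h ^ f₀
    0<s = *-mono-≤ 0<p₀ (m^n>0 h ⦃ >-nonZero 0<h ⦄ f₀)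
    den : H * (# I * # U) ≤ V * e I U
    den = begin
      H * (# I * # U)                          ≡⟨ cong (H *_) (*-comm (# I) (# U)) ⟩
      H * (# U * # I)                          ≡⟨ cong (H *_) (sym (weight-const (# U) I)) ⟩
      H * weight (λ _ → # U) I                 ≤⟨ *-monoʳ-≤ H (weight-mono _ (λ x → ℓ * degˡ U x) I rich) ⟩
      H * weight (λ x → ℓ * degˡ U x) I        ≡⟨ cong (H *_) (weight-* ℓ (degˡ U) I) ⟩
      H * (ℓ * e I U)                          ≡⟨ trans (sym (*-assoc H ℓ _)) (cong (_* e I U) (trans (*-comm H ℓ) (sym V≡))) ⟩
      V * e I U                                ∎
    initial : (∃ λ A' → ∃ λ X' → A' ⊆ I × X' ⊆ U × # A' ≡ p₀ * h ^ f₀ × # X' ≡ p₀ * h ^ f₀ × H * (p₀ * h ^ f₀ * (p₀ * h ^ f₀)) ≤ V * e A' X') → Result p₀ I U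
    initial (A' , X' , sA , sX , c₁ , c₂ , d) = widen (increment f₀ H p₀ A' X' 0<p₀ ≤-refl f₀≡ c₁ c₂
             (subst₂ (λ a b → H * (a * b) ≤ V * e A' X') (sym c₁) (sym c₂) d))
      where
      widen : Result p₀ A' X' → Result p₀ I U
      widen (p' , A₁ , X₁ , le , s₁ , s₂ , z₁ , z₂ , ns) =
        p' , A₁ , X₁ , le , (λ v w → sA v (s₁ v w)) , (λ v w → sX v (s₂ v w)) , z₁ , z₂ , ns
    finish : Result p₀ I U → Flexible I U p₀
    finish (p , A , X , le , sA , sX , cA , cX , ns) = build (trim p A X (≤-trans 0<p₀ le) cA cX ns μ₀)
      where
      build : (∃ λ Y → Y ⊆ X × # Y + p ≡ h * p × (∀ t → t ≤ p → Slots A Y t)) → Flexible I U p₀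
      build (Y , sY , cY , sl) = record { p = p ; p₀≤p = le ; Y = Y ; Y⊆U = λ v z → sX v (sY v z) ; #Y = cY ; slots = widen }
        where
        widen : ∀ t → t ≤ p → Slots I Y t
        widen t t≤p = lift (sl t t≤p)
          where
          lift : Slots A Y t → Slots I Y t
          lift (I' , s , c , m) = I' , (λ v z → sA v (s v z)) , c , m

-- Monochromatic copies of linear size

-- A majority colour reaches a 1/`r` share of a layer and deleting used vertices may halve it, hence
-- `2 * r ≤ D₀`. `N-big` is the Ramsey condition for `Δ + 2` layers, and `E-big` is the demand of
-- the greedy embedding with initial loss `2 * r` and degree loss `2 * D₀`.
record Setting (r n : ℕ) : Set where
  field
    F     : GraphSeq
    c     : Colouring r n
    c₀    : Fin r
    Δ     : ℕ
    0<Δ   : 0 < Δ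
    F-deg : ∀ i x → # (adj (F i) x) ≤ Δ
    D₀    : ℕ
    2r≤D₀ : 2 * r ≤ D₀
    N E   : ℕ
    N-big : suc r ^ (r * suc (suc Δ)) ≤ N
    E-big : 2 * (2 * r * (2 * D₀) ^ Δ) * Δ ≤ E

module Tiles {r n : ℕ} (P : Setting r n) where
  open Setting P public
  open Tilings F c public
  open Chains c c₀ D₀ (≤-trans (m≤n*m r 2) 2r≤D₀) public

  L : ℕ
  L = 2 * r * (2 * D₀) ^ Δ

  0<2r : 0 < 2 * r
  0<2r = *-mono-≤ {1} {2} (s≤s z≤n) 0<r

  0<2D₀ : 0 < 2 * D₀
  0<2D₀ = *-mono-≤ {1} {2} (s≤s z≤n) 0<D₀

  0<L : 0 < L
  0<L = *-mono-≤ 0<2r (m^n>0 (2 * D₀) ⦃ >-nonZero 0<2D₀ ⦄ Δ)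

  0<E : 0 < E
  0<E = ≤-trans (*-mono-≤ (*-mono-≤ {1} {2} (s≤s z≤n) 0<L) 0<Δ) E-big

  open Hosts N E 0<E public

  0<Γ : 0 < Γ
  0<Γ = *-mono-≤ (m^n>0 κ ⦃ >-nonZero 0<κ ⦄ N) (*-mono-≤ (m^n>0 r ⦃ >-nonZero 0<r ⦄ N) (0<loss N))

  N-sym : ∀ γ u v → N[ γ ] u v ≡ N[ γ ] v u
  N-sym γ u v = cong (λ z → [ z ≐ γ ]) (col-sym c u v)

  C₁ : ℕ
  C₁ = 2 * L * Γ

  0<C₁ : 0 < C₁
  0<C₁ = *-mono-≤ (*-mono-≤ {1} {2} (s≤s z≤n) 0<L) 0<Γ

  colouring : ∀ i → ∃ λ (g : Fin (suc i) → Fin (suc Δ)) → ∀ x y → adj (F i) x y ≡ true → ¬ (g x ≡ g y)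
  colouring i = greedy-colouring Δ (adj (F i)) (adj-sym (F i)) (irrefl (F i)) (F-deg i)

  host-room : ∀ a b m {h w} → w ≤ Γ * h → a * b * Γ * m < w → a * b * m < h
  host-room a b m {h} {w} big lt = *-cancelˡ-< Γ _ _ (<-≤-trans (≤-<-trans (≤-reflexive (ar a b Γ m)) lt) big)
    where
    ar : ∀ a b c m → c * (a * b * m) ≡ a * b * c * m
    ar = solve-∀

  copy : ∀ W m → 0 < # W → C₁ * suc m < # W → ∃ λ S → S ⊆ W × # S ≡ suc m × Cover≤ S 1
  copy W m 0<W lt = finish (hosts (suc (suc Δ)) W N-big 0<W) (colouring m)
    where
    finish : HostSystem (suc (suc Δ)) W → (∃ λ (g : Fin (suc m) → Fin (suc Δ)) → ∀ x y → adj (F m) x y ≡ true → ¬ (g x ≡ g y)) →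
             ∃ λ S → S ⊆ W × # S ≡ suc m × Cover≤ S 1
    finish HS (g , proper) = conclude (embedding full full (λ _ p → p) (λ x y _ _ a e → proper x y a (Fin.inject₁-injective e))
        (λ x y _ _ ()) (λ x → H (κ' x)) (λ _ _ p → p) (λ y _ → m≤n*m (# (H (κ' y))) (2 * r) ⦃ >-nonZero 0<2r ⦄))
      where
      open HostSystem HS
      -- The `Δ + 1` colour classes go to the newer hosts; the oldest host is reserved for the
      -- flexible part in `frame`.
      κ' : Fin (suc m) → Fin (suc (suc Δ))
      κ' x = inject₁ (g x)
      open Embedding (adj (F m)) (adj-sym (F m)) Δ 0<Δ (F-deg m) N[ hue ] (N-sym hue) κ' H (2 * r) (2 * D₀) E 0<2D₀
        H-dense E-big (λ i → host-room 2 L (suc m) (H-big i) lt) using (Embedded; embedding)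
      conclude : Embedded full full (λ x → H (κ' x)) → ∃ λ S → S ⊆ W × # S ≡ suc m × Cover≤ S 1
      conclude Em = image φ full , sub , trans (#-image φ full φ-inj) (#-full (suc m)) ,
          cover-copy m φ hue (λ u v → φ-inj u v refl refl) (λ u v a → ≐⁻ (edge u v refl refl a)) (λ u → image⁺ φ full refl) onto
        where
        open Embedded Em
        sub : image φ full ⊆ W
        sub v p with image⁻ φ full p
        ... | x , _ , refl = H⊆ (κ' x) (φ x) (φ∈C₀ x refl)
        onto : ∀ w → w ∈ image φ full → ∃ λ u → φ u ≡ w
        onto w p with image⁻ φ full p
        ... | x , _ , e = x , e

  copy≥1 : ∀ W m → 0 < m → C₁ * m < # W → ∃ λ S → S ⊆ W × # S ≡ m × Cover≤ S 1
  copy≥1 W (suc m) _ lt = copy W m (≤-<-trans z≤n lt) lt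

  copy-of-size : ∀ W m → C₁ * m < # W → ∃ λ S → S ⊆ W × # S ≡ m × Cover≤ S 1
  copy-of-size W zero lt = ∅ , (λ _ ()) , #-empty ∅ (λ _ → refl) , 0 , z≤n , cover-∅ (λ _ → refl)
  copy-of-size W (suc m) lt = copy≥1 W (suc m) (s≤s z≤n) lt

  rate : ℕ
  rate = suc (2 * C₁)

  -- As long as more than a 1/Θ fraction is uncovered, each further copy takes a 1/(rate * Θ) fraction of the whole.
  greedy-loop : ∀ Θ w f W → rate * Θ * # W ≤ f * w → ∃ λ S → S ⊆ W × Cover≤ S (f + C₁) × Θ * # (W ∖ S) ≤ w
  greedy-loop Θ w f W fuel with Θ * # W ≤? w
  ... | yes small = ∅ , (λ _ ()) , (0 , z≤n , cover-∅ (λ _ → refl)) , ≤-trans (*-monoʳ-≤ Θ (#-mono {P = W ∖ ∅} (λ v → ∖ˡ W ∅))) small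
  ... | no large with # W ≤? C₁
  ... | yes few = W , (λ _ p → p) , weaken (≤-trans few (m≤n+m C₁ f)) (cover-singletons c₀ W) ,
      ≤-trans (≤-reflexive (trans (cong (Θ *_) (#-empty (W ∖ W) (λ v → ¬true⇒false λ p → true≢false (∖ˡ W W p) (∖ʳ W W p)))) (*-zeroʳ Θ))) z≤n
  greedy-loop Θ w zero W fuel | no large | no many = ⊥-elim (large (≤-trans (≤-trans (m≤n*m (Θ * # W) rate) (≤-trans (≤-reflexive (sym (*-assoc rate Θ _))) fuel)) z≤n))
  greedy-loop Θ w (suc f) W fuel | no large | no many = step (chunk C₁ (pred (# W)) 0<C₁ (<⇒≤pred (≰⇒> many)))
    where
    open ≤-Reasoning
    sucpred : suc (pred (# W)) ≡ # W
    sucpred = suc-pred (# W) ⦃ >-nonZero (≤-<-trans z≤n (≰⇒> many)) ⦄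
    step : (∃ λ m → 0 < m × C₁ * m ≤ pred (# W) × pred (# W) ≤ 2 * C₁ * m) → ∃ λ S → S ⊆ W × Cover≤ S (suc f + C₁) × Θ * # (W ∖ S) ≤ w
    step (m , 0<m , lo , hi) = next-copy (copy≥1 W m 0<m (≤-trans (s≤s lo) (≤-reflexive sucpred)))
      where
      big : # W ≤ rate * m
      big = begin
        # W               ≡⟨ sym sucpred ⟩
        suc (pred (# W))  ≤⟨ +-mono-≤ 0<m hi ⟩
        m + 2 * C₁ * m    ∎
      next-copy : (∃ λ S → S ⊆ W × # S ≡ m × Cover≤ S 1) → ∃ λ S → S ⊆ W × Cover≤ S (suc f + C₁) × Θ * # (W ∖ S) ≤ w
      next-copy (S , sS , cS , CS) = join (greedy-loop Θ w f (W ∖ S) fuel')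
        where
        ar : ∀ a t m → a * t * m ≡ t * (a * m)
        ar = solve-∀
        fuel' : rate * Θ * # (W ∖ S) ≤ f * w
        fuel' = +-cancelʳ-≤ w _ _ (begin
          rate * Θ * # (W ∖ S) + w                    ≤⟨ +-monoʳ-≤ (rate * Θ * # (W ∖ S)) (<⇒≤ (≰⇒> large)) ⟩
          rate * Θ * # (W ∖ S) + Θ * # W              ≤⟨ +-monoʳ-≤ (rate * Θ * # (W ∖ S)) (*-monoʳ-≤ Θ big) ⟩
          rate * Θ * # (W ∖ S) + Θ * (rate * m)       ≡⟨ cong (rate * Θ * # (W ∖ S) +_) (sym (ar rate Θ m)) ⟩
          rate * Θ * # (W ∖ S) + rate * Θ * m         ≡⟨ sym (*-distribˡ-+ (rate * Θ) (# (W ∖ S)) m) ⟩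
          rate * Θ * (# (W ∖ S) + m)                  ≡⟨ cong (rate * Θ *_) (trans (cong (# (W ∖ S) +_) (sym cS)) (#-∖-⊆ W S sS)) ⟩
          rate * Θ * # W                              ≤⟨ fuel ⟩
          w + f * w                                   ≡⟨ +-comm w _ ⟩
          f * w + w                                   ∎)
        join : (∃ λ S' → S' ⊆ W ∖ S × Cover≤ S' (f + C₁) × Θ * # (W ∖ S ∖ S') ≤ w) → ∃ λ S → S ⊆ W × Cover≤ S (suc f + C₁) × Θ * # (W ∖ S) ≤ w
        join (S' , sS' , CS' , left) = S ∪ S' , sub , cover≤-∪ (λ v p → ¬true⇒false λ q → true≢false p (∖ʳ W S (sS' v q))) CS CS' ,
            ≤-trans (*-monoʳ-≤ Θ (#-mono {P = W ∖ (S ∪ S')} {W ∖ S ∖ S'} incl)) left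
          where
          sub : S ∪ S' ⊆ W
          sub v p with ∨⁻ {S v} p
          ... | inj₁ q = sS v q
          ... | inj₂ q = ∖ˡ W S (sS' v q)
          incl : W ∖ (S ∪ S') ⊆ W ∖ S ∖ S'
          incl v p = ∖⁺ (W ∖ S) S' (∖⁺ W S (∖ˡ W (S ∪ S') p) (¬true⇒false λ q → true≢false (∨⁺ˡ {S v} {S' v} q) (∖ʳ W (S ∪ S') p)))
                       (¬true⇒false λ q → true≢false (∨⁺ʳ {S v} {S' v} q) (∖ʳ W (S ∪ S') p))

  greedy-cover : ∀ Θ W → ∃ λ S → S ⊆ W × Cover≤ S (rate * Θ + C₁) × Θ * # (W ∖ S) ≤ # W
  greedy-cover Θ W = greedy-loop Θ (# W) (rate * Θ) W ≤-refl

-- Absorbers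

module Absorbers {r n : ℕ} (P : Setting r n) where
  open Tiles P public

  ∁ : ∀ {k} → Sub k → Sub k
  ∁ I x = not (I x)

  -- The tile keeps `φ` outside the independent set `I`, fills the slots `I'` from `Y ∖ T` by the
  -- matching `μ`, and puts the rest of `I` on the fixed vertices `ψ`. Every edge has an end outside
  -- `I`, so its colour comes from `φ-edge` or from the candidate sets.
  assemble : ∀ m γ (I I' : Sub (suc m)) (C : Fin (suc m) → Sub n) (φ ψ μ : Fin (suc m) → Fin n) (Y T : Sub n) →
    (∀ x y → x ∈ I → y ∈ I → adj (F m) x y ≡ false) →
    (∀ x y → x ∈ ∁ I → y ∈ ∁ I → φ x ≡ φ y → x ≡ y) →
    (∀ x y → x ∈ ∁ I → y ∈ ∁ I → adj (F m) x y ≡ true → N[ γ ] (φ x) (φ y) ≡ true) →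
    (∀ x y u → x ∈ ∁ I → adj (F m) x y ≡ true → u ∈ C y → N[ γ ] (φ x) u ≡ true) →
    (∀ x y → x ∈ I ∖ I' → y ∈ I ∖ I' → ψ x ≡ ψ y → x ≡ y) →
    (∀ x → x ∈ I ∖ I' → ψ x ∈ C x × ψ x ∉ image φ (∁ I) × ψ x ∉ Y) →
    (∀ x y → x ∈ I' → y ∈ I' → μ x ≡ μ y → x ≡ y) →
    (∀ x → x ∈ I' → x ∈ I × μ x ∈ C x × μ x ∈ Y ∖ T) →
    (∀ y → y ∈ Y ∖ T → ∃ λ x → x ∈ I' × μ x ≡ y) →
    (∀ y → y ∈ Y → y ∉ image φ (∁ I)) → T ⊆ Y →
    Cover≤ ((image φ (∁ I) ∪ image ψ (I ∖ I') ∪ Y) ∖ T) 1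
  assemble m γ I I' C φ ψ μ Y T indep φ-inj φ-edge C-adj ψ-inj ψ-in μ-inj μ-in μ-onto Y-free T⊆Y =
    cover-copy m ρ γ inj (λ u v a → ≐⁻ (mono' u v a (view u) (view v))) (λ u → inside u (view u)) onto
    where
    Z : Sub n
    Z = image φ (∁ I) ∪ image ψ (I ∖ I') ∪ Y
    ρ : Fin (suc m) → Fin n
    ρ x = if I x then (if I' x then μ x else ψ x) else φ x
    View : Fin (suc m) → Set
    View x = (x ∈ ∁ I × ρ x ≡ φ x) ⊎ ((x ∈ I' × ρ x ≡ μ x) ⊎ (x ∈ I ∖ I' × ρ x ≡ ψ x))
    view : ∀ x → View x
    view x with I x | I' x
    ... | false | _ = inj₁ (refl , refl)
    ... | true | true = inj₂ (inj₁ (refl , refl))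
    ... | true | false = inj₂ (inj₂ (refl , refl))
    apart : ∀ {a b : Fin n} (K : Sub n) → a ∈ K → b ∉ K → ¬ (a ≡ b)
    apart K p q refl = true≢false p q
    inj' : ∀ x y → View x → View y → ρ x ≡ ρ y → x ≡ y
    inj' x y (inj₁ (p , e)) (inj₁ (q , f)) g = φ-inj x y p q (trans (sym e) (trans g f))
    inj' x y (inj₂ (inj₁ (p , e))) (inj₂ (inj₁ (q , f))) g = μ-inj x y p q (trans (sym e) (trans g f))
    inj' x y (inj₂ (inj₂ (p , e))) (inj₂ (inj₂ (q , f))) g = ψ-inj x y p q (trans (sym e) (trans g f))
    inj' x y (inj₁ (p , e)) (inj₂ (inj₁ (q , f))) g =
      ⊥-elim (apart (image φ (∁ I)) (image⁺ φ (∁ I) p) (Y-free _ (∖ˡ Y T (proj₂ (proj₂ (μ-in y q))))) (trans (sym e) (trans g f)))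
    inj' x y (inj₂ (inj₁ (q , f))) (inj₁ (p , e)) g =
      ⊥-elim (apart (image φ (∁ I)) (image⁺ φ (∁ I) p) (Y-free _ (∖ˡ Y T (proj₂ (proj₂ (μ-in x q))))) (trans (sym e) (trans (sym g) f)))
    inj' x y (inj₁ (p , e)) (inj₂ (inj₂ (q , f))) g =
      ⊥-elim (apart (image φ (∁ I)) (image⁺ φ (∁ I) p) (proj₁ (proj₂ (ψ-in y q))) (trans (sym e) (trans g f)))
    inj' x y (inj₂ (inj₂ (q , f))) (inj₁ (p , e)) g =
      ⊥-elim (apart (image φ (∁ I)) (image⁺ φ (∁ I) p) (proj₁ (proj₂ (ψ-in x q))) (trans (sym e) (trans (sym g) f)))
    inj' x y (inj₂ (inj₁ (p , e))) (inj₂ (inj₂ (q , f))) g =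
      ⊥-elim (apart Y (∖ˡ Y T (proj₂ (proj₂ (μ-in x p)))) (proj₂ (proj₂ (ψ-in y q))) (trans (sym e) (trans g f)))
    inj' x y (inj₂ (inj₂ (q , f))) (inj₂ (inj₁ (p , e))) g =
      ⊥-elim (apart Y (∖ˡ Y T (proj₂ (proj₂ (μ-in y p)))) (proj₂ (proj₂ (ψ-in x q))) (trans (sym e) (trans (sym g) f)))
    inj : ∀ x y → ρ x ≡ ρ y → x ≡ y
    inj x y = inj' x y (view x) (view y)
    in-I : ∀ x → (x ∈ I' × ρ x ≡ μ x) ⊎ (x ∈ I ∖ I' × ρ x ≡ ψ x) → x ∈ I × ρ x ∈ C x
    in-I x (inj₁ (p , e)) = proj₁ (μ-in x p) , subst (_∈ C x) (sym e) (proj₁ (proj₂ (μ-in x p)))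
    in-I x (inj₂ (p , e)) = ∖ˡ I I' p , subst (_∈ C x) (sym e) (proj₁ (ψ-in x p))
    mono' : ∀ x y → adj (F m) x y ≡ true → View x → View y → N[ γ ] (ρ x) (ρ y) ≡ true
    mono' x y a (inj₁ (p , e)) (inj₁ (q , f)) = subst₂ (λ u v → N[ γ ] u v ≡ true) (sym e) (sym f) (φ-edge x y p q a)
    mono' x y a (inj₁ (p , e)) (inj₂ q) = subst (λ u → N[ γ ] u (ρ y) ≡ true) (sym e) (C-adj x y (ρ y) p a (proj₂ (in-I y q)))
    mono' x y a (inj₂ p) (inj₁ (q , f)) = trans (N-sym γ (ρ x) (ρ y)) (subst (λ u → N[ γ ] u (ρ x) ≡ true) (sym f)
      (C-adj y x (ρ x) q (trans (adj-sym (F m) y x) a) (proj₂ (in-I x p))))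
    mono' x y a (inj₂ p) (inj₂ q) = ⊥-elim (true≢false a (indep x y (proj₁ (in-I x p)) (proj₁ (in-I y q))))
    put : ∀ {v} x → v ∈ Z → v ∉ T → ρ x ≡ v → ρ x ∈ Z ∖ T
    put x p q refl = ∖⁺ Z T p q
    inside : ∀ x → View x → ρ x ∈ Z ∖ T
    inside x (inj₁ (p , e)) = put x (∨⁺ˡ (∨⁺ˡ (image⁺ φ (∁ I) p)))
      (¬true⇒false λ t → true≢false (image⁺ φ (∁ I) p) (Y-free _ (T⊆Y _ t))) e
    inside x (inj₂ (inj₁ (p , e))) = put x (∨⁺ʳ {(image φ (∁ I) ∪ image ψ (I ∖ I')) (μ x)} (∖ˡ Y T (proj₂ (proj₂ (μ-in x p)))))
      (∖ʳ Y T (proj₂ (proj₂ (μ-in x p)))) e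
    inside x (inj₂ (inj₂ (p , e))) = put x (∨⁺ˡ (∨⁺ʳ {image φ (∁ I) (ψ x)} (image⁺ ψ (I ∖ I') p)))
      (¬true⇒false λ t → true≢false (T⊆Y _ t) (proj₂ (proj₂ (ψ-in x p)))) e
    ρ-∁ : ∀ x → x ∈ ∁ I → ρ x ≡ φ x
    ρ-∁ x p with I x
    ρ-∁ x p | false = refl
    ρ-I' : ∀ x → x ∈ I → x ∈ I' → ρ x ≡ μ x
    ρ-I' x p q rewrite p | q = refl
    ρ-J : ∀ x → x ∈ I → x ∉ I' → ρ x ≡ ψ x
    ρ-J x p q rewrite p | q = refl
    onto : ∀ w → w ∈ Z ∖ T → ∃ λ u → ρ u ≡ w
    onto w p with ∨⁻ {(image φ (∁ I) ∪ image ψ (I ∖ I')) w} (∖ˡ Z T p)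
    ... | inj₂ y with μ-onto w (∖⁺ Y T y (∖ʳ Z T p))
    ... | x , q , e = x , trans (ρ-I' x (proj₁ (μ-in x q)) q) e
    onto w p | inj₁ z with ∨⁻ {image φ (∁ I) w} z
    ... | inj₁ i with image⁻ φ (∁ I) i
    ... | x , q , e = x , trans (ρ-∁ x q) e
    onto w p | inj₁ z | inj₂ i with image⁻ ψ (I ∖ I') i
    ... | x , q , e = x , trans (ρ-J x (∖ˡ I I' q) (∖ʳ I I' q)) e

module AbsorberExistence {r n : ℕ} (P : Setting r n) where
  open Absorbers P public

  opaque
    -- Parameters of the density increment. The initial density is 1/`2L`: candidate sets are a
    -- 1/`L` share of `U`, and at most half of such a set is occupied by `φ`.
    ℓ' q' h' H' V' f' : ℕ
    ℓ' = 2 * L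
    q' = 2 * ℓ'
    h' = 4 * q'
    H' = 2 * (h' * h')
    V' = ℓ' * H'
    f' = suc V' ∸ H'

    ℓ'≡ : ℓ' ≡ 2 * L
    ℓ'≡ = refl

    q'≡ : q' ≡ 2 * ℓ'
    q'≡ = refl

    h'≡ : h' ≡ 4 * q'
    h'≡ = refl

    H'≡ : H' ≡ 2 * (h' * h')
    H'≡ = refl

    V'≡ : V' ≡ ℓ' * H'
    V'≡ = refl

    f'≡ : f' ≡ suc V' ∸ H'
    f'≡ = refl

  0<ℓ' : 0 < ℓ'
  0<ℓ' = subst (0 <_) (sym ℓ'≡) (*-mono-≤ {1} {2} (s≤s z≤n) 0<L)

  H'+f' : H' + f' ≡ suc V'
  H'+f' = trans (cong (H' +_) f'≡) (m+[n∸m]≡n (≤-trans (≤-trans (m≤n*m H' ℓ' ⦃ >-nonZero 0<ℓ' ⦄) (≤-reflexive (sym V'≡))) (n≤1+n V')))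

  0<h' : 0 < h'
  0<h' = subst (0 <_) (sym (trans h'≡ (cong (4 *_) q'≡))) (*-mono-≤ {1} {4} (s≤s z≤n) (*-mono-≤ {1} {2} (s≤s z≤n) 0<ℓ'))

  ∉∁ : ∀ {k} (I : Sub k) {x} → x ∉ ∁ I → x ∈ I
  ∉∁ I {x} q with I x
  ... | true = refl

  -- A copy of `F m` in which `I` is left open. The factor 8 in `U-big` leaves room for two halvings
  -- of the candidate sets, by the image of `φ` and by `Y`, and for the greedy choice of
  -- representatives thereafter.
  record Frame (W : Sub n) (m : ℕ) : Set where
    field
      γ      : Fin r
      I      : Sub (suc m)
      U      : Sub n
      φ      : Fin (suc m) → Fin n
      C      : Fin (suc m) → Sub n
      I-big  : suc m ≤ suc Δ * # I
      indep  : ∀ x y → x ∈ I → y ∈ I → adj (F m) x y ≡ false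
      φ-inj  : ∀ x y → x ∈ ∁ I → y ∈ ∁ I → φ x ≡ φ y → x ≡ y
      φ-edge : ∀ x y → x ∈ ∁ I → y ∈ ∁ I → adj (F m) x y ≡ true → N[ γ ] (φ x) (φ y) ≡ true
      C-adj  : ∀ x y u → x ∈ ∁ I → adj (F m) x y ≡ true → u ∈ C y → N[ γ ] (φ x) u ≡ true
      φ∈W    : ∀ x → x ∈ ∁ I → φ x ∈ W
      U⊆W    : U ⊆ W
      U-big  : 8 * L * suc m < # U
      C⊆U    : ∀ x → x ∈ I → C x ⊆ U
      C-big  : ∀ x → x ∈ I → # U ≤ L * # (C x)

  -- The largest colour class I gets the oldest layer U to itself and is left unembedded.
  frame : ∀ W m → 8 * L * Γ * suc m < # W → Frame W m
  frame W m lt = finish (hosts (suc (suc Δ)) W N-big (≤-<-trans z≤n lt)) (colouring m)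
    where
    finish : HostSystem (suc (suc Δ)) W → (∃ λ (g : Fin (suc m) → Fin (suc Δ)) → ∀ x y → adj (F m) x y ≡ true → ¬ (g x ≡ g y)) → Frame W m
    finish HS (g , proper) = choose-class (large-class Δ g)
      where
      open HostSystem HS
      room : ∀ i → 8 * L * suc m < # (H i)
      room i = host-room 8 L (suc m) (H-big i) lt
      choose-class : (∃ λ g₀ → suc m ≤ suc Δ * # (λ x → [ g x ≐ g₀ ])) → Frame W m
      choose-class (g₀ , big) = conclude (embedding (∁ I) full (λ _ _ → refl) proper' before (λ x → H (κ' x)) (λ _ _ p → p)
                                  (λ y _ → m≤n*m (# (H (κ' y))) (2 * r) ⦃ >-nonZero 0<2r ⦄))
        where
        I : Sub (suc m)
        I x = [ g x ≐ g₀ ]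
        last : Fin (suc (suc Δ))
        last = fromℕ (suc Δ)
        κ' : Fin (suc m) → Fin (suc (suc Δ))
        κ' x = if I x then last else inject₁ (g x)
        κ'-∁ : ∀ x → x ∈ ∁ I → κ' x ≡ inject₁ (g x)
        κ'-∁ x p = cong (λ b → if b then last else inject₁ (g x)) (not⁻ {I x} p)
        κ'-I : ∀ x → x ∈ I → κ' x ≡ last
        κ'-I x p = cong (λ b → if b then last else inject₁ (g x)) p
        proper' : ∀ x y → x ∈ ∁ I → y ∈ ∁ I → adj (F m) x y ≡ true → ¬ (κ' x ≡ κ' y)
        proper' x y p q a e = proper x y a (Fin.inject₁-injective (trans (sym (κ'-∁ x p)) (trans e (κ'-∁ y q))))
        before : ∀ x y → x ∈ ∁ I → y ∈ full → y ∉ ∁ I → adj (F m) x y ≡ true → κ' x Fin.< κ' y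
        before x y p _ q a = subst₂ Fin._<_ (sym (κ'-∁ x p)) (sym (κ'-I y (∉∁ I q)))
          (subst₂ _<_ (sym (Fin.toℕ-inject₁ (g x))) (sym (Fin.toℕ-fromℕ (suc Δ))) (Fin.toℕ<n (g x)))
        open Embedding (adj (F m)) (adj-sym (F m)) Δ 0<Δ (F-deg m) N[ hue ] (N-sym hue) κ' H (2 * r) (2 * D₀) E 0<2D₀
          H-dense E-big (λ i → ≤-<-trans (*-monoˡ-≤ (suc m) (*-monoˡ-≤ L {2} {8} (s≤s (s≤s z≤n)))) (room i)) using (Embedded; embedding)
        conclude : Embedded (∁ I) full (λ x → H (κ' x)) → Frame W m
        conclude Em = record
          { γ = hue ; I = I ; U = H last ; φ = E'.φ ; C = E'.C ; I-big = big
          ; indep = λ x y p q → ¬true⇒false λ a → proper x y a (trans (≐⁻ p) (sym (≐⁻ q)))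
          ; φ-inj = E'.φ-inj ; φ-edge = E'.edge ; C-adj = E'.C-adj
          ; φ∈W = λ x p → H⊆ (κ' x) _ (E'.φ∈C₀ x p) ; U⊆W = H⊆ last ; U-big = room last
          ; C⊆U = λ x p v q → subst (λ z → v ∈ H z) (κ'-I x p) (E'.C⊆C₀ x v q)
          ; C-big = λ x p → subst (λ z → # (H z) ≤ L * # (E'.C x)) (κ'-I x p) (E'.C-big x refl (cong not p)) }
          where
          module E' = Embedded Em

  -- After the loss of at most `t` vertices, `t-room` leaves more than `C₁ * t` in `Y`, enough to
  -- find inside it the copy that fills up `T` to size `t`.
  record Absorber (W : Sub n) : Set where
    field
      Z Y    : Sub n
      t      : ℕ
      Z⊆W    : Z ⊆ W
      Y⊆Z    : Y ⊆ Z
      t-room : C₁ * t + t < # Y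
      absorb : ∀ T → T ⊆ Y → # T ≡ t → Cover≤ (Z ∖ T) 1

  module FromFrame {W : Sub n} {m : ℕ} (K : Frame W m) where
    open Frame K
    open ≤-Reasoning

    B : Fin (suc m) → Fin n → Bool
    B x v = C x v ∧ not (image φ (∁ I) v)

    open Robust B ℓ' q' h' H' V' f' 0<ℓ' q'≡ h'≡ H'≡ V'≡ H'+f' using (Flexible; flexible; Slots; MatchOnto; 4≤h) public

    #I≤ : # I ≤ suc m
    #I≤ = ≤-trans (#-mono {P = I} (λ _ _ → refl)) (≤-reflexive (#-full (suc m)))

    8LM : 8 * L * suc m ≤ # U
    8LM = <⇒≤ U-big

    rich : ∀ x → x ∈ I → # U ≤ ℓ' * # (B x ∩ U)
    rich x p = subst (λ z → # U ≤ z * # (B x ∩ U)) (sym ℓ'≡) (+-cancelʳ-≤ (# U) _ _ (begin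
      # U + # U                                  ≤⟨ +-mono-≤ (C-big x p) (C-big x p) ⟩
      L * # (C x) + L * # (C x)                  ≡⟨ a₁ L (# (C x)) ⟩
      2 * L * # (C x)                            ≤⟨ *-monoʳ-≤ (2 * L) (≤-trans (#-mono incl) (#-∪ (B x ∩ U) (image φ (∁ I)))) ⟩
      2 * L * (# (B x ∩ U) + # (image φ (∁ I)))  ≤⟨ *-monoʳ-≤ (2 * L) (+-monoʳ-≤ (# (B x ∩ U)) im) ⟩
      2 * L * (# (B x ∩ U) + suc m)              ≡⟨ *-distribˡ-+ (2 * L) (# (B x ∩ U)) (suc m) ⟩
      2 * L * # (B x ∩ U) + 2 * L * suc m        ≤⟨ +-monoʳ-≤ (2 * L * # (B x ∩ U)) (≤-trans (*-monoˡ-≤ (suc m) (*-monoˡ-≤ L {2} {8} (s≤s (s≤s z≤n)))) 8LM) ⟩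
      2 * L * # (B x ∩ U) + # U                  ∎))
      where
      a₁ : ∀ a b → a * b + a * b ≡ 2 * a * b
      a₁ = solve-∀
      im : # (image φ (∁ I)) ≤ suc m
      im = ≤-trans (#-image-≤ φ (∁ I)) (≤-trans (#-mono {P = ∁ I} (λ _ _ → refl)) (≤-reflexive (#-full (suc m))))
      incl : C x ⊆ (B x ∩ U) ∪ image φ (∁ I)
      incl v q with bool (image φ (∁ I) v)
      ... | inj₁ i = ∨⁺ʳ {(B x ∩ U) v} i
      ... | inj₂ i = ∨⁺ˡ (∧⁺ {B x v} (∧⁺ q (not⁺ i)) (C⊆U x p v q))

    -- The greedy embedding lemma, applied to an edgeless graph.
    representatives : ∀ (Y : Sub n) (J : Sub (suc m)) → J ⊆ I → # Y ≤ suc m →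
      ∃ λ (ψ : Fin (suc m) → Fin n) → (∀ x y → x ∈ J → y ∈ J → ψ x ≡ ψ y → x ≡ y) × (∀ x → x ∈ J → B x (ψ x) ≡ true × ψ x ∈ U × ψ x ∉ Y)
    representatives Y J J⊆I #Y≤ = conclude (embedding J J (λ _ p → p) (λ _ _ _ _ ()) (λ _ _ _ _ _ ()) C₀ (λ _ v p → ∧ʳ {B _ v} (∖ˡ (B _ ∩ U) Y p)) big)
      where
      C₀ : Fin (suc m) → Sub n
      C₀ x = B x ∩ U ∖ Y
      big : ∀ x → x ∈ J → # U ≤ 4 * L * # (C₀ x)
      big x p = +-cancelʳ-≤ (# U) _ _ (begin
        # U + # U                              ≤⟨ +-mono-≤ rich' rich' ⟩
        2 * L * # (B x ∩ U) + 2 * L * # (B x ∩ U)   ≡⟨ a₁ L (# (B x ∩ U)) ⟩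
        4 * L * # (B x ∩ U)                    ≤⟨ *-monoʳ-≤ (4 * L) (≤-trans (#-∖ (B x ∩ U) Y) (+-monoʳ-≤ (# (C₀ x)) #Y≤)) ⟩
        4 * L * (# (C₀ x) + suc m)             ≡⟨ *-distribˡ-+ (4 * L) (# (C₀ x)) (suc m) ⟩
        4 * L * # (C₀ x) + 4 * L * suc m       ≤⟨ +-monoʳ-≤ (4 * L * # (C₀ x)) (≤-trans (*-monoˡ-≤ (suc m) (*-monoˡ-≤ L {4} {8} (s≤s (s≤s (s≤s (s≤s z≤n)))))) 8LM) ⟩
        4 * L * # (C₀ x) + # U                 ∎)
        where
        rich' : # U ≤ 2 * L * # (B x ∩ U)
        rich' = subst (λ z → # U ≤ z * # (B x ∩ U)) ℓ'≡ (rich x (J⊆I x p))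
        a₁ : ∀ a b → 2 * a * b + 2 * a * b ≡ 4 * a * b
        a₁ = solve-∀
      room : 2 * (4 * L * 1) * suc m < # U
      room = subst (_< # U) (a₂ L (suc m)) U-big
        where
        a₂ : ∀ a b → 8 * a * b ≡ 2 * (4 * a * 1) * b
        a₂ = solve-∀
      only-zero : ∀ (i j : Fin 1) → i Fin.< j → Dense (λ _ _ → true) U U (2 * (4 * L * 1) * 1) 1
      only-zero zero zero ()
      open Embedding (λ (_ _ : Fin (suc m)) → false) (λ _ _ → refl) 1 (s≤s z≤n) (λ x → ≤-trans (≤-reflexive (#-empty ∅ (λ _ → refl))) z≤n)
        (λ _ _ → true) (λ _ _ → refl) (λ _ → zero) (λ (_ : Fin 1) → U) (4 * L) 1 (2 * (4 * L * 1) * 1) (s≤s z≤n) only-zero ≤-refl (λ _ → room)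
        using (Embedded; embedding)
      conclude : Embedded J J C₀ → _
      conclude Em = E'.φ , E'.φ-inj , λ x p → ∧ˡ (∖ˡ (B x ∩ U) Y (E'.φ∈C₀ x p)) , ∧ʳ {B x (E'.φ x)} (∖ˡ (B x ∩ U) Y (E'.φ∈C₀ x p)) , ∖ʳ (B x ∩ U) Y (E'.φ∈C₀ x p)
        where module E' = Embedded Em

    build : ∀ p₀ t → suc C₁ * t ≤ p₀ → 0 < p₀ → (Fl : Flexible I U p₀) → Absorber W
    -- The slots for `t = 0` are taken too: a matching onto the whole of `Y` shows that `Y` avoids
    -- the image of `φ` and has at most `m + 1` elements.
    build p₀ t tC 0<p₀ Fl = outer (slots 0 z≤n) (slots t (≤-trans t≤p₀ p₀≤p))
      where
      open Flexible Fl
      t≤p₀ : t ≤ p₀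
      t≤p₀ = ≤-trans (m≤m+n t _) tC
      p<Y : p < # Y
      p<Y = +-cancelʳ-< p p (# Y) (begin-strict
        p + p      <⟨ +-monoʳ-< p (m<m+n p (≤-trans 0<p₀ p₀≤p)) ⟩
        p + (p + p) ≤⟨ +-monoʳ-≤ p (+-monoʳ-≤ p (m≤m+n p _)) ⟩
        4 * p      ≤⟨ *-monoˡ-≤ p 4≤h ⟩
        h' * p     ≡⟨ sym #Y ⟩
        # Y + p    ∎)
      outer : Slots I Y 0 → Slots I Y t → Absorber W
      outer (I₀ , I₀⊆ , c₀' , m₀) (I' , I'⊆ , cI , m') = middle (m₀ ∅ (λ _ ()) (#-empty ∅ (λ _ → refl))) (representatives Y (I ∖ I') (λ x → ∖ˡ I I') #Y≤)
        where
        #Y≤ : # Y ≤ suc m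
        #Y≤ = ≤-trans (≤-reflexive (trans (sym c₀') (+-identityʳ _))) (≤-trans (#-mono I₀⊆) #I≤)
        middle : MatchOnto I₀ (Y ∖ ∅) → (∃ λ (ψ : Fin (suc m) → Fin n) → (∀ x y → x ∈ I ∖ I' → y ∈ I ∖ I' → ψ x ≡ ψ y → x ≡ y) ×
                   (∀ x → x ∈ I ∖ I' → B x (ψ x) ≡ true × ψ x ∈ U × ψ x ∉ Y)) → Absorber W
        middle (μ₀ , _ , edge₀ , _ , onto₀) (ψ , ψ-inj , ψ-in) = record
          { Z = image φ (∁ I) ∪ image ψ (I ∖ I') ∪ Y ; Y = Y ; t = t ; Z⊆W = Z⊆W
          ; Y⊆Z = λ v p → ∨⁺ʳ {(image φ (∁ I) ∪ image ψ (I ∖ I')) v} p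
          ; t-room = ≤-<-trans (≤-trans (≤-reflexive (+-comm (C₁ * t) t)) (≤-trans tC p₀≤p)) p<Y
          ; absorb = λ T TY cT → cover T TY (m' T TY cT) }
          where
          Y-free : ∀ y → y ∈ Y → y ∉ image φ (∁ I)
          Y-free y p with onto₀ y (∖⁺ Y ∅ p refl)
          ... | x , xI , refl = not⁻ (∧ʳ {C x (μ₀ x)} (edge₀ x xI))
          Z⊆W : image φ (∁ I) ∪ image ψ (I ∖ I') ∪ Y ⊆ W
          Z⊆W v p with ∨⁻ {(image φ (∁ I) ∪ image ψ (I ∖ I')) v} p
          ... | inj₂ y = U⊆W v (Y⊆U v y)
          ... | inj₁ z with ∨⁻ {image φ (∁ I) v} z
          ... | inj₁ i with image⁻ φ (∁ I) i
          ... | x , q , refl = φ∈W x q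
          Z⊆W v p | inj₁ z | inj₂ i with image⁻ ψ (I ∖ I') i
          ... | x , q , refl = U⊆W _ (proj₁ (proj₂ (ψ-in x q)))
          cover : ∀ T → T ⊆ Y → MatchOnto I' (Y ∖ T) → Cover≤ ((image φ (∁ I) ∪ image ψ (I ∖ I') ∪ Y) ∖ T) 1
          cover T TY (μ , μ∈ , μ-edge , μ-inj , μ-onto) = assemble m γ I I' C φ ψ μ Y T indep φ-inj φ-edge C-adj ψ-inj
            (λ x p → ∧ˡ (proj₁ (ψ-in x p)) , not⁻ (∧ʳ {C x (ψ x)} (proj₁ (ψ-in x p))) , proj₂ (proj₂ (ψ-in x p)))
            μ-inj (λ x p → I'⊆ x p , ∧ˡ (μ-edge x p) , μ∈ x p) μ-onto Y-free TY

  -- `Θ₁` collects the losses on the way from `W` to `t`: the size of the tile, its largest colour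
  -- class, the shrinking `hf` during the increments, and the room demanded by `t-room`.
  C₂ rate₂ hf Θ₁ : ℕ
  C₂ = 8 * L * Γ
  rate₂ = suc (2 * C₂)
  hf = h' ^ f'
  Θ₁ = rate₂ * suc Δ * (2 * hf * (2 * suc C₁))

  0<C₂ : 0 < C₂
  0<C₂ = *-mono-≤ (*-mono-≤ {1} {8} (s≤s z≤n) 0<L) 0<Γ

  0<hf : 0 < hf
  0<hf = m^n>0 h' ⦃ >-nonZero 0<h' ⦄ f'

  AbsorberFor : Sub n → Set
  AbsorberFor W = Σ (Absorber W) λ A → # W ≤ Θ₁ * Absorber.t A

  absorber : ∀ W → Θ₁ ≤ # W → AbsorberFor W
  absorber W big = step₁ (chunk C₂ (pred (# W)) 0<C₂ (<⇒≤pred C₂<W))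
    where
    open ≤-Reasoning
    0<tail : 0 < 2 * hf * (2 * suc C₁)
    0<tail = *-mono-≤ (*-mono-≤ {1} {2} (s≤s z≤n) 0<hf) (s≤s z≤n)
    C₂<W : C₂ < # W
    C₂<W = begin-strict
      C₂               <⟨ s≤s (m≤n*m C₂ 2) ⟩
      rate₂            ≤⟨ m≤m*n rate₂ (suc Δ) ⟩
      rate₂ * suc Δ    ≤⟨ m≤m*n (rate₂ * suc Δ) (2 * hf * (2 * suc C₁)) ⦃ >-nonZero 0<tail ⦄ ⟩
      Θ₁               ≤⟨ big ⟩
      # W              ∎
    sucpred : suc (pred (# W)) ≡ # W
    sucpred = suc-pred (# W) ⦃ >-nonZero (≤-<-trans z≤n C₂<W) ⦄
    step₁ : (∃ λ M → 0 < M × C₂ * M ≤ pred (# W) × pred (# W) ≤ 2 * C₂ * M) → AbsorberFor W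
    step₁ (suc m , 0<M , lo , hi) = step₂ (frame W m (≤-trans (s≤s lo) (≤-reflexive sucpred)))
      where
      W≤M : # W ≤ rate₂ * suc m
      W≤M = begin
        # W                       ≡⟨ sym sucpred ⟩
        suc (pred (# W))          ≤⟨ +-mono-≤ 0<M hi ⟩
        suc m + 2 * C₂ * suc m    ∎
      step₂ : Frame W m → AbsorberFor W
      step₂ K = step₃ (chunk hf (# I) 0<hf hf≤I)
        where
        open Frame K
        open FromFrame K
        W≤I : # W ≤ rate₂ * suc Δ * # I
        W≤I = ≤-trans W≤M (≤-trans (*-monoʳ-≤ rate₂ I-big) (≤-reflexive (sym (*-assoc rate₂ (suc Δ) (# I)))))
        tail≤I : 2 * hf * (2 * suc C₁) ≤ # I
        tail≤I = *-cancelˡ-≤ (rate₂ * suc Δ) (≤-trans big W≤I)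
        hf≤I : hf ≤ # I
        hf≤I = ≤-trans (≤-trans (m≤n*m hf 2) (m≤m*n (2 * hf) (2 * suc C₁))) tail≤I
        step₃ : (∃ λ p₀ → 0 < p₀ × hf * p₀ ≤ # I × # I ≤ 2 * hf * p₀) → AbsorberFor W
        step₃ (p₀ , 0<p₀ , lo , hi) = step₄ (chunk (suc C₁) p₀ (s≤s z≤n) C₁≤p₀)
          where
          C₁≤p₀ : suc C₁ ≤ p₀
          C₁≤p₀ = *-cancelˡ-≤ (2 * hf) ⦃ >-nonZero (*-mono-≤ {1} {2} (s≤s z≤n) 0<hf) ⦄ (begin
            2 * hf * suc C₁        ≤⟨ *-monoʳ-≤ (2 * hf) (m≤n*m (suc C₁) 2) ⟩
            2 * hf * (2 * suc C₁)  ≤⟨ tail≤I ⟩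
            # I                    ≤⟨ hi ⟩
            2 * hf * p₀            ∎)
          s≤I : p₀ * h' ^ f' ≤ # I
          s≤I = ≤-trans (≤-reflexive (*-comm p₀ hf)) lo
          I≤U : # I ≤ # U
          I≤U = ≤-trans #I≤ (≤-trans (m≤n*m (suc m) (8 * L) ⦃ >-nonZero (*-mono-≤ {1} {8} (s≤s z≤n) 0<L) ⦄) 8LM)
          step₄ : (∃ λ t → 0 < t × suc C₁ * t ≤ p₀ × p₀ ≤ 2 * suc C₁ * t) → AbsorberFor W
          step₄ (t , 0<t , tC , hi') = build p₀ t tC 0<p₀ (flexible I U p₀ 0<p₀ s≤I (≤-trans s≤I I≤U) rich φ) , bound
            where
            a₁ : ∀ a b c d → a * (b * (c * d)) ≡ a * (b * c) * d
            a₁ = solve-∀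
            bound : # W ≤ Θ₁ * t
            bound = begin
              # W                                               ≤⟨ W≤I ⟩
              rate₂ * suc Δ * # I                               ≤⟨ *-monoʳ-≤ (rate₂ * suc Δ) hi ⟩
              rate₂ * suc Δ * (2 * hf * p₀)                     ≤⟨ *-monoʳ-≤ (rate₂ * suc Δ) (*-monoʳ-≤ (2 * hf) hi') ⟩
              rate₂ * suc Δ * (2 * hf * (2 * suc C₁ * t))       ≡⟨ a₁ (rate₂ * suc Δ) (2 * hf) (2 * suc C₁) t ⟩
              Θ₁ * t                                            ∎

-- Absorbing vertices of one type

module TypeAbsorption {r n : ℕ} (P : Setting r n) where
  open AbsorberExistence P public

  -- The packing constant: a tile with `Q * k` vertices has `k` vertices at pairwise distance at
  -- least three, so it can absorb `k` given vertices.
  Q : ℕ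
  Q = suc (suc Δ * suc Δ)

  -- A perfect matching in the complete bipartite graph, with `p = 1`.
  bijection : ∀ {k} (A : Sub k) (S : Sub n) → # A ≡ # S → 0 < # S →
              ∃ λ (β : Fin k → Fin n) → (∀ x → x ∈ A → β x ∈ S) × (∀ x y → x ∈ A → y ∈ A → β x ≡ β y → x ≡ y) ×
                (∀ w → w ∈ S → ∃ λ x → x ∈ A × β x ≡ w)
  bijection A S eq 0<S = unpack (perfect (λ _ → proj₁ (0<#⇒∈ S 0<S)))
    where
    edge : ∀ A' X' → A' ⊆ A → X' ⊆ S → 1 ≤ # A' → 1 ≤ # X' → ∃ λ x → ∃ λ v → x ∈ A' × v ∈ X' × true ≡ true
    edge A' X' _ _ a x with 0<#⇒∈ A' a | 0<#⇒∈ X' x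
    ... | u , p | v , q = u , v , p , q , refl
    open Matching (λ _ _ → true) A S 1 eq
      (λ x _ → ≤-trans 0<S (#-mono {P = S} (λ _ p → p)))
      (λ y _ → ≤-trans (≤-trans 0<S (≤-reflexive (sym eq))) (#-mono {P = A} (λ _ p → ∧⁺ p refl)))
      edge using (Perfect; perfect)
    unpack : Perfect → _
    unpack M = Perfect.μ M , Perfect.μ∈Y M , Perfect.μ-inj M , Perfect.μ-onto M

  -- Far-apart vertices of the tile are mapped onto S; their neighbourhoods are disjoint, so each remaining vertex sees
  -- at most one vertex of S before the greedy embedding into the layers starts.
  absorb-type : ∀ γ (Hs : Fin (suc Δ) → Sub n) (S T : Sub n) → 0 < # S →
    (∀ a b → a Fin.< b → Dense N[ γ ] (Hs a) (Hs b) E (2 * D₀)) →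
    (∀ w i → w ∈ S → # (Hs i) ≤ r * # (N[ γ ] w ∩ Hs i)) →
    (∀ i → 2 * r * # T ≤ # (Hs i)) → (∀ i → 2 * L * (Q * # S) < # (Hs i)) → (∀ w i → w ∈ S → w ∉ Hs i) →
    ∃ λ T' → (∀ v → v ∈ T' → v ∉ T × ∃ λ i → v ∈ Hs i) × # T' ≤ Q * # S × Cover≤ (S ∪ T') 1
  absorb-type γ Hs S T 0<S Hs-dense maj T-small room apart = go (Q * # S) refl (*-mono-≤ {1} {Q} (s≤s z≤n) 0<S)
    where
    Goal : Set
    Goal = ∃ λ T' → (∀ v → v ∈ T' → v ∉ T × ∃ λ i → v ∈ Hs i) × # T' ≤ Q * # S × Cover≤ (S ∪ T') 1
    go : ∀ M → M ≡ Q * # S → 0 < M → Goal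
    go (suc m) eqM _ = step₁ (packing Δ (F m) (F-deg m))
      where
      step₁ : (∃ λ (P₀ : Sub (suc m)) → suc m ≤ Q * # P₀ × (∀ x y → x ∈ P₀ → y ∈ P₀ → adj (F m) x y ≡ false) ×
                (∀ x y z → x ∈ P₀ → y ∈ P₀ → adj (F m) z x ≡ true → adj (F m) z y ≡ true → x ≡ y)) → Goal
      step₁ (P₀ , big , indep₀ , uniq₀) = step₂ (subset-of-size P₀ (# S) (*-cancelˡ-≤ Q (≤-trans (≤-reflexive (sym eqM)) big)))
        where
        step₂ : (∃ λ A → A ⊆ P₀ × # A ≡ # S) → Goal
        step₂ (A , A⊆ , cA) = step₃ (bijection A S cA 0<S) (colouring m)
          where
          step₃ : (∃ λ (β : Fin (suc m) → Fin n) → (∀ x → x ∈ A → β x ∈ S) × (∀ x y → x ∈ A → y ∈ A → β x ≡ β y → x ≡ y) ×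
                    (∀ w → w ∈ S → ∃ λ x → x ∈ A × β x ≡ w)) →
                  (∃ λ (g : Fin (suc m) → Fin (suc Δ)) → ∀ x y → adj (F m) x y ≡ true → ¬ (g x ≡ g y)) → Goal
          step₃ (β , β∈ , β-inj , β-onto) (g , proper) = conclude (embedding (∁ A) (∁ A) (λ _ p → p) (λ x y _ _ → proper x y)
              (λ x y _ p q _ → ⊥-elim (true≢false p q)) C₀ (λ y v p → ∧ˡ p) C₀-big)
            where
            blocked : Fin (suc m) → Sub n
            blocked y v = some (λ x → A x ∧ (adj (F m) y x ∧ not (N[ γ ] (β x) v)))
            C₀ : Fin (suc m) → Sub n
            C₀ y v = Hs (g y) v ∧ not ((T ∪ blocked y) v)
            -- `X` is what the at most one neighbour in `A` permits, a 1/`r` share of the layer.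
            -- Removing `T` costs at most half of it, whence the initial loss `2 * r`.
            enough : ∀ y (X : Sub n) → X ⊆ Hs (g y) → # (Hs (g y)) ≤ r * # X → (∀ v → v ∈ X → v ∉ blocked y) → # (Hs (g y)) ≤ 2 * r * # (C₀ y)
            enough y X sub big' free = +-cancelʳ-≤ (# (Hs (g y))) _ _ (begin
              # (Hs (g y)) + # (Hs (g y))              ≤⟨ +-mono-≤ big' big' ⟩
              r * # X + r * # X                        ≡⟨ a₁ r (# X) ⟩
              2 * r * # X                              ≤⟨ *-monoʳ-≤ (2 * r) (#-∖ X T) ⟩
              2 * r * (# (X ∖ T) + # T)                ≡⟨ *-distribˡ-+ (2 * r) (# (X ∖ T)) (# T) ⟩
              2 * r * # (X ∖ T) + 2 * r * # T          ≤⟨ +-mono-≤ (*-monoʳ-≤ (2 * r) (#-mono {P = X ∖ T} {C₀ y} incl)) (T-small (g y)) ⟩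
              2 * r * # (C₀ y) + # (Hs (g y))          ∎)
              where
              open ≤-Reasoning
              a₁ : ∀ a b → a * b + a * b ≡ 2 * a * b
              a₁ = solve-∀
              incl : X ∖ T ⊆ C₀ y
              incl v p = ∖⁺ (Hs (g y)) (T ∪ blocked y) (sub v (∖ˡ X T p))
                (¬true⇒false λ q → [ (λ t → true≢false t (∖ʳ X T p)) , (λ b → true≢false b (free v (∖ˡ X T p))) ]′ (∨⁻ {T v} q))
            C₀-big : ∀ y → y ∈ ∁ A → # (Hs (g y)) ≤ 2 * r * # (C₀ y)
            C₀-big y _ = pick-case (find (λ x → A x ∧ adj (F m) y x))
              where
              pick-case : (∃ λ x → A x ∧ adj (F m) y x ≡ true) ⊎ (∀ x → A x ∧ adj (F m) y x ≡ false) → # (Hs (g y)) ≤ 2 * r * # (C₀ y)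
              pick-case (inj₁ (x , p)) = enough y (N[ γ ] (β x) ∩ Hs (g y)) (λ v → ∧ʳ {N[ γ ] (β x) v}) (maj (β x) (g y) (β∈ x (∧ˡ p)))
                λ v q → ¬true⇒false λ b → contra v (∧ˡ q) (some⁻ _ b)
                where
                contra : ∀ v → N[ γ ] (β x) v ≡ true → (∃ λ z → A z ∧ (adj (F m) y z ∧ not (N[ γ ] (β z) v)) ≡ true) → ⊥
                contra v ok (z , e) = true≢false ok (not⁻ (subst (λ z → not (N[ γ ] (β z) v) ≡ true)
                  (uniq₀ z x y (A⊆ z (∧ˡ e)) (A⊆ x (∧ˡ p)) (∧ˡ (∧ʳ {A z} e)) (∧ʳ {A x} p)) (∧ʳ {adj (F m) y z} (∧ʳ {A z} e))))
              pick-case (inj₂ none) = enough y (Hs (g y)) (λ _ p → p) (m≤n*m (# (Hs (g y))) r ⦃ >-nonZero 0<r ⦄)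
                λ v _ → ¬true⇒false λ b → contra v (some⁻ _ b)
                where
                contra : ∀ v → (∃ λ z → A z ∧ (adj (F m) y z ∧ not (N[ γ ] (β z) v)) ≡ true) → ⊥
                contra v (z , e) = true≢false (∧⁺ {A z} {adj (F m) y z} (∧ˡ e) (∧ˡ (∧ʳ {A z} e))) (none z)
            open Embedding (adj (F m)) (adj-sym (F m)) Δ 0<Δ (F-deg m) N[ γ ] (N-sym γ) g Hs (2 * r) (2 * D₀) E 0<2D₀
              Hs-dense E-big (λ i → subst (λ M → 2 * L * M < # (Hs i)) (sym eqM) (room i)) using (Embedded; embedding)
            conclude : Embedded (∁ A) (∁ A) C₀ → Goal
            conclude Em = image φ (∁ A) , T'-in , T'-small ,
                cover-copy m ρ γ inj (λ u v a → ≐⁻ (mono' u v a (view u) (view v))) (λ u → inside u (view u)) onto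
              where
              open Embedded Em
              T'-in : ∀ v → v ∈ image φ (∁ A) → v ∉ T × ∃ λ i → v ∈ Hs i
              T'-in v p with image⁻ φ (∁ A) p
              ... | x , q , refl = ∉-⊆ {P = T} {T ∪ blocked x} (λ w → ∨⁺ˡ) (∖ʳ (Hs (g x)) (T ∪ blocked x) (φ∈C₀ x q)) , g x , ∧ˡ (φ∈C₀ x q)
              T'-small : # (image φ (∁ A)) ≤ Q * # S
              T'-small = ≤-trans (#-image-≤ φ (∁ A)) (≤-trans (#-mono {P = ∁ A} (λ _ _ → refl)) (≤-reflexive (trans (#-full (suc m)) eqM)))
              ρ : Fin (suc m) → Fin n
              ρ x = if A x then β x else φ x
              View : Fin (suc m) → Set
              View x = (x ∈ A × ρ x ≡ β x) ⊎ (x ∈ ∁ A × ρ x ≡ φ x)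
              view : ∀ x → View x
              view x with A x
              ... | true = inj₁ (refl , refl)
              ... | false = inj₂ (refl , refl)
              S-φ : ∀ x → x ∈ ∁ A → φ x ∉ S
              S-φ x p = ¬true⇒false λ s → true≢false (∧ˡ (φ∈C₀ x p)) (apart (φ x) (g x) s)
              inj' : ∀ x y → View x → View y → ρ x ≡ ρ y → x ≡ y
              inj' x y (inj₁ (p , e)) (inj₁ (q , f)) h = β-inj x y p q (trans (sym e) (trans h f))
              inj' x y (inj₂ (p , e)) (inj₂ (q , f)) h = φ-inj x y p q (trans (sym e) (trans h f))
              inj' x y (inj₁ (p , e)) (inj₂ (q , f)) h = ⊥-elim (true≢false (subst (_∈ S) (trans (sym e) (trans h f)) (β∈ x p)) (S-φ y q))
              inj' x y (inj₂ (p , e)) (inj₁ (q , f)) h = ⊥-elim (true≢false (subst (_∈ S) (trans (sym f) (trans (sym h) e)) (β∈ y q)) (S-φ x p))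
              inj : ∀ x y → ρ x ≡ ρ y → x ≡ y
              inj x y = inj' x y (view x) (view y)
              seen : ∀ x y → x ∈ A → y ∈ ∁ A → adj (F m) y x ≡ true → N[ γ ] (β x) (φ y) ≡ true
              seen x y p q a with bool (N[ γ ] (β x) (φ y))
              ... | inj₁ ok = ok
              ... | inj₂ bad' = ⊥-elim (true≢false (∨⁺ʳ {T (φ y)} (some⁺ (λ x → A x ∧ (adj (F m) y x ∧ not (N[ γ ] (β x) (φ y)))) x
                  (∧⁺ p (∧⁺ a (not⁺ bad'))))) (∖ʳ (Hs (g y)) (T ∪ blocked y) (φ∈C₀ y q)))
              mono' : ∀ x y → adj (F m) x y ≡ true → View x → View y → N[ γ ] (ρ x) (ρ y) ≡ true
              mono' x y a (inj₁ (p , e)) (inj₁ (q , f)) = ⊥-elim (true≢false a (indep₀ x y (A⊆ x p) (A⊆ y q)))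
              mono' x y a (inj₂ (p , e)) (inj₂ (q , f)) = subst₂ (λ u v → N[ γ ] u v ≡ true) (sym e) (sym f) (edge x y p q a)
              mono' x y a (inj₁ (p , e)) (inj₂ (q , f)) = subst₂ (λ u v → N[ γ ] u v ≡ true) (sym e) (sym f) (seen x y p q (trans (adj-sym (F m) y x) a))
              mono' x y a (inj₂ (p , e)) (inj₁ (q , f)) = trans (N-sym γ (ρ x) (ρ y)) (subst₂ (λ u v → N[ γ ] u v ≡ true) (sym f) (sym e) (seen y x q p a))
              inside : ∀ x → View x → ρ x ∈ S ∪ image φ (∁ A)
              inside x (inj₁ (p , e)) = subst (_∈ S ∪ image φ (∁ A)) (sym e) (∨⁺ˡ (β∈ x p))
              inside x (inj₂ (p , e)) = subst (_∈ S ∪ image φ (∁ A)) (sym e) (∨⁺ʳ {S (φ x)} (image⁺ φ (∁ A) p))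
              onto : ∀ w → w ∈ S ∪ image φ (∁ A) → ∃ λ u → ρ u ≡ w
              onto w p = [ (λ s → fromS (β-onto w s)) , (λ i → fromφ (image⁻ φ (∁ A) i)) ]′ (∨⁻ {S w} p)
                where
                fromS : (∃ λ x → x ∈ A × β x ≡ w) → ∃ λ u → ρ u ≡ w
                fromS (x , q , e) = x , trans (cong (λ b → if b then β x else φ x) q) e
                fromφ : (∃ λ x → x ∈ ∁ A × φ x ≡ w) → ∃ λ u → ρ u ≡ w
                fromφ (x , q , e) = x , trans (cong (λ b → if b then β x else φ x) (not⁻ {A x} q)) e

-- The main induction

module MainInduction {r n : ℕ} (P : Setting r n) where
  open TypeAbsorption P public

  apart-∪ : ∀ {P Q X : Sub n} → (∀ v → v ∈ P → v ∉ X) → (∀ v → v ∈ Q → v ∉ X) → ∀ v → v ∈ P ∪ Q → v ∉ X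
  apart-∪ {P} p q v z = [ p v , q v ]′ (∨⁻ {P v} z)

  -- Bookkeeping of one round. The five pieces are the absorbed vertices with the layer vertices `T`
  -- spent on them, the greedy part `S`, the recursive part with the layer vertices `T₂` that it
  -- spends, the padding `Sp`, and what the absorber `Z` has left. Only the part of `T₂` outside
  -- `Y₀` is charged to older layers.
  combine : ∀ (R R' T Z Y₀ S T₂ Sp : Sub n) {b₁ b₂ b₃ b₄ b₅} → R' ⊆ R → (∀ v → v ∈ T → v ∉ R) → Z ⊆ R' → Y₀ ⊆ Z → S ⊆ R' ∖ Z →
    (∀ v → v ∈ T₂ → v ∈ Y₀ ⊎ (v ∉ R × v ∉ T)) → Sp ⊆ Y₀ ∖ (T₂ ∩ Y₀) →
    Cover≤ ((R ∖ R') ∪ T) b₁ → Cover≤ S b₂ → Cover≤ ((R' ∖ Z ∖ S) ∪ T₂) b₃ → Cover≤ Sp b₄ → Cover≤ (Z ∖ ((T₂ ∩ Y₀) ∪ Sp)) b₅ →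
    Cover≤ (R ∪ (T ∪ (T₂ ∖ Y₀))) (b₁ + b₂ + b₃ + b₄ + b₅)
  combine R R' T Z Y₀ S T₂ Sp R'⊆R T-R Z⊆R' Y₀⊆Z S⊆ T₂-in Sp⊆ c₁ c₂ c₃ c₄ c₅ =
    cover≤-ext to from (cover≤-∪ d₄ (cover≤-∪ d₃ (cover≤-∪ d₂ (cover≤-∪ d₁ c₁ c₂) c₃) c₄) c₅)
    where
    P₁ P₂ P₃ P₄ P₅ : Sub n
    P₁ = (R ∖ R') ∪ T
    P₂ = S
    P₃ = (R' ∖ Z ∖ S) ∪ T₂
    P₄ = Sp
    P₅ = Z ∖ ((T₂ ∩ Y₀) ∪ Sp)
    Y₀⊆R' : Y₀ ⊆ R'
    Y₀⊆R' v p = Z⊆R' v (Y₀⊆Z v p)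
    R'-apart : ∀ v → v ∈ R' → v ∉ P₁
    R'-apart v p = ¬true⇒false λ q → [ (λ a → true≢false p (∖ʳ R R' a)) , (λ t → true≢false (R'⊆R v p) (T-R v t)) ]′ (∨⁻ {(R ∖ R') v} q)
    ap₁ : ∀ {X : Sub n} → X ⊆ R' → ∀ v → v ∈ P₁ → v ∉ X
    ap₁ s v p = ¬true⇒false λ x → true≢false p (R'-apart v (s v x))
    T₂-apart : ∀ v → v ∈ T₂ → v ∉ P₁
    T₂-apart v p = [ (λ y → R'-apart v (Y₀⊆R' v y)) , (λ { (nr , nt) → ¬true⇒false λ q →
      [ (λ a → true≢false (∖ˡ R R' a) nr) , (λ t → true≢false t nt) ]′ (∨⁻ {(R ∖ R') v} q) }) ]′ (T₂-in v p)
    d₁ : ∀ v → v ∈ P₁ → v ∉ P₂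
    d₁ = ap₁ {S} (λ v s → ∖ˡ R' Z (S⊆ v s))
    d₂ : ∀ v → v ∈ P₁ ∪ P₂ → v ∉ P₃
    d₂ = apart-∪ {P₁} {P₂} {P₃} (λ v p → ¬true⇒false λ q → [ (λ a → true≢false p (R'-apart v (∖ˡ R' Z (∖ˡ (R' ∖ Z) S a)))) , (λ t → true≢false p (T₂-apart v t)) ]′ (∨⁻ {(R' ∖ Z ∖ S) v} q))
      (λ v s → ¬true⇒false λ q → [ (λ a → true≢false s (∖ʳ (R' ∖ Z) S a)) ,
        (λ t → [ (λ y → true≢false (Y₀⊆Z v y) (∖ʳ R' Z (S⊆ v s))) , (λ { (nr , _) → true≢false (R'⊆R v (∖ˡ R' Z (S⊆ v s))) nr }) ]′ (T₂-in v t)) ]′ (∨⁻ {(R' ∖ Z ∖ S) v} q))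
    Sp⊆Z : Sp ⊆ Z
    Sp⊆Z v p = Y₀⊆Z v (∖ˡ Y₀ (T₂ ∩ Y₀) (Sp⊆ v p))
    S-Z : ∀ v → v ∈ S → v ∉ Z
    S-Z v s = ∖ʳ R' Z (S⊆ v s)
    d₃ : ∀ v → v ∈ P₁ ∪ P₂ ∪ P₃ → v ∉ P₄
    d₃ = apart-∪ {P₁ ∪ P₂} {P₃} {P₄} (apart-∪ {P₁} {P₂} {P₄} (ap₁ {Sp} (λ v p → Z⊆R' v (Sp⊆Z v p))) (λ v s → ∉-⊆ {P = Sp} {Z} Sp⊆Z (S-Z v s)))
      (apart-∪ {R' ∖ Z ∖ S} {T₂} {P₄} (λ v a → ∉-⊆ {P = Sp} {Z} Sp⊆Z (∖ʳ R' Z (∖ˡ (R' ∖ Z) S a)))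
        (λ v t → ¬true⇒false λ q → true≢false (∧⁺ t (∖ˡ Y₀ (T₂ ∩ Y₀) (Sp⊆ v q))) (∖ʳ Y₀ (T₂ ∩ Y₀) (Sp⊆ v q))))
    P₅⊆Z : P₅ ⊆ Z
    P₅⊆Z v = ∖ˡ Z ((T₂ ∩ Y₀) ∪ Sp)
    d₄ : ∀ v → v ∈ P₁ ∪ P₂ ∪ P₃ ∪ P₄ → v ∉ P₅
    d₄ = apart-∪ {P₁ ∪ P₂ ∪ P₃} {P₄} {P₅} (apart-∪ {P₁ ∪ P₂} {P₃} {P₅} (apart-∪ {P₁} {P₂} {P₅} (ap₁ {P₅} (λ v p → Z⊆R' v (P₅⊆Z v p))) (λ v s → ∉-⊆ {P = P₅} {Z} P₅⊆Z (S-Z v s)))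
        (apart-∪ {R' ∖ Z ∖ S} {T₂} {P₅} (λ v a → ∉-⊆ {P = P₅} {Z} P₅⊆Z (∖ʳ R' Z (∖ˡ (R' ∖ Z) S a)))
          (λ v t → ¬true⇒false λ q → [ (λ y → true≢false (∨⁺ˡ {(T₂ ∩ Y₀) v} {Sp v} (∧⁺ t y)) (∖ʳ Z ((T₂ ∩ Y₀) ∪ Sp) q)) ,
            (λ { (nr , _) → true≢false (R'⊆R v (Z⊆R' v (P₅⊆Z v q))) nr }) ]′ (T₂-in v t))))
      (λ v s → ¬true⇒false λ q → true≢false (∨⁺ʳ {(T₂ ∩ Y₀) v} s) (∖ʳ Z ((T₂ ∩ Y₀) ∪ Sp) q))
    Ω : Sub n
    Ω = R ∪ (T ∪ (T₂ ∖ Y₀))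
    inR : ∀ {v} → v ∈ R → v ∈ Ω
    inR p = ∨⁺ˡ p
    to : P₁ ∪ P₂ ∪ P₃ ∪ P₄ ∪ P₅ ⊆ Ω
    to v z = [ (λ z₄ → [ (λ z₃ → [ (λ z₂ → [ (λ z₁ → [ (λ a → inR (∖ˡ R R' a)) , (λ t → ∨⁺ʳ {R v} (∨⁺ˡ t)) ]′ (∨⁻ {(R ∖ R') v} z₁)) ,
        (λ s → inR (R'⊆R v (∖ˡ R' Z (S⊆ v s)))) ]′ (∨⁻ {P₁ v} z₂)) ,
        (λ q → [ (λ a → inR (R'⊆R v (∖ˡ R' Z (∖ˡ (R' ∖ Z) S a)))) , inT₂ ]′ (∨⁻ {(R' ∖ Z ∖ S) v} q)) ]′ (∨⁻ {(P₁ ∪ P₂) v} z₃)) ,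
        (λ s → inR (R'⊆R v (Z⊆R' v (Sp⊆Z v s)))) ]′ (∨⁻ {(P₁ ∪ P₂ ∪ P₃) v} z₄)) ,
        (λ q → inR (R'⊆R v (Z⊆R' v (P₅⊆Z v q)))) ]′ (∨⁻ {(P₁ ∪ P₂ ∪ P₃ ∪ P₄) v} z)
      where
      inT₂ : v ∈ T₂ → v ∈ Ω
      inT₂ t with bool (Y₀ v)
      ... | inj₁ y = inR (R'⊆R v (Y₀⊆R' v y))
      ... | inj₂ ny = ∨⁺ʳ {R v} (∨⁺ʳ {T v} (∖⁺ T₂ Y₀ t ny))
    from : Ω ⊆ P₁ ∪ P₂ ∪ P₃ ∪ P₄ ∪ P₅
    from v z = [ fromR , (λ q → [ (λ t → l₁ (∨⁺ʳ {(R ∖ R') v} t)) , (λ t → l₃ (∨⁺ʳ {(R' ∖ Z ∖ S) v} (∖ˡ T₂ Y₀ t))) ]′ (∨⁻ {T v} q)) ]′ (∨⁻ {R v} z)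
      where
      All : Set
      All = v ∈ P₁ ∪ P₂ ∪ P₃ ∪ P₄ ∪ P₅
      l₁ : v ∈ P₁ → All
      l₁ p = ∨⁺ˡ (∨⁺ˡ (∨⁺ˡ (∨⁺ˡ p)))
      l₂ : v ∈ P₂ → All
      l₂ p = ∨⁺ˡ (∨⁺ˡ (∨⁺ˡ (∨⁺ʳ {P₁ v} p)))
      l₃ : v ∈ P₃ → All
      l₃ p = ∨⁺ˡ (∨⁺ˡ (∨⁺ʳ {(P₁ ∪ P₂) v} p))
      l₄ : v ∈ P₄ → All
      l₄ p = ∨⁺ˡ (∨⁺ʳ {(P₁ ∪ P₂ ∪ P₃) v} p)
      l₅ : v ∈ P₅ → All
      l₅ p = ∨⁺ʳ {(P₁ ∪ P₂ ∪ P₃ ∪ P₄) v} p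
      fromR : v ∈ R → All
      fromR p = [ (λ r' → [ (λ z' → [ (λ tf → [ (λ t → l₃ (∨⁺ʳ {(R' ∖ Z ∖ S) v} (∧ˡ t))) , l₄ ]′ (∨⁻ {(T₂ ∩ Y₀) v} tf)) ,
            (λ ntf → l₅ (∖⁺ Z ((T₂ ∩ Y₀) ∪ Sp) z' ntf)) ]′ (bool (((T₂ ∩ Y₀) ∪ Sp) v))) ,
          (λ nz → [ l₂ , (λ ns → l₃ (∨⁺ˡ (∖⁺ (R' ∖ Z) S (∖⁺ R' Z r' nz) ns))) ]′ (bool (S v))) ]′ (bool (Z v))) ,
        (λ nr → l₁ (∨⁺ˡ (∖⁺ R R' p nr))) ]′ (bool (R' v))

  -- How far each layer must outweigh the leftover. The factor `2 * L * Q` makes a tile with `Q`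
  -- vertices per leftover vertex fit into the layers; `N + 2` gives strictness and covers the
  -- vertices spent in up to `N` rounds.
  cap : ℕ
  cap = 2 * L * Q * suc (suc N)

  Absorbable : ∀ {j e} → Chain j e → Fin (r ^ j) → Set
  Absorbable K q = ∃ λ γ → Mono (pair K) γ (suc Δ) (λ i → [ finToFun q i ≐ γ ])

  absorbable? : ∀ {j e} (K : Chain j e) q → Dec (Absorbable K q)
  absorbable? K q = Fin.any? (λ γ → mono? (pair K) γ (suc Δ) (λ i → [ finToFun q i ≐ γ ]))

  2LQ≤cap : 2 * L * Q ≤ cap
  2LQ≤cap = m≤m*n (2 * L * Q) (suc (suc N))

  0<2LQ : 0 < 2 * L * Q
  0<2LQ = *-mono-≤ (*-mono-≤ {1} {2} (s≤s z≤n) 0<L) (s≤s z≤n)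

  2LQ<cap : ∀ s ρ → s ≤ ρ → 0 < ρ → 2 * L * (Q * s) < cap * ρ
  2LQ<cap s ρ le 0<ρ = begin-strict
    2 * L * (Q * s)                     ≡⟨ sym (*-assoc (2 * L) Q s) ⟩
    2 * L * Q * s                       ≤⟨ *-monoʳ-≤ (2 * L * Q) le ⟩
    2 * L * Q * ρ                       <⟨ m<m+n (2 * L * Q * ρ) (*-mono-≤ 0<2LQ 0<ρ) ⟩
    2 * L * Q * ρ + 2 * L * Q * ρ       ≡⟨ a₁ (2 * L * Q) ρ ⟩
    2 * L * Q * 2 * ρ                   ≤⟨ *-monoˡ-≤ ρ (*-monoʳ-≤ (2 * L * Q) {2} {suc (suc N)} (s≤s (s≤s z≤n))) ⟩
    cap * ρ                             ∎
    where
    open ≤-Reasoning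
    a₁ : ∀ a b → a * b + a * b ≡ a * 2 * b
    a₁ = solve-∀

  r≤L : r ≤ L
  r≤L = ≤-trans (m≤n*m r 2) (m≤m*n (2 * r) ((2 * D₀) ^ Δ) ⦃ m^n≢0 (2 * D₀) Δ ⦃ >-nonZero 0<2D₀ ⦄ ⦄)

  small-T : ∀ a ρ t y → a ≤ L → t ≤ Q * ρ → cap * ρ ≤ y → 2 * a * t ≤ y
  small-T a ρ t y a≤L t≤ y≥ = begin
    2 * a * t          ≤⟨ *-mono-≤ (*-monoʳ-≤ 2 a≤L) t≤ ⟩
    2 * L * (Q * ρ)    ≡⟨ sym (*-assoc (2 * L) Q ρ) ⟩
    2 * L * Q * ρ      ≤⟨ *-monoˡ-≤ ρ 2LQ≤cap ⟩
    cap * ρ            ≤⟨ y≥ ⟩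
    y                  ∎
    where open ≤-Reasoning

  module _ {j e : ℕ} (K : Chain j e) (E≤e : E ≤ e) (R : Sub n) (R-apart : ∀ w i → w ∈ R → w ∉ layer K i) (big : ∀ i → cap * # R ≤ # (layer K i)) where

    -- The state after the types numbered below `p`: at most one tile per type is spent, and no
    -- vertex left in `R'` has an absorbable type among them.
    record Absorbed (p : ℕ) : Set where
      field
        R' T   : Sub n
        R'⊆R   : R' ⊆ R
        T-in   : ∀ v → v ∈ T → ∃ λ i → v ∈ layer K i
        T-size : # T ≤ Q * # (R ∖ R')
        done   : Cover≤ ((R ∖ R') ∪ T) p
        hard   : ∀ w → w ∈ R' → toℕ (key (layer K) w) < p → ¬ Absorbable K (key (layer K) w)

    T-apart : ∀ {p} (A : Absorbed p) v → v ∈ Absorbed.T A → v ∉ R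
    T-apart A v t = ¬true⇒false λ p → true≢false (proj₂ (Absorbed.T-in A v t)) (R-apart v (proj₁ (Absorbed.T-in A v t)) p)

    absorb-next : ∀ p (p< : p < r ^ j) → Absorbed p → Absorbed (suc p)
    absorb-next p p< A = go (absorbable? K q) (0 <? # S)
      where
      open Absorbed A
      q : Fin (r ^ j)
      q = Fin.fromℕ< p<
      S : Sub n
      S w = R' w ∧ [ key (layer K) w ≐ q ]
      same : ∀ w → toℕ (key (layer K) w) < suc p → ¬ (toℕ (key (layer K) w) < p) → key (layer K) w ≡ q
      same w lt nlt = Fin.toℕ-injective (trans (≤-antisym (s≤s⁻¹ lt) (≮⇒≥ nlt)) (sym (Fin.toℕ-fromℕ< p<)))
      keep : (∀ w → w ∈ R' → key (layer K) w ≡ q → ¬ Absorbable K q) → Absorbed (suc p)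
      keep no-q = record { R' = R' ; T = T ; R'⊆R = R'⊆R ; T-in = T-in ; T-size = T-size ; done = weaken (n≤1+n p) done ; hard = hard' }
        where
        hard' : ∀ w → w ∈ R' → toℕ (key (layer K) w) < suc p → ¬ Absorbable K (key (layer K) w)
        hard' w w∈ lt ab = pick-side (toℕ (key (layer K) w) <? p)
          where
          pick-side : Dec (toℕ (key (layer K) w) < p) → ⊥
          pick-side (yes lt') = hard w w∈ lt' ab
          pick-side (no nlt) = no-q w w∈ (same w lt nlt) (subst (Absorbable K) (same w lt nlt) ab)
      take : Absorbable K q → 0 < # S → Absorbed (suc p)
      take (γ , mo) 0<S = use (Mono⇒sequence (pair K) γ (suc Δ) mo)
        where
        S⊆R : S ⊆ R
        S⊆R w p = R'⊆R w (∧ˡ p)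
        #S≤ : # S ≤ # R
        #S≤ = #-mono S⊆R
        0<R : 0 < # R
        0<R = ≤-trans 0<S #S≤
        T≤ : # T ≤ Q * # R
        T≤ = ≤-trans T-size (*-monoʳ-≤ Q (#-mono {P = R ∖ R'} (λ v → ∖ˡ R R')))
        use : (∃ λ (f : Fin (suc Δ) → Fin j) → (∀ a → [ finToFun q (f a) ≐ γ ] ≡ true) × (∀ a b → a Fin.< b → f a Fin.< f b × pair K (f a) (f b) ≡ γ)) → Absorbed (suc p)
        use (f , σ≡ , inc) = finish (absorb-type γ (λ a → layer K (f a)) S T 0<S
            (λ a b lt → subst (λ z → Dense N[ z ] (layer K (f a)) (layer K (f b)) E (2 * D₀)) (proj₂ (inc a b lt))
              (Dense-weaken N[ pair K (f a) (f b) ] (2 * D₀) E≤e (dense K (f a) (f b) (proj₁ (inc a b lt)))))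
            (λ w i w∈ → subst (λ z → # (layer K (f i)) ≤ r * # (N[ z ] w ∩ layer K (f i))) (≐⁻ (σ≡ i)) (key-majority (layer K) w q (≐⁻ (∧ʳ {R' w} w∈)) (f i)))
            (λ i → small-T r (# R) (# T) _ r≤L T≤ (big (f i)))
            (λ i → <-≤-trans (2LQ<cap (# S) (# R) #S≤ 0<R) (big (f i)))
            (λ w i w∈ → R-apart w (f i) (S⊆R w w∈)))
          where
          finish : (∃ λ T' → (∀ v → v ∈ T' → v ∉ T × ∃ λ i → v ∈ layer K (f i)) × # T' ≤ Q * # S × Cover≤ (S ∪ T') 1) → Absorbed (suc p)
          finish (T' , T'-in , T'-size , cov) = record
            { R' = R' ∖ S ; T = T ∪ T' ; R'⊆R = λ v z → R'⊆R v (∖ˡ R' S z) ; T-in = T-in' ; T-size = size' ; done = done' ; hard = hard' }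
            where
            T-in' : ∀ v → v ∈ T ∪ T' → ∃ λ i → v ∈ layer K i
            T-in' v z = [ T-in v , (λ t → f (proj₁ (proj₂ (T'-in v t))) , proj₂ (proj₂ (T'-in v t))) ]′ (∨⁻ {T v} z)
            T'-R : ∀ v → v ∈ T' → v ∉ R
            T'-R v t = ¬true⇒false λ w → true≢false (proj₂ (proj₂ (T'-in v t))) (R-apart v (f (proj₁ (proj₂ (T'-in v t)))) w)
            split⊆ : (R ∖ R') ∪ S ⊆ R ∖ (R' ∖ S)
            split⊆ v z = [ (λ a → ∖⁺ R (R' ∖ S) (∖ˡ R R' a) (∉-⊆ {P = R' ∖ S} {R'} (λ w → ∖ˡ R' S) (∖ʳ R R' a))) ,
              (λ s → ∖⁺ R (R' ∖ S) (S⊆R v s) (¬true⇒false λ b → true≢false s (∖ʳ R' S b))) ]′ (∨⁻ {(R ∖ R') v} z)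
            ⊆split : R ∖ (R' ∖ S) ⊆ (R ∖ R') ∪ S
            ⊆split v z = [ (λ s → ∨⁺ʳ {(R ∖ R') v} s) , (λ ns → ∨⁺ˡ (∖⁺ R R' (∖ˡ R (R' ∖ S) z)
                (¬true⇒false λ w → true≢false (∖⁺ R' S w ns) (∖ʳ R (R' ∖ S) z)))) ]′ (bool (S v))
            dj : ∀ v → v ∈ R ∖ R' → v ∉ S
            dj v a = ¬true⇒false λ s → true≢false (∧ˡ s) (∖ʳ R R' a)
            size' : # (T ∪ T') ≤ Q * # (R ∖ (R' ∖ S))
            size' = begin
              # (T ∪ T')                       ≤⟨ #-∪ T T' ⟩
              # T + # T'                       ≤⟨ +-mono-≤ T-size T'-size ⟩
              Q * # (R ∖ R') + Q * # S         ≡⟨ sym (*-distribˡ-+ Q (# (R ∖ R')) (# S)) ⟩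
              Q * (# (R ∖ R') + # S)           ≡⟨ cong (Q *_) (sym (#-∪-disjoint (R ∖ R') S dj)) ⟩
              Q * # ((R ∖ R') ∪ S)             ≤⟨ *-monoʳ-≤ Q (#-mono split⊆) ⟩
              Q * # (R ∖ (R' ∖ S))             ∎
              where open ≤-Reasoning
            done' : Cover≤ ((R ∖ (R' ∖ S)) ∪ (T ∪ T')) (suc p)
            done' = weaken (≤-reflexive (+-comm p 1)) (cover≤-ext to' from' (cover≤-∪ dj' done cov))
              where
              dj' : ∀ v → v ∈ (R ∖ R') ∪ T → v ∉ S ∪ T'
              dj' v z = ¬true⇒false λ w → [ (λ s → [ (λ a → true≢false s (dj v a)) , (λ t → true≢false (S⊆R v s) (T-apart A v t)) ]′ (∨⁻ {(R ∖ R') v} z)) ,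
                (λ t' → [ (λ a → true≢false (∖ˡ R R' a) (T'-R v t')) , (λ t → true≢false t (proj₁ (T'-in v t'))) ]′ (∨⁻ {(R ∖ R') v} z)) ]′ (∨⁻ {S v} w)
              to' : ((R ∖ R') ∪ T) ∪ (S ∪ T') ⊆ (R ∖ (R' ∖ S)) ∪ (T ∪ T')
              to' v z = [ (λ x → [ (λ a → ∨⁺ˡ (split⊆ v (∨⁺ˡ a))) , (λ t → ∨⁺ʳ {(R ∖ (R' ∖ S)) v} (∨⁺ˡ t)) ]′ (∨⁻ {(R ∖ R') v} x)) ,
                (λ x → [ (λ s → ∨⁺ˡ (split⊆ v (∨⁺ʳ {(R ∖ R') v} s))) , (λ t → ∨⁺ʳ {(R ∖ (R' ∖ S)) v} (∨⁺ʳ {T v} t)) ]′ (∨⁻ {S v} x)) ]′ (∨⁻ {((R ∖ R') ∪ T) v} z)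
              from' : (R ∖ (R' ∖ S)) ∪ (T ∪ T') ⊆ ((R ∖ R') ∪ T) ∪ (S ∪ T')
              from' v z = [ (λ x → [ (λ a → ∨⁺ˡ (∨⁺ˡ a)) , (λ s → ∨⁺ʳ {((R ∖ R') ∪ T) v} (∨⁺ˡ s)) ]′ (∨⁻ {(R ∖ R') v} (⊆split v x))) ,
                (λ x → [ (λ t → ∨⁺ˡ (∨⁺ʳ {(R ∖ R') v} t)) , (λ t → ∨⁺ʳ {((R ∖ R') ∪ T) v} (∨⁺ʳ {S v} t)) ]′ (∨⁻ {T v} x)) ]′ (∨⁻ {(R ∖ (R' ∖ S)) v} z)
            hard' : ∀ w → w ∈ R' ∖ S → toℕ (key (layer K) w) < suc p → ¬ Absorbable K (key (layer K) w)
            hard' w w∈ lt ab = pick-side (toℕ (key (layer K) w) <? p)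
              where
              pick-side : Dec (toℕ (key (layer K) w) < p) → ⊥
              pick-side (yes lt') = hard w (∖ˡ R' S w∈) lt' ab
              pick-side (no nlt) = true≢false (∧⁺ (∖ˡ R' S w∈) (dec⁺ (_ Fin.≟ _) (same w lt nlt))) (∖ʳ R' S w∈)
      go : Dec (Absorbable K q) → Dec (0 < # S) → Absorbed (suc p)
      go (no na) _ = keep (λ _ _ _ → na)
      go (yes ab) (no none) = keep (λ w w∈ k≡ _ → none (∈⇒0<# S {w} (∧⁺ w∈ (dec⁺ (_ Fin.≟ _) k≡))))
      go (yes ab) (yes 0<S) = take ab 0<S

    absorb-upto : ∀ p → p ≤ r ^ j → Absorbed p
    absorb-upto zero _ = record
      { R' = R ; T = ∅ ; R'⊆R = λ _ p → p ; T-in = λ _ () ; T-size = ≤-trans (≤-reflexive (#-empty ∅ (λ _ → refl))) z≤n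
      ; done = 0 , z≤n , cover-∅ (λ v → ¬true⇒false λ z → [ (λ a → true≢false (∖ˡ R R a) (∖ʳ R R a)) , (λ ()) ]′ (∨⁻ {(R ∖ R) v} z))
      ; hard = λ _ _ () }
    absorb-upto (suc p) le = absorb-next p le (absorb-upto p (≤-trans (n≤1+n p) le))

    absorb-all : Absorbed (r ^ j)
    absorb-all = absorb-upto (r ^ j) ≤-refl

-- The recursion on the number of layers

module Conclusion {r n : ℕ} (P : Setting r n) where
  open MainInduction P public

  -- A leftover of at most `n₁` vertices is covered by singletons. `X₀` bounds the ratio of a
  -- leftover to the new layer made from it, and `Θ₂` makes the next leftover so small that all
  -- layers outweigh it by `cap`. `Bstep` counts the tiles of one round: types, singletons, greedy
  -- tiles, padding and absorber.
  X₀ Θ₂ n₁ Bstep : ℕ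
  X₀ = r ^ N * Θ₁ * loss N E₀
  Θ₂ = κ * (cap * X₀)
  n₁ = r ^ N * Θ₁
  Bstep = r ^ N + n₁ + (rate * Θ₂ + C₁) + 2

  0<Θ₁ : 0 < Θ₁
  0<Θ₁ = *-mono-≤ {1} {rate₂ * suc Δ} (*-mono-≤ {1} {rate₂} {1} {suc Δ} (s≤s z≤n) (s≤s z≤n)) (*-mono-≤ (*-mono-≤ {1} {2} (s≤s z≤n) 0<hf) (s≤s z≤n))

  0<r^N : 0 < r ^ N
  0<r^N = m^n>0 r ⦃ >-nonZero 0<r ⦄ N

  0<n₁ : 0 < n₁
  0<n₁ = *-mono-≤ 0<r^N 0<Θ₁

  0<X₀ : 0 < X₀
  0<X₀ = *-mono-≤ 0<n₁ (0<loss N)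

  0<cap : 0 < cap
  0<cap = *-mono-≤ 0<2LQ (s≤s z≤n)

  NoClique : ∀ {j e} → Chain j e → Set
  NoClique K = ∀ γ → ¬ Mono (pair K) γ (suc (suc Δ)) full

  -- `T` are the layer vertices that the cover borrows. The absorbers from which the layers come
  -- must do without them, so their number is bounded in terms of `R`.
  Solved : ∀ {j} → (Fin j → Sub n) → Sub n → ℕ → Set
  Solved Y R f = ∃ λ T → (∀ v → v ∈ T → ∃ λ i → v ∈ Y i) × # T ≤ Q * f * # R × Cover≤ (R ∪ T) (f * Bstep)

  -- Here ρ is the number of vertices that could not be absorbed, ρ' how many of them the greedy covering leaves,
  -- t the capacity of the new absorber and y the size of the new layer.
  new-layer-big : ∀ ρ' ρ y₀ t y → Θ₂ * ρ' ≤ ρ → ρ ≤ n₁ * t → t ≤ y₀ → y₀ ≤ loss N E₀ * y → cap * ρ' ≤ y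
  new-layer-big ρ' ρ y₀ t y g₁ g₂ g₃ g₄ = *-cancelˡ-≤ X₀ ⦃ >-nonZero 0<X₀ ⦄ (begin
    X₀ * (cap * ρ')              ≤⟨ m≤n*m (X₀ * (cap * ρ')) κ ⦃ >-nonZero 0<κ ⦄ ⟩
    κ * (X₀ * (cap * ρ'))        ≡⟨ a₁ κ X₀ cap ρ' ⟩
    Θ₂ * ρ'                      ≤⟨ g₁ ⟩
    ρ                            ≤⟨ g₂ ⟩
    n₁ * t                       ≤⟨ *-monoʳ-≤ n₁ (≤-trans g₃ g₄) ⟩
    n₁ * (loss N E₀ * y)         ≡⟨ sym (*-assoc n₁ (loss N E₀) y) ⟩
    X₀ * y                       ∎)
    where
    open ≤-Reasoning
    a₁ : ∀ a b c d → a * (b * (c * d)) ≡ a * (c * b) * d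
    a₁ = solve-∀

  old-layer-big : ∀ ρ' ρ R y y' → Θ₂ * ρ' ≤ ρ → ρ ≤ R → cap * R ≤ y → y ≤ κ * y' → cap * ρ' ≤ y'
  old-layer-big ρ' ρ R y y' g₁ g₂ g₃ g₄ = *-cancelˡ-≤ κ ⦃ >-nonZero 0<κ ⦄ (begin
    κ * (cap * ρ')                 ≡⟨ a₁ κ cap ρ' ⟩
    cap * (κ * ρ')                 ≤⟨ *-monoʳ-≤ cap (m≤n*m (κ * ρ') (cap * X₀) ⦃ >-nonZero (*-mono-≤ 0<cap 0<X₀) ⦄) ⟩
    cap * (cap * X₀ * (κ * ρ'))    ≡⟨ cong (cap *_) (a₂ (cap * X₀) κ ρ') ⟩
    cap * (Θ₂ * ρ')                ≤⟨ *-monoʳ-≤ cap (≤-trans g₁ g₂) ⟩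
    cap * R                        ≤⟨ g₃ ⟩
    y                              ≤⟨ g₄ ⟩
    κ * y'                         ∎)
    where
    open ≤-Reasoning
    a₁ : ∀ a b c → a * (b * c) ≡ b * (a * c)
    a₁ = solve-∀
    a₂ : ∀ a b c → a * (b * c) ≡ b * a * c
    a₂ = solve-∀

  -- The capacity `t` of the new absorber suffices for everything that all later rounds borrow.
  used-small : ∀ f ρ' ρ t u → f ≤ N → u ≤ Q * f * ρ' → Θ₂ * ρ' ≤ ρ → ρ ≤ n₁ * t → u ≤ t
  used-small f ρ' ρ t u f≤N g₀ g₁ g₂ = *-cancelˡ-≤ n₁ ⦃ >-nonZero 0<n₁ ⦄ (begin
    n₁ * u                             ≤⟨ *-monoʳ-≤ n₁ (≤-trans g₀ (*-monoˡ-≤ ρ' Qf≤cap)) ⟩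
    n₁ * (cap * ρ')                    ≤⟨ m≤n*m (n₁ * (cap * ρ')) (κ * loss N E₀) ⦃ >-nonZero (*-mono-≤ 0<κ (0<loss N)) ⦄ ⟩
    κ * loss N E₀ * (n₁ * (cap * ρ'))  ≡⟨ a₁ κ (loss N E₀) n₁ cap ρ' ⟩
    Θ₂ * ρ'                            ≤⟨ g₁ ⟩
    ρ                                  ≤⟨ g₂ ⟩
    n₁ * t                             ∎)
    where
    open ≤-Reasoning
    a₁ : ∀ a b c d e → a * b * (c * (d * e)) ≡ a * (d * (c * b)) * e
    a₁ = solve-∀
    Qf≤cap : Q * f ≤ cap
    Qf≤cap = *-mono-≤ (m≤n*m Q (2 * L) ⦃ >-nonZero (*-mono-≤ {1} {2} (s≤s z≤n) 0<L) ⦄) (≤-trans f≤N (≤-trans (n≤1+n N) (n≤1+n (suc N))))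

  module Step (f j : ℕ) (jf : j + suc f ≡ N) (K : Chain j (level (suc f))) (nc : NoClique K)
    (R : Sub n) (R-apart : ∀ w i → w ∈ R → w ∉ layer K i) (big : ∀ i → cap * # R ≤ # (layer K i))
    (IH : ∀ (K' : Chain (suc j) (level f)) → NoClique K' → ∀ R₂ → (∀ w i → w ∈ R₂ → w ∉ layer K' i) →
          (∀ i → cap * # R₂ ≤ # (layer K' i)) → Solved (layer K') R₂ f) where

    open ≤-Reasoning

    j≤N : j ≤ N
    j≤N = ≤-trans (m≤m+n j (suc f)) (≤-reflexive jf)

    f≤N : f ≤ N
    f≤N = ≤-trans (n≤1+n f) (≤-trans (m≤n+m (suc f) j) (≤-reflexive jf))

    module _ (Ab : Absorbed K (level-mono {0} {suc f} z≤n) R R-apart big (r ^ j)) where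
      open Absorbed Ab

      T-R : ∀ v → v ∈ T → v ∉ R
      T-R = T-apart K (level-mono {0} {suc f} z≤n) R R-apart big Ab

      T≤ : # T ≤ Q * # R
      T≤ = ≤-trans T-size (*-monoʳ-≤ Q (#-mono {P = R ∖ R'} (λ v → ∖ˡ R R')))

      finish-small : # R' ≤ n₁ → Solved (layer K) R (suc f)
      finish-small le = T , T-in , ≤-trans T≤ (*-monoˡ-≤ (# R) (m≤m*n Q (suc f))) ,
        weaken (begin
            r ^ j + n₁                                    ≤⟨ +-monoˡ-≤ n₁ (r^≤ j≤N) ⟩
            r ^ N + n₁                                    ≤⟨ ≤-trans (m≤m+n (r ^ N + n₁) (rate * Θ₂ + C₁)) (m≤m+n _ 2) ⟩
            Bstep                                         ≤⟨ m≤m+n Bstep (f * Bstep) ⟩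
            suc f * Bstep                                 ∎)
          (cover≤-ext to from (cover≤-∪ dj done (weaken le (cover-singletons c₀ R'))))
        where
        dj : ∀ v → v ∈ (R ∖ R') ∪ T → v ∉ R'
        dj v z = ¬true⇒false λ p → [ (λ a → true≢false p (∖ʳ R R' a)) , (λ t → true≢false (R'⊆R v p) (T-R v t)) ]′ (∨⁻ {(R ∖ R') v} z)
        to : (R ∖ R') ∪ T ∪ R' ⊆ R ∪ T
        to v z = [ (λ x → [ (λ a → ∨⁺ˡ (∖ˡ R R' a)) , (λ t → ∨⁺ʳ {R v} t) ]′ (∨⁻ {(R ∖ R') v} x)) , (λ p → ∨⁺ˡ (R'⊆R v p)) ]′ (∨⁻ {((R ∖ R') ∪ T) v} z)
        from : R ∪ T ⊆ (R ∖ R') ∪ T ∪ R'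
        from v z = [ (λ p → [ (λ p' → ∨⁺ʳ {((R ∖ R') ∪ T) v} p') , (λ np → ∨⁺ˡ (∨⁺ˡ (∖⁺ R R' p np))) ]′ (bool (R' v))) ,
          (λ t → ∨⁺ˡ (∨⁺ʳ {(R ∖ R') v} t)) ]′ (∨⁻ {R v} z)

      module _ (n₁≤ : n₁ ≤ # R') (q : Fin (r ^ j)) (pop : # R' ≤ r ^ j * # (λ w → R' w ∧ [ key (layer K) w ≐ q ])) where

        W : Sub n
        W w = R' w ∧ [ key (layer K) w ≐ q ]

        Θ₁≤W : Θ₁ ≤ # W
        Θ₁≤W = *-cancelˡ-≤ (r ^ N) ⦃ >-nonZero 0<r^N ⦄ (≤-trans n₁≤ (≤-trans pop (*-monoˡ-≤ (# W) (r^≤ j≤N))))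

        -- Borrowed vertices leave the layers before the recursion sees them, so none is used twice.
        Y₁ : Fin j → Sub n
        Y₁ i = layer K i ∖ T

        half : ∀ i → # (layer K i) ≤ 2 * # (Y₁ i)
        half i = +-cancelʳ-≤ (# (layer K i)) _ _ (begin
          # (layer K i) + # (layer K i)                ≤⟨ +-mono-≤ (#-∖ (layer K i) T) (#-∖ (layer K i) T) ⟩
          (# (Y₁ i) + # T) + (# (Y₁ i) + # T)          ≡⟨ a₁ (# (Y₁ i)) (# T) ⟩
          2 * # (Y₁ i) + 2 * 1 * # T                   ≤⟨ +-monoʳ-≤ (2 * # (Y₁ i)) (small-T 1 (# R) (# T) (# (layer K i)) 0<L T≤ (big i)) ⟩
          2 * # (Y₁ i) + # (layer K i)                 ∎)
          where
          a₁ : ∀ a b → (a + b) + (a + b) ≡ 2 * a + 2 * 1 * b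
          a₁ = solve-∀

        0<R : 0 < # R
        0<R = ≤-trans 0<n₁ (≤-trans n₁≤ (#-mono R'⊆R))

        pos : ∀ i → 0 < # (Y₁ i)
        pos i = n≢0⇒n>0 λ z → <⇒≱ (*-mono-≤ 0<cap 0<R) (≤-trans (big i) (≤-trans (half i) (≤-reflexive (cong (2 *_) z))))

        rich : ∀ a i → a ∈ W → # (Y₁ i) ≤ D₀ * # (N[ finToFun q i ] a ∩ Y₁ i)
        rich a i a∈ = ≤-trans (#-mono {P = Y₁ i} {layer K i} (λ v → ∖ˡ (layer K i) T)) (≤-trans main' (*-monoˡ-≤ _ 2r≤D₀))
          where
          Nb : Sub n
          Nb = N[ finToFun q i ] a
          y = # (layer K i)
          maj : y ≤ r * # (Nb ∩ layer K i)
          maj = key-majority (layer K) a q (≐⁻ (∧ʳ {R' a} a∈)) i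
          a₁ : ∀ a b → a * b + a * b ≡ 2 * a * b
          a₁ = solve-∀
          incl : Nb ∩ layer K i ∖ T ⊆ Nb ∩ Y₁ i
          incl v p = ∧⁺ {Nb v} (∧ˡ (∖ˡ (Nb ∩ layer K i) T p)) (∖⁺ (layer K i) T (∧ʳ {Nb v} (∖ˡ (Nb ∩ layer K i) T p)) (∖ʳ (Nb ∩ layer K i) T p))
          main' : y ≤ 2 * r * # (Nb ∩ Y₁ i)
          main' = +-cancelʳ-≤ y _ _ (begin
            y + y                                            ≤⟨ +-mono-≤ maj maj ⟩
            r * # (Nb ∩ layer K i) + r * # (Nb ∩ layer K i)  ≡⟨ a₁ r (# (Nb ∩ layer K i)) ⟩
            2 * r * # (Nb ∩ layer K i)                       ≤⟨ *-monoʳ-≤ (2 * r) (≤-trans (#-∖ (Nb ∩ layer K i) T) (+-monoˡ-≤ (# T) (#-mono incl))) ⟩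
            2 * r * (# (Nb ∩ Y₁ i) + # T)                    ≡⟨ *-distribˡ-+ (2 * r) (# (Nb ∩ Y₁ i)) (# T) ⟩
            2 * r * # (Nb ∩ Y₁ i) + 2 * r * # T              ≤⟨ +-monoʳ-≤ (2 * r * # (Nb ∩ Y₁ i)) (small-T r (# R) (# T) y r≤L T≤ (big i)) ⟩
            2 * r * # (Nb ∩ Y₁ i) + y                        ∎)

        not-absorbable : ¬ Absorbable K q
        not-absorbable ab = contra (0<#⇒∈ W (≤-trans 0<Θ₁ Θ₁≤W))
          where
          contra : (∃ λ w → w ∈ W) → ⊥
          contra (w , p) = hard w (∧ˡ p) (Fin.toℕ<n _) (subst (Absorbable K) (sym (≐⁻ (∧ʳ {R' w} p))) ab)

        module _ (A : Absorber W) (W≤t : # W ≤ Θ₁ * Absorber.t A) where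
          open Absorber A renaming (Y to Y₀)

          R'≤t : # R' ≤ n₁ * t
          R'≤t = begin
            # R'                     ≤⟨ pop ⟩
            r ^ j * # W              ≤⟨ *-mono-≤ (r^≤ j≤N) W≤t ⟩
            r ^ N * (Θ₁ * t)         ≡⟨ sym (*-assoc (r ^ N) Θ₁ t) ⟩
            n₁ * t                   ∎

          t<Y₀ : t < # Y₀
          t<Y₀ = ≤-<-trans (m≤n+m t (C₁ * t)) t-room

          Z⊆R' : Z ⊆ R'
          Z⊆R' v p = ∧ˡ (Z⊆W v p)

          Extended : Set
          Extended = ∃ λ A' → ∃ λ (Y' : Fin j → Sub n) → A' ⊆ Y₀ × (∀ i → Y' i ⊆ Y₁ i) × (∀ i → # (layer K i) ≤ κ * # (Y' i)) ×
             # Y₀ ≤ loss j E₀ * # A' ×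
             (∃ λ (K' : Chain (suc j) (level f)) → layer K' ≡ A' ◂ Y' × pair K' ≡ extend-γ c₀ (finToFun q) (pair K))

          extended : Extended
          extended = extend E₀ K (level-mono f≤N) 0<E₀ Y₁ (λ i v → ∖ˡ (layer K i) T) half pos Y₀ (finToFun q) (≤-<-trans z≤n t<Y₀)
            (λ a i p → rich a i (Z⊆W a (Y⊆Z a p)))

          after-extension : Extended → (∃ λ S → S ⊆ R' ∖ Z × Cover≤ S (rate * Θ₂ + C₁) × Θ₂ * # (R' ∖ Z ∖ S) ≤ # (R' ∖ Z)) → Solved (layer K) R (suc f)
          after-extension (A' , Y' , sA , sY , lY , lA , K' , eqL , eqP) (S , S⊆ , cS , left) =
            after-recursion (IH K' nc' R₂ apart' big')
            where
            R₂ : Sub n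
            R₂ = R' ∖ Z ∖ S
            left' : Θ₂ * # R₂ ≤ # R'
            left' = ≤-trans left (#-mono {P = R' ∖ Z} (λ v → ∖ˡ R' Z))
            nc' : NoClique K'
            nc' γ mo = [ (λ m → not-absorbable (γ , m)) , nc γ ]′ (Mono-extend c₀ (finToFun q) (pair K) γ (suc Δ)
                         (subst (λ p → Mono p γ (suc (suc Δ)) full) eqP mo))
            apart' : ∀ w i → w ∈ R₂ → w ∉ layer K' i
            apart' w i p = subst (λ Y → w ∉ Y i) (sym eqL) (lem i)
              where
              lem : ∀ i → w ∉ (A' ◂ Y') i
              lem zero = ¬true⇒false λ a → true≢false (Y⊆Z w (sA w a)) (∖ʳ R' Z (∖ˡ (R' ∖ Z) S p))
              lem (suc i) = ¬true⇒false λ a → true≢false (∖ˡ (layer K i) T (sY i w a)) (R-apart w i (R'⊆R w (∖ˡ R' Z (∖ˡ (R' ∖ Z) S p))))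
            big' : ∀ i → cap * # R₂ ≤ # (layer K' i)
            big' i = subst (λ Y → cap * # R₂ ≤ # (Y i)) (sym eqL) (lem i)
              where
              lem : ∀ i → cap * # R₂ ≤ # ((A' ◂ Y') i)
              lem zero = new-layer-big (# R₂) (# R') (# Y₀) t (# A') left' R'≤t (<⇒≤ t<Y₀) (≤-trans lA (*-monoˡ-≤ (# A') (loss≤ j≤N)))
              lem (suc i) = old-layer-big (# R₂) (# R') (# R) (# (layer K i)) (# (Y' i)) left' (#-mono R'⊆R) (big i) (lY i)
            after-recursion : Solved (layer K') R₂ f → Solved (layer K) R (suc f)
            after-recursion (T₂ , T₂-in , T₂-size , cov) = after-padding (copy-of-size (Y₀ ∖ TY) (t ∸ # TY) room)
              where
              TY : Sub n
              TY = T₂ ∩ Y₀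
              where-T₂ : ∀ v → v ∈ T₂ → v ∈ Y₀ ⊎ (v ∉ R × ∃ λ i → v ∈ Y₁ i)
              where-T₂ v p = lem (proj₁ (T₂-in v p)) (subst (λ Y → v ∈ Y (proj₁ (T₂-in v p))) eqL (proj₂ (T₂-in v p)))
                where
                lem : ∀ i → v ∈ (A' ◂ Y') i → v ∈ Y₀ ⊎ (v ∉ R × ∃ λ i → v ∈ Y₁ i)
                lem zero a = inj₁ (sA v a)
                lem (suc i) a = inj₂ ((¬true⇒false λ x → true≢false (∖ˡ (layer K i) T (sY i v a)) (R-apart v i x)) , i , sY i v a)
              T₂≤t : # T₂ ≤ t
              T₂≤t = used-small f (# R₂) (# R') t (# T₂) f≤N T₂-size left' R'≤t
              TY≤t : # TY ≤ t
              TY≤t = ≤-trans (#-mono {P = TY} (λ v → ∧ˡ)) T₂≤t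
              room : C₁ * (t ∸ # TY) < # (Y₀ ∖ TY)
              room = +-cancelʳ-< t _ _ (begin-strict
                C₁ * (t ∸ # TY) + t      ≤⟨ +-monoˡ-≤ t (*-monoʳ-≤ C₁ (m∸n≤m t (# TY))) ⟩
                C₁ * t + t               <⟨ t-room ⟩
                # Y₀                     ≤⟨ #-∖ Y₀ TY ⟩
                # (Y₀ ∖ TY) + # TY       ≤⟨ +-monoʳ-≤ (# (Y₀ ∖ TY)) TY≤t ⟩
                # (Y₀ ∖ TY) + t          ∎)
              after-padding : (∃ λ Sp → Sp ⊆ Y₀ ∖ TY × # Sp ≡ t ∸ # TY × Cover≤ Sp 1) → Solved (layer K) R (suc f)
              -- The part of `T₂` in `Y₀` is settled by the absorber of this round; the rest lies in
              -- older layers and is reported to the rounds that made them.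
              after-padding (Sp , Sp⊆ , cSp , covSp) = T ∪ (T₂ ∖ Y₀) , out-in , out-size , weaken count
                  (combine R R' T Z Y₀ S T₂ Sp R'⊆R T-R Z⊆R' Y⊆Z S⊆ T₂-class Sp⊆ done cS cov covSp (absorb (TY ∪ Sp) Tf⊆ #Tf))
                where
                T₂-class : ∀ v → v ∈ T₂ → v ∈ Y₀ ⊎ (v ∉ R × v ∉ T)
                T₂-class v p = [ inj₁ , (λ { (nr , i , y) → inj₂ (nr , ∖ʳ (layer K i) T y) }) ]′ (where-T₂ v p)
                Tf⊆ : TY ∪ Sp ⊆ Y₀
                Tf⊆ v z = [ (λ a → ∧ʳ {T₂ v} a) , (λ s → ∖ˡ Y₀ TY (Sp⊆ v s)) ]′ (∨⁻ {TY v} z)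
                #Tf : # (TY ∪ Sp) ≡ t
                #Tf = trans (#-∪-disjoint TY Sp (λ v a → ¬true⇒false λ s → true≢false a (∖ʳ Y₀ TY (Sp⊆ v s)))) (trans (cong (# TY +_) cSp) (m+[n∸m]≡n TY≤t))
                out-in : ∀ v → v ∈ T ∪ (T₂ ∖ Y₀) → ∃ λ i → v ∈ layer K i
                out-in v z = [ T-in v , (λ a → [ (λ y → ⊥-elim (true≢false y (∖ʳ T₂ Y₀ a))) , (λ { (_ , i , y) → i , ∖ˡ (layer K i) T y }) ]′ (where-T₂ v (∖ˡ T₂ Y₀ a))) ]′ (∨⁻ {T v} z)
                out-size : # (T ∪ (T₂ ∖ Y₀)) ≤ Q * suc f * # R
                out-size = begin
                  # (T ∪ (T₂ ∖ Y₀))            ≤⟨ #-∪ T (T₂ ∖ Y₀) ⟩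
                  # T + # (T₂ ∖ Y₀)            ≤⟨ +-mono-≤ T≤ (≤-trans (#-mono {P = T₂ ∖ Y₀} (λ v → ∖ˡ T₂ Y₀)) T₂-size) ⟩
                  Q * # R + Q * f * # R₂       ≤⟨ +-monoʳ-≤ (Q * # R) (*-monoʳ-≤ (Q * f) (#-mono {P = R₂} (λ v p → R'⊆R v (∖ˡ R' Z (∖ˡ (R' ∖ Z) S p))))) ⟩
                  Q * # R + Q * f * # R        ≡⟨ a₁ Q f (# R) ⟩
                  Q * suc f * # R              ∎
                  where
                  a₁ : ∀ q f x → q * x + q * f * x ≡ q * suc f * x
                  a₁ = solve-∀
                count : r ^ j + (rate * Θ₂ + C₁) + f * Bstep + 1 + 1 ≤ suc f * Bstep
                count = begin
                  r ^ j + (rate * Θ₂ + C₁) + f * Bstep + 1 + 1       ≡⟨ a₁ (r ^ j) (rate * Θ₂ + C₁) (f * Bstep) ⟩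
                  r ^ j + 0 + (rate * Θ₂ + C₁) + 2 + f * Bstep       ≤⟨ +-monoˡ-≤ (f * Bstep) (+-monoˡ-≤ 2 (+-monoˡ-≤ (rate * Θ₂ + C₁) (+-mono-≤ (r^≤ j≤N) (z≤n {n₁})))) ⟩
                  Bstep + f * Bstep                                  ∎
                  where
                  a₁ : ∀ a b c → a + b + c + 1 + 1 ≡ a + 0 + b + 2 + c
                  a₁ = solve-∀

          solve-large : Solved (layer K) R (suc f)
          solve-large = after-extension extended (greedy-cover Θ₂ (R' ∖ Z))

        with-absorber : AbsorberFor W → Solved (layer K) R (suc f)
        with-absorber (A , W≤t) = solve-large A W≤t

      solve' : Solved (layer K) R (suc f)
      solve' = go (# R' ≤? n₁)
        where
        go : Dec (# R' ≤ n₁) → Solved (layer K) R (suc f)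
        go (yes le) = finish-small le
        go (no nle) = choose-type (popular-key (layer K) R' (≤-trans 0<n₁ (<⇒≤ (≰⇒> nle))))
          where
          choose-type : (∃ λ q → # R' ≤ r ^ j * # (λ w → R' w ∧ [ key (layer K) w ≐ q ])) → Solved (layer K) R (suc f)
          choose-type (q , pop) = with-absorber (<⇒≤ (≰⇒> nle)) q pop (absorber _ (Θ₁≤W (<⇒≤ (≰⇒> nle)) q pop))

    solved : Solved (layer K) R (suc f)
    solved = solve' (absorb-all K (level-mono {0} {suc f} z≤n) R R-apart big)

  -- Layers and remaining rounds add up to `N`. With no round left there are `N` layers, and
  -- Ramsey's theorem contradicts `NoClique`; so the recursion always ends earlier, with a leftover
  -- of at most `n₁` vertices.
  main : ∀ f j → j + f ≡ N → (K : Chain j (level f)) → NoClique K → ∀ R → (∀ w i → w ∈ R → w ∉ layer K i) →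
         (∀ i → cap * # R ≤ # (layer K i)) → Solved (layer K) R f
  main zero j jf K nc R ap bg = ⊥-elim (contra (ramsey (pair K) c₀ (r * suc (suc Δ)) (λ _ → suc (suc Δ)) (≤-reflexive (∑-const r _)) full
      (≤-trans N-big (≤-reflexive (trans (sym jf) (trans (+-identityʳ j) (sym (#-full j))))))))
    where
    contra : (∃ λ γ → Mono (pair K) γ (suc (suc Δ)) full) → ⊥
    contra (γ , mo) = nc γ mo
  main (suc f) j jf K nc R ap bg = Step.solved f j jf K nc R ap bg (main f (suc j) (trans (sym (+-suc j f)) jf))

  tiling-bound : ∃ λ t → t ≤ N * Bstep × MonoTiling r n F c t
  tiling-bound = finish (main N 0 refl (record { layer = λ () ; pair = λ () ; dense = λ () }) (λ γ → λ { (() , _) }) full (λ _ ()) (λ ()))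
    where
    finish : Solved {0} (λ ()) full N → ∃ λ t → t ≤ N * Bstep × MonoTiling r n F c t
    finish (T , _ , _ , t , le , cov) = t , le , cover⇒tiling (cover-ext {S = full ∪ T} (λ _ _ → refl) (λ _ _ → refl) cov)

-- The number of tiles

n<2^n : ∀ n → n < 2 ^ n
n<2^n zero = s≤s z≤n
n<2^n (suc n) = begin-strict
  suc n            <⟨ s≤s (n<2^n n) ⟩
  1 + 2 ^ n        ≤⟨ +-mono-≤ (m^n>0 2 n) (m≤m+n (2 ^ n) 0) ⟩
  2 * 2 ^ n        ∎
  where open ≤-Reasoning

module Numerics {r n : ℕ} (P : Setting r n) (2D₀≤N : 2 * Setting.D₀ P ≤ Setting.N P) (κ≤N : Conclusion.κ P ≤ Setting.N P)
  (L≤N : Conclusion.L P ≤ Setting.N P) (E≤N³ : Setting.E P ≤ Setting.N P ^ 3) (Δ<N : suc (Setting.Δ P) ≤ Setting.N P)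
  (r≤N : r ≤ Setting.N P) (1024≤N : 1024 ≤ Setting.N P) where
  open Conclusion P
  open ≤-Reasoning

  x : ℕ
  x = N ^ 5

  -- At this scale a sum or a product raises the second exponent by only one, so `i` merely counts
  -- nested operations.
  Bd : ℕ → ℕ → Set
  Bd i a = a ≤ 2 ^ (2 ^ (x + i))

  private instance
    N≢0 : NonZero N
    N≢0 = >-nonZero (≤-trans (s≤s z≤n) 1024≤N)

  2^-mono : ∀ {a b} → a ≤ b → 2 ^ a ≤ 2 ^ b
  2^-mono = ^-monoʳ-≤ 2

  up : ∀ {i a} j → i ≤ j → Bd i a → Bd j a
  up j le b = ≤-trans b (2^-mono (2^-mono (+-monoʳ-≤ x le)))

  double : ∀ k → 2 ^ (2 ^ (x + k)) * 2 ^ (2 ^ (x + k)) ≡ 2 ^ (2 ^ (x + suc k))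
  double k = trans (sym (^-distribˡ-+-* 2 (2 ^ (x + k)) (2 ^ (x + k))))
    (cong (2 ^_) (trans (cong (2 ^ (x + k) +_) (sym (+-identityʳ _))) (cong (2 ^_) (sym (+-suc x k)))))

  mul : ∀ {i j a b} → Bd i a → Bd j b → Bd (suc (i ⊔ j)) (a * b)
  mul {i} {j} {a} {b} p q = ≤-trans (*-mono-≤ (up {i} {a} (i ⊔ j) (m≤m⊔n i j) p) (up {j} {b} (i ⊔ j) (m≤n⊔m i j) q)) (≤-reflexive (double (i ⊔ j)))

  0<2^2^ : ∀ k → 2 ≤ 2 ^ (2 ^ k)
  0<2^2^ k = ≤-trans (≤-reflexive (sym (^-identityʳ 2))) (2^-mono (m^n>0 2 k))

  add : ∀ {i j a b} → Bd i a → Bd j b → Bd (suc (i ⊔ j)) (a + b)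
  add {i} {j} {a} {b} p q = begin
    a + b          ≤⟨ +-mono-≤ (up {i} {a} k (m≤m⊔n i j) p) (up {j} {b} k (m≤n⊔m i j) q) ⟩
    X + X          ≡⟨ cong (X +_) (sym (+-identityʳ X)) ⟩
    2 * X          ≤⟨ *-monoˡ-≤ X (0<2^2^ (x + k)) ⟩
    X * X          ≡⟨ double k ⟩
    2 ^ (2 ^ (x + suc k)) ∎
    where
    k = i ⊔ j
    X = 2 ^ (2 ^ (x + k))

  base : ∀ {a} y → a ≤ 2 ^ (2 ^ y) → y ≤ x → Bd 0 a
  base y le yx = ≤-trans le (2^-mono (2^-mono (≤-trans yx (m≤m+n x 0))))

  pow≤x : ∀ k → k ≤ 5 → N ^ k ≤ x
  pow≤x k le = ^-monoʳ-≤ N le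

  small : ∀ {a} → a ≤ N → Bd 0 a
  small {a} le = base N (≤-trans le (≤-trans (<⇒≤ (n<2^n N)) (2^-mono (<⇒≤ (n<2^n N)))))
    (≤-trans (≤-reflexive (sym (^-identityʳ N))) (pow≤x 1 (s≤s z≤n)))

  lit : ∀ {a} → a ≤ 1024 → a ≤ N
  lit le = ≤-trans le 1024≤N

  4≤N : 4 ≤ N
  4≤N = lit (m≤m+n 4 1020)

  N≤2^N : N ≤ 2 ^ N
  N≤2^N = <⇒≤ (n<2^n N)

  power≤ : ∀ a b y z → a ≤ 2 ^ y → y ≤ 2 ^ y → b ≤ 2 ^ z → a ^ b ≤ 2 ^ (2 ^ (y + z))
  power≤ a b y z la ly lb = begin
    a ^ b                  ≤⟨ ^-monoˡ-≤ b la ⟩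
    (2 ^ y) ^ b            ≡⟨ ^-*-assoc 2 y b ⟩
    2 ^ (y * b)            ≤⟨ 2^-mono (*-mono-≤ ly lb) ⟩
    2 ^ (2 ^ y * 2 ^ z)    ≡⟨ cong (2 ^_) (sym (^-distribˡ-+-* 2 y z)) ⟩
    2 ^ (2 ^ (y + z))      ∎

  powBd : ∀ a b y z → a ≤ 2 ^ y → b ≤ 2 ^ z → y + z ≤ x → Bd 0 (a ^ b)
  powBd a b y z la lb le = base (y + z) (power≤ a b y z la (<⇒≤ (n<2^n y)) lb) le

  multiple≤pow : ∀ c k → c ≤ N → c * N ^ k ≤ N ^ suc k
  multiple≤pow c k le = *-monoˡ-≤ (N ^ k) le

  2N≤x : N + N ≤ x
  2N≤x = begin
    N + N          ≡⟨ cong₂ _+_ (sym (^-identityʳ N)) (trans (sym (^-identityʳ N)) (sym (+-identityʳ _))) ⟩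
    2 * N ^ 1      ≤⟨ multiple≤pow 2 1 (lit (m≤m+n 2 1022)) ⟩
    N ^ 2          ≤⟨ pow≤x 2 (s≤s (s≤s z≤n)) ⟩
    x              ∎

  N-power : ∀ a → a ≤ N → Bd 0 (a ^ N)
  N-power a le = powBd a N N N (≤-trans le N≤2^N) N≤2^N 2N≤x

  level≡ : ∀ f → level f ≡ κ ^ f * E
  level≡ zero = sym (+-identityʳ E)
  level≡ (suc f) = trans (cong (κ *_) (level≡ f)) (sym (*-assoc κ (κ ^ f) E))

  E₀≤ : E₀ ≤ 2 ^ (N ^ 3)
  E₀≤ = begin
    E₀                   ≡⟨ level≡ N ⟩
    κ ^ N * E            ≤⟨ *-mono-≤ (^-monoˡ-≤ N κ≤N) E≤N³ ⟩
    N ^ N * N ^ 3        ≡⟨ sym (^-distribˡ-+-* N N 3) ⟩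
    N ^ (N + 3)          ≤⟨ ^-monoˡ-≤ (N + 3) N≤2^N ⟩
    (2 ^ N) ^ (N + 3)    ≡⟨ ^-*-assoc 2 N (N + 3) ⟩
    2 ^ (N * (N + 3))    ≤⟨ 2^-mono (*-monoʳ-≤ N N+3≤) ⟩
    2 ^ (N * N ^ 2)      ∎
    where
    N+3≤ : N + 3 ≤ N ^ 2
    N+3≤ = begin
      N + 3          ≤⟨ +-monoʳ-≤ N (≤-trans (m≤m+n 3 1) (≤-trans 4≤N (m≤m+n N _))) ⟩
      4 * N          ≤⟨ *-monoˡ-≤ N 4≤N ⟩
      N * N          ≡⟨ cong (N *_) (sym (*-identityʳ N)) ⟩
      N ^ 2          ∎

  exponent≤ : N * (2 * D₀ * E₀) ≤ 2 ^ (N ^ 4)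
  exponent≤ = begin
    N * (2 * D₀ * E₀)                    ≤⟨ *-mono-≤ N≤2^N (*-mono-≤ (≤-trans 2D₀≤N N≤2^N) E₀≤) ⟩
    2 ^ N * (2 ^ N * 2 ^ (N ^ 3))        ≡⟨ cong (2 ^ N *_) (sym (^-distribˡ-+-* 2 N (N ^ 3))) ⟩
    2 ^ N * 2 ^ (N + N ^ 3)              ≡⟨ sym (^-distribˡ-+-* 2 N (N + N ^ 3)) ⟩
    2 ^ (N + (N + N ^ 3))                ≤⟨ 2^-mono (+-mono-≤ N≤N³ (+-mono-≤ N≤N³ (m≤m+n (N ^ 3) 0))) ⟩
    2 ^ (3 * N ^ 3)                      ≤⟨ 2^-mono (multiple≤pow 3 3 (lit (m≤m+n 3 1021))) ⟩
    2 ^ (N ^ 4)                          ∎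
    where
    N≤N³ : N ≤ N ^ 3
    N≤N³ = ≤-trans (≤-reflexive (sym (^-identityʳ N))) (^-monoʳ-≤ N {1} {3} (s≤s z≤n))

  -- The dominant quantity, and the reason for `x = N ^ 5`: the base is at most `2 ^ (N ^ 3)` and
  -- the exponent at most `2 ^ (N ^ 4)`.
  bd-loss : Bd 0 (loss N E₀)
  bd-loss = powBd E₀ (N * (2 * D₀ * E₀)) (N ^ 3) (N ^ 4) E₀≤ exponent≤ (begin
    N ^ 3 + N ^ 4             ≤⟨ +-mono-≤ (^-monoʳ-≤ N {3} {4} (s≤s (s≤s (s≤s z≤n)))) (m≤m+n (N ^ 4) 0) ⟩
    2 * N ^ 4                 ≤⟨ multiple≤pow 2 4 (lit (m≤m+n 2 1022)) ⟩
    x                         ∎)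

  h'≤ : h' ≤ N ^ 2
  h'≤ = begin
    h'                 ≡⟨ trans h'≡ (cong (4 *_) (trans q'≡ (cong (2 *_) ℓ'≡))) ⟩
    4 * (2 * (2 * L))  ≡⟨ ar L ⟩
    16 * L             ≤⟨ *-mono-≤ (lit (m≤m+n 16 1008)) L≤N ⟩
    N * N              ≡⟨ cong (N *_) (sym (*-identityʳ N)) ⟩
    N ^ 2              ∎
    where
    ar : ∀ l → 4 * (2 * (2 * l)) ≡ 16 * l
    ar = solve-∀

  -- The number of density increments is polynomial in `N`, so the shrinking `hf` is only singly
  -- exponential.
  f'≤ : f' ≤ N ^ 8
  f'≤ = begin
    f'                                ≡⟨ f'≡ ⟩
    suc V' ∸ H'                       ≤⟨ m∸n≤m (suc V') H' ⟩
    suc V'                            ≡⟨ cong suc (trans V'≡ (cong₂ _*_ ℓ'≡ H'≡)) ⟩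
    suc (2 * L * (2 * (h' * h')))     ≤⟨ s≤s (*-mono-≤ (*-mono-≤ (lit (m≤m+n 2 1022)) L≤N) (*-mono-≤ (lit (m≤m+n 2 1022)) (*-mono-≤ h'≤ h'≤))) ⟩
    suc (N * N * (N * (N ^ 2 * N ^ 2)))  ≡⟨ cong suc (ar N) ⟩
    suc (N ^ 7)                       ≤⟨ +-mono-≤ (m^n>0 N 7) (m≤m+n (N ^ 7) 0) ⟩
    2 * N ^ 7                         ≤⟨ multiple≤pow 2 7 (lit (m≤m+n 2 1022)) ⟩
    N ^ 8                             ∎
    where
    ar : ∀ a → a * a * (a * (a * (a * 1) * (a * (a * 1)))) ≡ a * (a * (a * (a * (a * (a * (a * 1))))))
    ar = solve-∀

  pow-as-2 : ∀ k → N ^ k ≤ 2 ^ (N * k)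
  pow-as-2 k = ≤-trans (^-monoˡ-≤ k N≤2^N) (≤-reflexive (^-*-assoc 2 N k))

  bd-hf : Bd 0 hf
  bd-hf = powBd h' f' (N * 2) (N * 8) (≤-trans h'≤ (pow-as-2 2)) (≤-trans f'≤ (pow-as-2 8)) (begin
    N * 2 + N * 8          ≡⟨ ar N ⟩
    10 * N ^ 1             ≤⟨ multiple≤pow 10 1 (lit (m≤m+n 10 1014)) ⟩
    N ^ 2                  ≤⟨ pow≤x 2 (s≤s (s≤s z≤n)) ⟩
    x                      ∎)
    where
    ar : ∀ a → a * 2 + a * 8 ≡ 10 * (a * 1)
    ar = solve-∀

  s : ∀ k → k ≤ 1024 → Bd 0 k
  s k le = small (lit le)

  bd-r^N : Bd 0 (r ^ N)
  bd-r^N = N-power r r≤N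

  bd-L : Bd 0 L
  bd-L = small L≤N

  bd-N : Bd 0 N
  bd-N = small ≤-refl

  bd-Γ : Bd 2 Γ
  bd-Γ = mul {0} {1} (N-power κ κ≤N) (mul {0} {0} bd-r^N bd-loss)

  bd-C₁ : Bd 3 C₁
  bd-C₁ = mul {1} {2} (mul {0} {0} {2} (s 2 (m≤m+n 2 1022)) bd-L) bd-Γ

  bd-C₂ : Bd 3 C₂
  bd-C₂ = mul {1} {2} (mul {0} {0} {8} (s 8 (m≤m+n 8 1016)) bd-L) bd-Γ

  bd-rate : Bd 5 rate
  bd-rate = add {0} {4} {1} (s 1 (m≤m+n 1 1023)) (mul {0} {3} {2} (s 2 (m≤m+n 2 1022)) bd-C₁)

  bd-rate₂ : Bd 5 rate₂
  bd-rate₂ = add {0} {4} {1} (s 1 (m≤m+n 1 1023)) (mul {0} {3} {2} (s 2 (m≤m+n 2 1022)) bd-C₂)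

  bd-Θ₁ : Bd 7 Θ₁
  bd-Θ₁ = mul {6} {6} (mul {5} {0} bd-rate₂ (small Δ<N))
            (mul {1} {5} (mul {0} {0} {2} (s 2 (m≤m+n 2 1022)) bd-hf) (mul {0} {4} {2} (s 2 (m≤m+n 2 1022)) (add {0} {3} {1} (s 1 (m≤m+n 1 1023)) bd-C₁)))

  bd-Q : Bd 2 Q
  bd-Q = add {0} {1} {1} (s 1 (m≤m+n 1 1023)) (mul {0} {0} (small Δ<N) (small Δ<N))

  bd-cap : Bd 4 cap
  bd-cap = mul {3} {1} (mul {1} {2} (mul {0} {0} {2} (s 2 (m≤m+n 2 1022)) bd-L) bd-Q) (add {0} {0} {2} (s 2 (m≤m+n 2 1022)) bd-N)

  bd-n₁ : Bd 8 n₁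
  bd-n₁ = mul {0} {7} bd-r^N bd-Θ₁

  bd-Θ₂ : Bd 11 Θ₂
  bd-Θ₂ = mul {0} {10} (small κ≤N) (mul {4} {9} bd-cap (mul {8} {0} bd-n₁ bd-loss))

  bd-Bstep : Bd 15 Bstep
  bd-Bstep = add {14} {0} (add {9} {13} (add {0} {8} bd-r^N bd-n₁) (add {12} {3} (mul {5} {11} bd-rate bd-Θ₂) bd-C₁)) (s 2 (m≤m+n 2 1022))

  total : N * Bstep ≤ 2 ^ (2 ^ (N ^ 6))
  total = ≤-trans (mul {0} {15} bd-N bd-Bstep) (2^-mono (2^-mono (begin
    x + 16                 ≤⟨ +-monoʳ-≤ x (≤-trans (lit (m≤m+n 16 1008)) (≤-trans (≤-reflexive (sym (^-identityʳ N))) (≤-trans (pow≤x 1 (s≤s z≤n)) (m≤m+n x 0)))) ⟩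
    2 * N ^ 5              ≤⟨ multiple≤pow 2 5 (lit (m≤m+n 2 1022)) ⟩
    N ^ 6                  ∎)))

-- Choice of the parameters and the final bound

theorem1p2 : Σ ℕ λ K → 1 ≤ K ×
    ((r Δ : ℕ) → 2 ≤ r → 2 ≤ Δ → (F : GraphSeq) →
    (∀ i → MaxDegree≤ (F i) Δ) →
    TauBoundedBy r F (2 ^ (2 ^ (r ^ (K * r * Δ ^ 3)))))
-- The count is at most two exponentials of `N ^ 6` with `N = r ^ (2 * (r * (Δ + 2)))`. As
-- `Δ + 2 ≤ 2 * Δ`, the exponent of `r` is at most `6 * 2 * 2 * r * Δ`, and 24 is the product of
-- these numbers.
theorem1p2 = 24 , s≤s z≤n , λ r Δ 2≤r 2≤Δ F deg n c → bound r Δ 2≤r 2≤Δ F deg n c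
  where
  bound : (r Δ : ℕ) → 2 ≤ r → 2 ≤ Δ → (F : GraphSeq) → (∀ i → MaxDegree≤ (F i) Δ) → TauBoundedBy r F (2 ^ (2 ^ (r ^ (24 * r * Δ ^ 3))))
  bound r Δ 2≤r 2≤Δ F deg n c = conclude tiling-bound
    where
    open ≤-Reasoning
    instance
      r≢0 : NonZero r
      r≢0 = >-nonZero (≤-trans (s≤s z≤n) 2≤r)
    -- The factor 2 replaces the base `r + 1` of the Ramsey bound by `r`, since `suc r ≤ r ^ 2`.
    w N : ℕ
    w = 2 * (r * suc (suc Δ))
    N = r ^ w
    power : ∀ {a k} → a ≤ r ^ k → k ≤ w → a ≤ N
    power le kw = ≤-trans le (^-monoʳ-≤ r kw)
    four-Δ : 4 * suc (suc Δ) ≤ w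
    four-Δ = ≤-trans (≤-reflexive (*-assoc 2 2 (suc (suc Δ)))) (*-monoʳ-≤ 2 (*-monoˡ-≤ (suc (suc Δ)) 2≤r))
    16≤w : 16 ≤ w
    16≤w = ≤-trans (*-monoʳ-≤ 4 {4} (s≤s (s≤s 2≤Δ))) four-Δ
    2≤r^1 : 2 ≤ r ^ 1
    2≤r^1 = ≤-trans 2≤r (≤-reflexive (sym (^-identityʳ r)))
    4≤r^2 : 4 ≤ r ^ 2
    4≤r^2 = ^-monoˡ-≤ 2 2≤r
    4r≤ : 2 * (2 * r) ≤ r ^ 3
    4r≤ = ≤-trans (≤-reflexive (trans (sym (*-assoc 2 2 r)) (*-comm 4 r))) (*-monoʳ-≤ r 4≤r^2)
    8r≤ : 2 * (2 * (2 * r)) ≤ r ^ 4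
    8r≤ = *-mono-≤ 2≤r 4r≤
    L' E' : ℕ
    L' = 2 * r * (2 * (2 * r)) ^ Δ
    E' = 2 * L' * Δ
    L'≤N : L' ≤ N
    L'≤N = power {k = 2 + 3 * Δ} (begin
      2 * r * (2 * (2 * r)) ^ Δ     ≤⟨ *-mono-≤ (*-mono-≤ 2≤r (≤-reflexive (sym (*-identityʳ r)))) (^-monoˡ-≤ Δ 4r≤) ⟩
      r ^ 2 * (r ^ 3) ^ Δ           ≡⟨ cong (r ^ 2 *_) (^-*-assoc r 3 Δ) ⟩
      r ^ 2 * r ^ (3 * Δ)           ≡⟨ sym (^-distribˡ-+-* r 2 (3 * Δ)) ⟩
      r ^ (2 + 3 * Δ)               ∎) (begin
      2 + 3 * Δ                     ≤⟨ +-mono-≤ {2} {8} (s≤s (s≤s z≤n)) (*-monoˡ-≤ Δ {3} {4} (s≤s (s≤s (s≤s z≤n)))) ⟩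
      8 + 4 * Δ                     ≡⟨ ar Δ ⟩
      4 * suc (suc Δ)               ≤⟨ four-Δ ⟩
      w                             ∎)
      where
      ar : ∀ d → 8 + 4 * d ≡ 4 * suc (suc d)
      ar = solve-∀
    Δ≤w : Δ ≤ w
    Δ≤w = ≤-trans (≤-trans (≤-trans (n≤1+n Δ) (n≤1+n (suc Δ))) (m≤n*m (suc (suc Δ)) 4)) four-Δ
    Δ<N : suc Δ ≤ N
    Δ<N = power {k = Δ} (≤-trans (n<2^n Δ) (^-monoˡ-≤ Δ 2≤r)) Δ≤w
    2≤N : 2 ≤ N
    2≤N = power {k = 1} 2≤r^1 (≤-trans (s≤s z≤n) 16≤w)
    E'≤N³ : E' ≤ N ^ 3
    E'≤N³ = ≤-trans (*-mono-≤ (*-mono-≤ 2≤N L'≤N) (≤-trans (n≤1+n Δ) Δ<N)) (≤-reflexive (ar N))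
      where
      ar : ∀ a → a * a * a ≡ a * (a * (a * 1))
      ar = solve-∀
    1024≤N : 1024 ≤ N
    1024≤N = power {k = 10} (^-monoˡ-≤ 10 2≤r) (≤-trans (m≤m+n 10 6) 16≤w)
    N-big' : suc r ^ (r * suc (suc Δ)) ≤ N
    N-big' = ≤-trans (^-monoˡ-≤ (r * suc (suc Δ)) suc-r≤) (≤-reflexive (^-*-assoc r 2 (r * suc (suc Δ))))
      where
      suc-r≤ : suc r ≤ r ^ 2
      suc-r≤ = begin
        1 + r        ≤⟨ +-mono-≤ (≤-trans (s≤s z≤n) 2≤r) (m≤m+n r 0) ⟩
        2 * r        ≤⟨ *-mono-≤ 2≤r (≤-reflexive (sym (*-identityʳ r))) ⟩
        r ^ 2        ∎
    P : Setting r n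
    P = record
      { F = F ; c = c ; c₀ = Fin.fromℕ< 2≤r ; Δ = Δ ; 0<Δ = ≤-trans (s≤s z≤n) 2≤Δ
      ; F-deg = λ i v → subst (_≤ Δ) (degree≡# (F i) v) (deg i v)
      ; D₀ = 2 * r ; 2r≤D₀ = ≤-refl ; N = N ; E = E' ; N-big = N-big' ; E-big = ≤-refl }
    open Conclusion P using (tiling-bound; Bstep)
    open Numerics P (power {k = 3} 4r≤ (≤-trans (m≤m+n 3 13) 16≤w)) (power {k = 4} 8r≤ (≤-trans (m≤m+n 4 12) 16≤w))
      L'≤N E'≤N³ Δ<N (power {k = 1} (≤-reflexive (sym (^-identityʳ r))) (≤-trans (s≤s z≤n) 16≤w)) 1024≤N using (total)
    exponent : w * 6 ≤ 24 * r * Δ ^ 3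
    exponent = begin
      2 * (r * suc (suc Δ)) * 6     ≤⟨ *-monoˡ-≤ 6 (*-monoʳ-≤ 2 (*-monoʳ-≤ r (+-monoˡ-≤ Δ 2≤Δ))) ⟩
      2 * (r * (Δ + Δ)) * 6         ≡⟨ ar r Δ ⟩
      24 * r * Δ ^ 1                ≤⟨ *-monoʳ-≤ (24 * r) (^-monoʳ-≤ Δ ⦃ >-nonZero (≤-trans (s≤s z≤n) 2≤Δ) ⦄ {1} {3} (s≤s z≤n)) ⟩
      24 * r * Δ ^ 3                ∎
      where
      ar : ∀ r d → 2 * (r * (d + d)) * 6 ≡ 24 * r * (d * 1)
      ar = solve-∀
    conclude : (∃ λ t → t ≤ N * Bstep × MonoTiling r n F c t) → ∃ λ t → t ≤ 2 ^ (2 ^ (r ^ (24 * r * Δ ^ 3))) × MonoTiling r n F c t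
    conclude (t , le , tiling) = t , ≤-trans le (≤-trans total (^-monoʳ-≤ 2 (^-monoʳ-≤ 2 (begin
      N ^ 6                   ≡⟨ ^-*-assoc r w 6 ⟩
      r ^ (w * 6)             ≤⟨ ^-monoʳ-≤ r exponent ⟩
      r ^ (24 * r * Δ ^ 3)    ∎)))) , tiling
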